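{- Let $n\ge1$, let $\alpha=(\alpha_1,\dots,\alpha_n)$ be a weak integer composition and let $\beta=(\beta_1,\dots,\beta_n)$ be a list of $n$ different positive integers. Then the sequences of generalized Demazure atoms $\{\mathcal{A}_{\beta,k\alpha}(\mathbf{x})\}_{k=1}^\infty$ and of non-symmetric integral form Hall--Littlewood polynomials $\{E_{k\alpha}(\mathbf{x};t)\}_{k=1}^\infty$ each satisfy a linear recurrence whose characteristic polynomial has simple roots.
   Context: A weak integer composition is a vector with non-negative integer entries; $k\alpha=(k\alpha_1,\dots,k\alpha_n)$. An augmented filling $T$ of shape $\alpha$ and basement $\beta$ (a list of $n$ distinct positive integers) is a filling of the boxes $(i,j)$, $1\le i\le n$, $1\le j\le\alpha_i$ ($i$ = row counted from the top, $j$ = column), with positive integers, augmented with a zeroth column (the basement) with entries $T(i,0)=\beta_i$. Two boxes $a,b$ (basement boxes included) are attacking if $T(a)=T(b)$ and either they are in the same column, or they are in adjacent columns with the rightmost box in a row strictly below the other box. A filling is non-attacking if it has no attacking pair of boxes. Triples in an augmented filling with weakly decreasing rows (basement boxes included). A triple of type A: boxes $a,b,c$ with $a$ immediately left of $b$, $c$ in the column of $b$ somewhere below $b$, and the row containing $a,b$ at least as long as the row containing $c$. A triple of type B: boxes $a,b,c$ with $a$ immediately left of $b$, $c$ in the column of $a$ somewhere above $a$, and the row containing $a,b$ strictly longer than the row containing $c$. A triple of either type is an inversion triple if $T(a)\ge T(c)\ge T(b)$. A semi-standard augmented filling is an augmented filling with weakly decreasing rows and without inversion triples; $\mathrm{SSAF}(\beta,\alpha)$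 is the (finite) set of those with basement $\beta$ and shape $\alpha$. The weight $w(T)=(w_1,w_2,\dots)$ has $w_i$ = number of boxes with content $i$, not including the basement, and $\mathbf{x}^{w(T)}=\prod_i x_i^{w_i}$. The generalized Demazure atoms are $$\mathcal{A}_{\beta,\alpha}(\mathbf{x})=\sum_{T\in\mathrm{SSAF}(\beta,\alpha)}\mathbf{x}^{w(T)}.$$ Let $\mathrm{NAWF}(\alpha)$ be the set of non-attacking augmented fillings of shape $\alpha$ with weakly decreasing rows and basement $\beta_i=i$. Define $$E_\alpha(\mathbf{x};t)=\sum_{T\in\mathrm{NAWF}(\alpha)}\mathbf{x}^{w(T)}t^{\mathrm{coinv}(T)}(1-t)^{\mathrm{dn}(T)},$$ where $\mathrm{coinv}(T)$ is the number of triples (of types A and B) in $T$ that are not inversion triples and $\mathrm{dn}(T)$ is the number of pairs of adjacent boxes $(i,j),(i,j+1)$ with $T(i,j)\ne T(i,j+1)$. A sequence $\{a_k\}_{k\ge1}$ of polynomials satisfies a linear recurrence with characteristic polynomial $u^r+c_1u^{r-1}+\dots+c_r$ (in an auxiliary variable $u$, with $c_i$ polynomials in the given variables, independent of $k$) if $a_k+c_1a_{k-1}+\dots+c_ra_{k-r}=0$ for all $k\ge r+1$. Simple roots means that the characteristic polynomial factors as $\prod_i(u-\rho_i)$ with pairwise distinct polynomials $\rho_i$. -}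

module Defs where

open import Algebra.Bundles.Raw using (RawRing)
import Algebra.Definitions.RawSemiring as RawSemiringDefs
open import Data.Fin.Base as Fin using (Fin; zero; suc; toℕ; inject₁)
import Data.Fin.Properties as Fin
open import Data.Integer.Base as ℤ using (ℤ; 0ℤ; 1ℤ)
open import Data.List.Base as List
  using (List; []; _∷_; [_]; _++_; allFin; upTo; concatMap; cartesianProduct; cartesianProductWith; filter; length)
open import Data.List.Membership.Propositional using (_∈_)
open import Data.List.Membership.Propositional.Properties
  using (∈-cartesianProductWith⁺; ∈-filter⁺; ∈-filter⁻; ∈-map⁺; ∈-upTo⁺)
open import Data.List.Relation.Unary.Any using (here)
open import Data.List.Relation.Unary.All using ([])
open import Data.List.Relation.Unary.AllPairs using ([]; _∷_)
open import Data.List.Relation.Unary.Unique.Propositional using (Unique)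
import Data.List.Relation.Unary.Unique.Propositional.Properties as Unique
open import Data.Nat.Base as ℕ using (ℕ; zero; suc; _≤_; _<_; s≤s; z≤n; _∸_; _⊔_)
import Data.Nat.Properties as ℕ
open import Data.Product using (Σ-syntax; ∃-syntax; _×_; _,_; proj₁; proj₂; uncurry; curry)
open import Data.Sum.Base using (_⊎_)
open import Data.Vec.Base as Vec using (Vec; []; _∷_; _∷ʳ_; lookup; tabulate; zipWith; replicate)
open import Data.Vec.Properties using (≡-dec)
open import Data.Vec.Relation.Binary.Pointwise.Inductive using (Pointwise)
open import Data.Vec.Relation.Unary.All using (All; []; _∷_)
open import Function.Base using (_∘_)
open import Function.Bundles using (_⇔_; mk⇔)
open import Level using (0ℓ)
open import Relation.Binary.PropositionalEquality using (_≡_; _≢_; refl; cong)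
open import Relation.Nullary using (¬_; Dec; yes; no; ¬?; _×-dec_; _⊎-dec_; _→-dec_; map′)
open import Relation.Unary using (Pred; Decidable)

------------------------------------------------------------------------
-- Polynomials over ℤ

Monomial : ℕ → Set
Monomial m = Vec ℕ m

-- A polynomial in m variables is a formal sum of integer multiples of
-- exponent vectors. Terms may repeat or vanish, so the equality of
-- polynomials is _≈ₚ_ and not _≡_.
Poly : ℕ → Set
Poly m = List (ℤ × Monomial m)

coeff : ∀ {m} → Monomial m → Poly m → ℤ
coeff e []            = 0ℤ
coeff e ((c , d) ∷ p) with ≡-dec ℕ._≟_ e d
... | yes _ = c ℤ.+ coeff e p
... | no  _ = coeff e p

infix 4 _≈ₚ_
_≈ₚ_ : ∀ {m} → Poly m → Poly m → Set
p ≈ₚ q = ∀ e → coeff e p ≡ coeff e q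

monomial : ∀ {m} → Monomial m → Poly m
monomial e = [ (1ℤ , e) ]

polyRing : ℕ → RawRing 0ℓ 0ℓ
polyRing m = record
  { Carrier = Poly m
  ; _≈_     = _≈ₚ_
  ; _+_     = _++_
  ; _*_     = cartesianProductWith λ (c , d) (c′ , d′) → c ℤ.* c′ , zipWith ℕ._+_ d d′
  ; -_      = List.map λ (c , d) → ℤ.- c , d
  ; 0#      = []
  ; 1#      = monomial (replicate m 0)
  }

------------------------------------------------------------------------
-- Linear recurrences

module Recurrence {c ℓ} (R : RawRing c ℓ) where

  open RawRing R
  open RawSemiringDefs rawSemiring using (sum)

  -- Univariate polynomials of degree r in u over R are vectors of
  -- coefficients, with the coefficient of uʳ first.

  charPoly : ∀ {r} → Vec Carrier r → Vec Carrier (suc r)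
  charPoly cs = 1# ∷ cs

  -- (u - ρ) p = u p - ρ p
  timesLinear : ∀ {r} → Carrier → Vec Carrier r → Vec Carrier (suc r)
  timesLinear ρ p = zipWith (λ x y → x + (- y)) (p ∷ʳ 0#) (0# ∷ Vec.map (ρ *_) p)

  prodLinear : ∀ {r} → Vec Carrier r → Vec Carrier (suc r)
  prodLinear []       = 1# ∷ []
  prodLinear (ρ ∷ ρs) = timesLinear ρ (prodLinear ρs)

  -- The sequence is a 1, a 2, …; the value a 0 is never used, because
  -- k ≥ r + 1.
  SatisfiesRecurrence : ∀ {r} → Vec Carrier r → (ℕ → Carrier) → Set ℓ
  SatisfiesRecurrence {r} cs a = ∀ k → suc r ≤ k →
    a k + sum (λ i → lookup cs i * a (k ∸ suc (toℕ i))) ≈ 0#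

  HasSimpleRoots : ∀ {r} → Vec Carrier (suc r) → Set _
  HasSimpleRoots {r} p = Σ[ ρ ∈ Vec Carrier r ]
    (∀ i j → i ≢ j → ¬ lookup ρ i ≈ lookup ρ j) ×
    Pointwise _≈_ p (prodLinear ρ)

  SimpleRootRecurrence : (ℕ → Carrier) → Set _
  SimpleRootRecurrence a = ∃[ r ] Σ[ cs ∈ Vec Carrier r ]
    SatisfiesRecurrence cs a × HasSimpleRoots (charPoly cs)

open Recurrence public using (SimpleRootRecurrence)

------------------------------------------------------------------------
-- Augmented fillings

-- Rows from top to bottom, the basement not included.
Filling : ∀ {n} → Vec ℕ n → Set
Filling α = All (Vec ℕ) α

row : ∀ {n} {α : Vec ℕ n} → Filling α → (i : Fin n) → Vec ℕ (lookup α i)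
row (r ∷ T) zero    = r
row (r ∷ T) (suc i) = row T i

module Augmented {n : ℕ} (β α : Vec ℕ n) where

  -- Boxes (i , j), including the basement boxes (i , 0).
  Box : Set
  Box = Σ[ i ∈ Fin n ] Fin (suc (lookup α i))

  boxes : List Box
  boxes = concatMap (λ i → List.map (i ,_) (allFin (suc (lookup α i)))) (allFin n)

  rowOf : Box → Fin n
  rowOf = proj₁

  col : Box → ℕ
  col (_ , j) = toℕ j

  rowLength : Box → ℕ
  rowLength b = lookup α (rowOf b)

  ImmediatelyLeft : Box → Box → Set
  ImmediatelyLeft a b = rowOf a ≡ rowOf b × suc (col a) ≡ col b

  TypeA : Box → Box → Box → Set
  TypeA a b c = ImmediatelyLeft a b × col c ≡ col b ×
                rowOf b Fin.< rowOf c × rowLength c ≤ rowLength a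

  TypeB : Box → Box → Box → Set
  TypeB a b c = ImmediatelyLeft a b × col c ≡ col a ×
                rowOf c Fin.< rowOf a × rowLength c < rowLength a

  Triple : Box → Box → Box → Set
  Triple a b c = TypeA a b c ⊎ TypeB a b c

  module _ (T : Filling α) where

    content : Box → ℕ
    content (i , j) = lookup (lookup β i ∷ row T i) j

    PositiveEntries : Set
    PositiveEntries = ∀ b → 1 ≤ col b → 1 ≤ content b

    WeaklyDecreasingRows : Set
    WeaklyDecreasingRows = ∀ a b → ImmediatelyLeft a b → content b ≤ content a

    Attacking : Box → Box → Set
    Attacking a b = content a ≡ content b ×
      (col a ≡ col b ⊎ (suc (col a) ≡ col b × rowOf a Fin.< rowOf b))

    NonAttacking : Set
    NonAttacking = ∀ a b → a ≢ b → ¬ Attacking a b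

    Inversion : Box → Box → Box → Set
    Inversion a b c = content c ≤ content a × content b ≤ content c

    NoInversionTriples : Set
    NoInversionTriples = ∀ a b c → Triple a b c → ¬ Inversion a b c

    IsSSAF : Set
    IsSSAF = PositiveEntries × WeaklyDecreasingRows × NoInversionTriples

    IsNAWF : Set
    IsNAWF = PositiveEntries × WeaklyDecreasingRows × NonAttacking

  ----------------------------------------------------------------------
  -- Decidability

  _≟-Box_ : (a b : Box) → Dec (a ≡ b)
  (i , j) ≟-Box (i′ , j′) with i Fin.≟ i′
  ... | no i≢i′ = no λ { refl → i≢i′ refl }
  ... | yes refl with j Fin.≟ j′
  ...   | yes refl = yes refl
  ...   | no j≢j′  = no λ { refl → j≢j′ refl }

  allBoxes? : ∀ {p} {P : Pred Box p} → Decidable P → Dec (∀ b → P b)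
  allBoxes? P? = map′ uncurry curry (Fin.all? λ i → Fin.all? λ j → P? (i , j))


  immediatelyLeft? : ∀ a b → Dec (ImmediatelyLeft a b)
  immediatelyLeft? a b = (rowOf a Fin.≟ rowOf b) ×-dec (suc (col a) ℕ.≟ col b)

  triple? : ∀ a b c → Dec (Triple a b c)
  triple? a b c =
    (immediatelyLeft? a b ×-dec (col c ℕ.≟ col b) ×-dec
      (rowOf b Fin.<? rowOf c) ×-dec (rowLength c ℕ.≤? rowLength a))
    ⊎-dec
    (immediatelyLeft? a b ×-dec (col c ℕ.≟ col a) ×-dec
      (rowOf c Fin.<? rowOf a) ×-dec (rowLength c ℕ.<? rowLength a))

  module _ (T : Filling α) where

    attacking? : ∀ a b → Dec (Attacking T a b)
    attacking? a b = (content T a ℕ.≟ content T b) ×-dec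
      ((col a ℕ.≟ col b) ⊎-dec ((suc (col a) ℕ.≟ col b) ×-dec (rowOf a Fin.<? rowOf b)))

    inversion? : ∀ a b c → Dec (Inversion T a b c)
    inversion? a b c = (content T c ℕ.≤? content T a) ×-dec (content T b ℕ.≤? content T c)

    positiveEntries? : Dec (PositiveEntries T)
    positiveEntries? = allBoxes? λ b → (1 ℕ.≤? col b) →-dec (1 ℕ.≤? content T b)

    weaklyDecreasingRows? : Dec (WeaklyDecreasingRows T)
    weaklyDecreasingRows? = allBoxes? λ a → allBoxes? λ b →
      immediatelyLeft? a b →-dec (content T b ℕ.≤? content T a)

    isSSAF? : Dec (IsSSAF T)
    isSSAF? = positiveEntries? ×-dec weaklyDecreasingRows? ×-dec
      (allBoxes? λ a → allBoxes? λ b → allBoxes? λ c →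
        triple? a b c →-dec ¬? (inversion? a b c))

    isNAWF? : Dec (IsNAWF T)
    isNAWF? = positiveEntries? ×-dec weaklyDecreasingRows? ×-dec
      (allBoxes? λ a → allBoxes? λ b →
        ¬? (a ≟-Box b) →-dec ¬? (attacking? a b))

  ----------------------------------------------------------------------
  -- Statistics

    -- Exponents of x₁, …, x_m; the coordinate i : Fin m belongs to the
    -- content i + 1.
    weight : (m : ℕ) → Vec ℕ m
    weight m = tabulate λ i → length
      (filter (λ b → (1 ℕ.≤? col b) ×-dec (content T b ℕ.≟ suc (toℕ i))) boxes)

    coinv : ℕ
    coinv = length (filter
      (λ (a , b , c) → triple? a b c ×-dec ¬? (inversion? a b c))
      (cartesianProduct boxes (cartesianProduct boxes boxes)))

    dn : ℕ
    dn = length (filter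
      (λ (a , b) → immediatelyLeft? a b ×-dec ¬? (content T a ℕ.≟ content T b))
      (cartesianProduct boxes boxes))

open Augmented public using (IsSSAF; IsNAWF)

------------------------------------------------------------------------
-- Enumeration of SSAF(β , α) and of its non-attacking analogue

maximum : ∀ {n} → Vec ℕ n → ℕ
maximum = Vec.foldr′ _⊔_ 0

rows : ℕ → (k : ℕ) → List (Vec ℕ k)
rows m zero    = [ [] ]
rows m (suc k) = cartesianProductWith _∷_ (List.map suc (upTo m)) (rows m k)

-- All fillings with entries in {1, …, m}.
fillings : ∀ {n} → ℕ → (α : Vec ℕ n) → List (Filling α)
fillings m []      = [ [] ]
fillings m (k ∷ α) = cartesianProductWith _∷_ (rows m k) (fillings m α)

-- Since rows weakly decrease, no entry exceeds the largest basement
-- entry; see ∈-ssaf and ∈-nawf below.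

ssaf : ∀ {n} (β α : Vec ℕ n) → List (Filling α)
ssaf β α = filter (Augmented.isSSAF? β α) (fillings (maximum β) α)

nawf : ∀ {n} (β α : Vec ℕ n) → List (Filling α)
nawf β α = filter (Augmented.isNAWF? β α) (fillings (maximum β) α)

private

  ∈-rows : ∀ m {k} (v : Vec ℕ k) → (∀ j → 1 ≤ lookup v j × lookup v j ≤ m) → v ∈ rows m k
  ∈-rows m []      h = here refl
  ∈-rows m (x ∷ v) h = ∈-cartesianProductWith⁺ _∷_ (entry x (h zero)) (∈-rows m v (h ∘ suc))
    where
    entry : ∀ x → 1 ≤ x × x ≤ m → x ∈ List.map suc (upTo m)
    entry (suc x) (_ , x<m) = ∈-map⁺ suc (∈-upTo⁺ x<m)

  ∈-fillings : ∀ m {n} {α : Vec ℕ n} (T : Filling α) →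
    (∀ i j → 1 ≤ lookup (row T i) j × lookup (row T i) j ≤ m) → T ∈ fillings m α
  ∈-fillings m []      h = here refl
  ∈-fillings m (r ∷ T) h =
    ∈-cartesianProductWith⁺ _∷_ (∈-rows m r (h zero)) (∈-fillings m T (h ∘ suc))

  rows-unique : ∀ m k → Unique (rows m k)
  rows-unique m zero    = [] ∷ []
  rows-unique m (suc k) = Unique.cartesianProductWith⁺ _∷_ (λ { refl → refl , refl })
    (Unique.map⁺ ℕ.suc-injective (Unique.upTo⁺ m)) (rows-unique m k)

  fillings-unique : ∀ m {n} (α : Vec ℕ n) → Unique (fillings m α)
  fillings-unique m []      = [] ∷ []
  fillings-unique m (k ∷ α) = Unique.cartesianProductWith⁺ _∷_ (λ { refl → refl , refl })
    (rows-unique m k) (fillings-unique m α)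

  lookup≤maximum : ∀ {n} (β : Vec ℕ n) i → lookup β i ≤ maximum β
  lookup≤maximum (b ∷ β) zero    = ℕ.m≤m⊔n b (maximum β)
  lookup≤maximum (b ∷ β) (suc i) = ℕ.≤-trans (lookup≤maximum β i) (ℕ.m≤n⊔m b (maximum β))

  descending : ∀ {k} (v : Vec ℕ (suc k)) →
    (∀ j → lookup v (suc j) ≤ lookup v (inject₁ j)) → ∀ j → lookup v j ≤ lookup v zero
  descending v           h zero    = ℕ.≤-refl
  descending (x ∷ y ∷ v) h (suc j) =
    ℕ.≤-trans (descending (y ∷ v) (h ∘ suc) j) (h zero)

  module _ {n} (β α : Vec ℕ n) where

    open Augmented β α using (PositiveEntries; WeaklyDecreasingRows)

    enumerated : ∀ T → PositiveEntries T → WeaklyDecreasingRows T → T ∈ fillings (maximum β) α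
    enumerated T pos dec = ∈-fillings (maximum β) T λ i j →
      pos (i , suc j) (s≤s z≤n) ,
      ℕ.≤-trans
        (descending (lookup β i ∷ row T i)
          (λ j′ → dec (i , inject₁ j′) (i , suc j′) (refl , cong suc (Fin.toℕ-inject₁ j′)))
          (suc j))
        (lookup≤maximum β i)

    module _ {P : Pred (Filling α) 0ℓ} (P? : Decidable P) where

      filtered-unique : Unique (filter P? (fillings (maximum β) α))
      filtered-unique = Unique.filter⁺ P? (fillings-unique (maximum β) α)

      ∈-filtered : (∀ T → P T → PositiveEntries T × WeaklyDecreasingRows T) →
        ∀ T → T ∈ filter P? (fillings (maximum β) α) ⇔ P T
      ∈-filtered adm T = mk⇔
        (λ T∈ → proj₂ (∈-filter⁻ P? {xs = fillings (maximum β) α} T∈))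
        (λ h → ∈-filter⁺ P? (uncurry (enumerated T) (adm T h)) h)

module _ {n} (β α : Vec ℕ n) where

  open Augmented β α using (isSSAF?; isNAWF?)

  ∈-ssaf : ∀ T → T ∈ ssaf β α ⇔ IsSSAF β α T
  ∈-ssaf = ∈-filtered β α {P = IsSSAF β α} isSSAF? λ _ (pos , dec , _) → pos , dec

  ssaf-unique : Unique (ssaf β α)
  ssaf-unique = filtered-unique β α {P = IsSSAF β α} isSSAF?

  ∈-nawf : ∀ T → T ∈ nawf β α ⇔ IsNAWF β α T
  ∈-nawf = ∈-filtered β α {P = IsNAWF β α} isNAWF? λ _ (pos , dec , _) → pos , dec

  nawf-unique : Unique (nawf β α)
  nawf-unique = filtered-unique β α {P = IsNAWF β α} isNAWF?

------------------------------------------------------------------------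
-- Generalized Demazure atoms and non-symmetric Hall–Littlewood polynomials

-- Polynomials in x₁, …, x_m, where m is the largest basement entry.
atom : ∀ {n} (β α : Vec ℕ n) → Poly (maximum β)
atom β α = List.foldr (λ T p → monomial (Augmented.weight β α T (maximum β)) + p) 0# (ssaf β α)
  where open RawRing (polyRing (maximum β))

standardBasement : (n : ℕ) → Vec ℕ n
standardBasement n = tabulate (suc ∘ toℕ)

-- Polynomials in t, x₁, …, x_n, with t the variable of index zero.
hallLittlewood : ∀ {n} → Vec ℕ n → Poly (suc n)
hallLittlewood {n} α = List.foldr (λ T p → term T + p) 0# (nawf β α)
  where
  open RawRing (polyRing (suc n))
  open RawSemiringDefs rawSemiring using (_^_)

  β : Vec ℕ n
  β = standardBasement n

  t : Poly (suc n)
  t = monomial (1 ∷ replicate n 0)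

  term : Filling α → Poly (suc n)
  term T = monomial (0 ∷ Augmented.weight β α T n)
         * t ^ Augmented.coinv β α T
         * (1# + (- t)) ^ Augmented.dn β α T

infixr 7 _·_
_·_ : ∀ {n} → ℕ → Vec ℕ n → Vec ℕ n
k · α = Vec.map (k ℕ.*_) α

{-# OPTIONS --safe #-}

-- Continue every row of a filling past its last box by repeating its last
-- entry. A filling then is a sequence of columns, each componentwise at most
-- the one before, and all conditions and statistics are local to pairs of
-- adjacent columns. For the shape kα the columns kv + 1, …, k(v + 1) have boxes
-- in the same rows, so the generating function is a product of transfer
-- matrices in which the matrix of each block occurs to the power k - 1. That
-- matrix is triangular and its diagonal entries are monomials. Along a chain
-- of columns these are distinct, because Σ i wᵢ is the sum of the entries of
-- the column. Hence its powers, and so the whole product, are of the form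
-- Σ c_ρ ρᵏ with monomials ρ and coefficients c_ρ in the fraction field, and
-- ∏ (u - ρ) over the distinct ρ is a characteristic polynomial.

module Submission where

open import Defs
open import Data.Nat.Base using (ℕ; suc; _≤_)
open import Data.Product.Base using (_×_)
open import Data.Vec.Base using (Vec)
open import Data.Vec.Relation.Unary.All using (All)
open import Data.Vec.Relation.Unary.Unique.Propositional using (Unique)

open import Algebra.Bundles using (CommutativeRing; CommutativeSemiring)
open import Algebra.Bundles.Raw using (RawRing)
import Algebra.Definitions.RawSemiring as RawSemiringDefs
open import Algebra.Structures using (IsCommutativeRing)
open import Data.Empty using (⊥-elim)
open import Data.Fin.Base as Fin using (Fin; zero; suc; toℕ; fromℕ<)
import Data.Fin.Properties as Fin
open import Data.Integer.Base as ℤ using (ℤ; 0ℤ; 1ℤ)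
import Data.Integer.Properties as ℤ
open import Data.List.Base as List
  using (List; []; _∷_; _++_; [_]; allFin; cartesianProduct; cartesianProductWith; concatMap;
         deduplicate; filter; length; upTo)
import Data.List.Properties as List
open import Data.List.Membership.Propositional using (_∈_)
open import Data.List.Membership.Propositional.Properties
  using (∈-allFin; ∈-cartesianProductWith⁺; ∈-cartesianProductWith⁻; ∈-deduplicate⁺; ∈-map⁺; ∈-map⁻;
         ∈-upTo⁺; ∈-upTo⁻)
open import Data.List.Relation.Unary.All as ListAll using ([]; _∷_)
import Data.List.Relation.Unary.All.Properties as ListAll
open import Data.List.Relation.Unary.AllPairs using ([]; _∷_)
open import Data.List.Relation.Unary.Any using (here; there)
import Data.List.Relation.Unary.Unique.Propositional as ListUnique
import Data.List.Relation.Unary.Unique.Propositional.Properties as ListUnique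
open import Data.List.Relation.Unary.Unique.DecPropositional.Properties using (deduplicate-!)
open import Data.Nat.Base as ℕ using (zero; pred; _<_; _∸_; s≤s; z≤n)
import Data.Nat.Properties as ℕ
open import Data.Product.Base using (∃-syntax; _,_; proj₁; proj₂)
open import Data.Sum.Base using (_⊎_; inj₁; inj₂)
open import Data.Unit.Base using (tt)
open import Data.Vec.Base as Vec using ([]; _∷_; _∷ʳ_; fromList; lookup; replicate; tabulate; zipWith)
open import Data.Vec.Properties as Vec
  using (lookup∘tabulate; lookup-map; lookup-zipWith; tabulate∘lookup; tabulate-cong; ≡-dec)
open import Data.Vec.Relation.Binary.Pointwise.Inductive as Pointwise using (Pointwise; []; _∷_)
open import Data.Vec.Relation.Unary.All as All using ([]; _∷_)
import Data.Vec.Relation.Unary.All.Properties as All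
open import Data.Vec.Relation.Unary.AllPairs using ([]; _∷_)
import Data.Vec.Relation.Unary.Unique.Propositional.Properties as Unique
open import Function.Base using (_∘_; const; id)
open import Level using (0ℓ)
open import Relation.Binary.Definitions using (DecidableEquality; tri<; tri≈; tri>)
open import Relation.Binary.PropositionalEquality as ≡ using (_≡_; _≢_; cong; cong₂; subst; subst₂)
open import Relation.Binary.Structures using (IsEquivalence)
open import Relation.Nullary using (¬_; Dec; yes; no; contradiction; ¬?; _×-dec_; _→-dec_; map′)
open import Relation.Unary using (Decidable; Pred; U)

-- Different columns may share a monomial, so a transfer matrix can have repeated eigenvalues. Only
-- a coincidence along one chain of columns could produce terms k ρᵏ, and there every change of
-- column lowers the sum of the entries. So each state gives a first-order recurrence whose ratio
-- differs from all ratios that reach it from below. The denominators are products of differences of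
-- such monomials. The first step into a block needs its own matrix: its left column closes the
-- previous block, where further rows may still have boxes, and type B triples and attacks between
-- adjacent columns see these boxes. A diagonal entry is nonzero only at columns with distinct
-- entries. Non-attacking fillings have this by definition; for semi-standard ones it has to be
-- derived from the absence of inversion triples. For Hall-Littlewood polynomials t gets degree 0,
-- so that degrees compare the exponents of x alone, and the factors 1 - t stay off the diagonal
-- because `dn` vanishes there. Finally, the vector to which a matrix power is applied, namely the
-- later blocks, itself depends on k.

-- Finite sums over lists, with indicators of decidable conditions.

module ListSum (S : CommutativeSemiring 0ℓ 0ℓ) where

  open CommutativeSemiring S
  open import Relation.Binary.Reasoning.Setoid setoid
  open import Algebra.Properties.CommutativeSemigroup +-commutativeSemigroup using (interchange)

  private variable
    A B C : Set

  sumOver : List A → (A → Carrier) → Carrier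
  sumOver xs f = List.foldr (λ x s → f x + s) 0# xs

  infix 5 sumOver
  syntax sumOver xs (λ x → t) = ∑[ x ← xs ] t

  sum-cong-∈ : ∀ (xs : List A) {f g : A → Carrier} →
    (∀ x → x ∈ xs → f x ≈ g x) → sumOver xs f ≈ sumOver xs g
  sum-cong-∈ []       eq = refl
  sum-cong-∈ (x ∷ xs) eq = +-cong (eq x (here ≡.refl)) (sum-cong-∈ xs λ y y∈ → eq y (there y∈))

  sum-cong : ∀ (xs : List A) {f g : A → Carrier} → (∀ x → f x ≈ g x) → sumOver xs f ≈ sumOver xs g
  sum-cong xs eq = sum-cong-∈ xs λ x _ → eq x

  sum-0 : ∀ (xs : List A) → (∑[ x ← xs ] 0#) ≈ 0#
  sum-0 []       = refl
  sum-0 (x ∷ xs) = trans (+-identityˡ _) (sum-0 xs)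

  sum-+ : ∀ (xs : List A) (f g : A → Carrier) →
    (∑[ x ← xs ] f x + g x) ≈ sumOver xs f + sumOver xs g
  sum-+ []       f g = sym (+-identityˡ 0#)
  sum-+ (x ∷ xs) f g = trans (+-congˡ (sum-+ xs f g)) (interchange _ _ _ _)

  sum-*ˡ : ∀ (xs : List A) c (f : A → Carrier) → (∑[ x ← xs ] c * f x) ≈ c * sumOver xs f
  sum-*ˡ []       c f = sym (zeroʳ c)
  sum-*ˡ (x ∷ xs) c f = trans (+-congˡ (sum-*ˡ xs c f)) (sym (distribˡ c _ _))

  sum-*ʳ : ∀ (xs : List A) c (f : A → Carrier) → (∑[ x ← xs ] f x * c) ≈ sumOver xs f * c
  sum-*ʳ xs c f = trans (sum-cong xs λ x → *-comm (f x) c) (trans (sum-*ˡ xs c f) (*-comm c _))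

  sum-swap : ∀ (xs : List A) (ys : List B) (f : A → B → Carrier) →
    (∑[ x ← xs ] ∑[ y ← ys ] f x y) ≈ (∑[ y ← ys ] ∑[ x ← xs ] f x y)
  sum-swap []       ys f = sym (sum-0 ys)
  sum-swap (x ∷ xs) ys f = trans (+-congˡ (sum-swap xs ys f)) (sym (sum-+ ys (f x) _))

  sum-++ : ∀ (xs ys : List A) (f : A → Carrier) →
    sumOver (xs ++ ys) f ≈ sumOver xs f + sumOver ys f
  sum-++ []       ys f = sym (+-identityˡ _)
  sum-++ (x ∷ xs) ys f = trans (+-congˡ (sum-++ xs ys f)) (sym (+-assoc _ _ _))

  sum-map : ∀ (g : A → B) (xs : List A) (f : B → Carrier) →
    sumOver (List.map g xs) f ≡ sumOver xs (f ∘ g)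
  sum-map g []       f = ≡.refl
  sum-map g (x ∷ xs) f = ≡.cong (f (g x) +_) (sum-map g xs f)

  sum-concatMap : ∀ (g : A → List B) (xs : List A) (f : B → Carrier) →
    sumOver (concatMap g xs) f ≈ (∑[ x ← xs ] sumOver (g x) f)
  sum-concatMap g []       f = refl
  sum-concatMap g (x ∷ xs) f = trans (sum-++ (g x) _ f) (+-congˡ (sum-concatMap g xs f))

  sum-cartesianProductWith : ∀ (g : A → B → C) xs ys (f : C → Carrier) →
    sumOver (cartesianProductWith g xs ys) f ≈ (∑[ x ← xs ] ∑[ y ← ys ] f (g x y))
  sum-cartesianProductWith g []       ys f = refl
  sum-cartesianProductWith g (x ∷ xs) ys f = trans
    (sum-++ (List.map (g x) ys) _ f)
    (+-cong (reflexive (sum-map (g x) ys f)) (sum-cartesianProductWith g xs ys f))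

  ifYes : ∀ {P : Set} → Dec P → Carrier → Carrier
  ifYes (yes _) x = x
  ifYes (no  _) x = 0#

  ifYes-cong : ∀ {P Q : Set} (P? : Dec P) (Q? : Dec Q) {x y} →
    (P → Q) → (Q → P) → (P → x ≈ y) → ifYes P? x ≈ ifYes Q? y
  ifYes-cong (yes p) (yes q) P⇒Q Q⇒P eq = eq p
  ifYes-cong (yes p) (no ¬q) P⇒Q Q⇒P eq = ⊥-elim (¬q (P⇒Q p))
  ifYes-cong (no ¬p) (yes q) P⇒Q Q⇒P eq = ⊥-elim (¬p (Q⇒P q))
  ifYes-cong (no ¬p) (no ¬q) P⇒Q Q⇒P eq = refl

  ifYes-no : ∀ {P : Set} (P? : Dec P) {x} → ¬ P → ifYes P? x ≈ 0#
  ifYes-no (yes p) ¬p = ⊥-elim (¬p p)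
  ifYes-no (no _)  ¬p = refl

  ifYes-yes : ∀ {P : Set} (P? : Dec P) {x} → P → ifYes P? x ≈ x
  ifYes-yes (yes _) p = refl
  ifYes-yes (no ¬p) p = ⊥-elim (¬p p)

  ifYes-split : ∀ {P Q R : Set} (R? : Dec R) (P? : Dec P) (Q? : Dec Q) {x} →
    (R → P × Q) → (P → Q → R) → ifYes R? x ≈ ifYes P? (ifYes Q? x)
  ifYes-split (yes r) P?      Q? R⇒ ⇒R =
    sym (trans (ifYes-yes P? (proj₁ (R⇒ r))) (ifYes-yes Q? (proj₂ (R⇒ r))))
  ifYes-split (no ¬r) (no _)  Q? R⇒ ⇒R = refl
  ifYes-split (no ¬r) (yes p) Q? R⇒ ⇒R = sym (ifYes-no Q? λ q → ¬r (⇒R p q))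

  ifYes-swap : ∀ {P Q : Set} (P? : Dec P) (Q? : Dec Q) {x} →
    ifYes P? (ifYes Q? x) ≈ ifYes Q? (ifYes P? x)
  ifYes-swap (yes _) Q?      = refl
  ifYes-swap (no _)  (yes _) = refl
  ifYes-swap (no _)  (no _)  = refl

  ifYes-*ʳ : ∀ {P : Set} (P? : Dec P) x y → ifYes P? x * y ≈ ifYes P? (x * y)
  ifYes-*ʳ (yes _) x y = refl
  ifYes-*ʳ (no _)  x y = zeroˡ y

  sum-filter : ∀ {P : Pred A 0ℓ} (P? : Decidable P) xs (f : A → Carrier) →
    sumOver (filter P? xs) f ≈ (∑[ x ← xs ] ifYes (P? x) (f x))
  sum-filter P? []       f = refl
  sum-filter P? (x ∷ xs) f with P? x
  ... | yes _ = +-congˡ (sum-filter P? xs f)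
  ... | no  _ = trans (sum-filter P? xs f) (sym (+-identityˡ _))

  module _ (_≟_ : (x y : A) → Dec (x ≡ y)) where

    sum-δ-∉ : ∀ (xs : List A) {x} → ListAll.All (x ≢_) xs → (f : A → Carrier) →
      (∑[ y ← xs ] ifYes (x ≟ y) (f y)) ≈ 0#
    sum-δ-∉ []       []          f = refl
    sum-δ-∉ (y ∷ ys) {x} (x≢y ∷ x∉) f =
      trans (+-cong (ifYes-no (x ≟ y) x≢y) (sum-δ-∉ ys x∉ f)) (+-identityˡ 0#)

    sum-δ : ∀ {xs : List A} → ListUnique.Unique xs → ∀ {x} → x ∈ xs → (f : A → Carrier) →
      (∑[ y ← xs ] ifYes (x ≟ y) (f y)) ≈ f x
    sum-δ {y ∷ ys} (y∉ ∷ u) {x} (here ≡.refl) f =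
      trans (+-cong (ifYes-yes (x ≟ x) ≡.refl) (sum-δ-∉ ys y∉ f)) (+-identityʳ (f x))
    sum-δ {y ∷ ys} (y∉ ∷ u) {x} (there x∈) f = trans
      (+-cong (ifYes-no (x ≟ y) λ x≡y → ListAll.lookup y∉ x∈ (≡.sym x≡y)) (sum-δ u x∈ f))
      (+-identityˡ (f x))

    sum-isolate : ∀ {xs : List A} → ListUnique.Unique xs → ∀ {x} → x ∈ xs → (f : A → Carrier) →
      sumOver xs f ≈ f x + (∑[ y ← xs ] ifYes (¬? (x ≟ y)) (f y))
    sum-isolate {xs} u {x} x∈ f = begin
      sumOver xs f
        ≈⟨ sum-cong xs split ⟩
      (∑[ y ← xs ] ifYes (x ≟ y) (f y) + ifYes (¬? (x ≟ y)) (f y))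
        ≈⟨ sum-+ xs _ _ ⟩
      (∑[ y ← xs ] ifYes (x ≟ y) (f y)) + (∑[ y ← xs ] ifYes (¬? (x ≟ y)) (f y))
        ≈⟨ +-congʳ (sum-δ u x∈ f) ⟩
      f x + (∑[ y ← xs ] ifYes (¬? (x ≟ y)) (f y)) ∎
      where
      split : ∀ y → f y ≈ ifYes (x ≟ y) (f y) + ifYes (¬? (x ≟ y)) (f y)
      split y with x ≟ y
      ... | yes _ = sym (+-identityʳ _)
      ... | no  _ = sym (+-identityˡ _)

-- Exponential sums with monomial ratios.

record MonomialRing : Set₁ where
  infixl 7 _⊕_
  field
    commutativeRing : CommutativeRing 0ℓ 0ℓ
  open CommutativeRing commutativeRing public
  field
    Exponent  : Set
    mon       : Exponent → Carrier
    _⊕_       : Exponent → Exponent → Exponent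
    𝟘         : Exponent
    mon-⊕     : ∀ d e → mon (d ⊕ e) ≈ mon d * mon e
    mon-𝟘     : mon 𝟘 ≈ 1#

module ExponentialSums (M : MonomialRing) where

  open MonomialRing M
  open import Relation.Binary.Reasoning.Setoid setoid
  open import Algebra.Properties.Semiring.Exp semiring public using (_^_; ^-congˡ)
  open import Algebra.Properties.CommutativeSemiring.Exp commutativeSemiring using (^-distrib-*)
  open import Algebra.Properties.Ring ring using (-‿distribˡ-*)
  open import Algebra.Properties.Group +-group using (x∙y⁻¹≈ε⇒x≈y)
  open import Algebra.Solver.Ring.NaturalCoefficients.Default commutativeSemiring
    using (solve; _:=_; _:+_; _:*_)
  open ListSum commutativeSemiring

  Regular : Carrier → Set
  Regular d = ∀ x → d * x ≈ 0# → x ≈ 0#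

  regular-1 : Regular 1#
  regular-1 x eq = trans (sym (*-identityˡ x)) eq

  regular-* : ∀ {d d′} → Regular d → Regular d′ → Regular (d * d′)
  regular-* r r′ x eq = r′ x (r _ (trans (sym (*-assoc _ _ x)) eq))

  -- Turns regularity into a comparison of two products, which for monomials x and y are two shifts
  -- of the same polynomial.
  regular-difference : ∀ {x y} → (∀ z → x * z ≈ y * z → z ≈ 0#) → Regular (x - y)
  regular-difference {x} {y} h z eq = h z (x∙y⁻¹≈ε⇒x≈y (x * z) (y * z) (begin
    x * z + - (y * z)   ≈⟨ +-congˡ (-‿distribˡ-* y z) ⟩
    x * z + (- y) * z   ≈⟨ distribʳ z x (- y) ⟨
    (x - y) * z         ≈⟨ eq ⟩
    0#                  ∎))

  ExpSum : Set
  ExpSum = List (Carrier × Exponent)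

  eval : ExpSum → ℕ → Carrier
  eval L k = ∑[ (c , e) ← L ] c * mon e ^ k

  -- The common denominator takes the place of the fraction field, in which
  -- the coefficients of an exponential sum live.
  record IsExpSum (P : Pred Exponent 0ℓ) (b : ℕ → Carrier) : Set where
    constructor isExpSum
    field
      denominator : Carrier
      regular     : Regular denominator
      terms       : ExpSum
      exponents   : ListAll.All (P ∘ proj₂) terms
      expansion   : ∀ k → denominator * b k ≈ eval terms k

  private variable
    P Q : Pred Exponent 0ℓ
    a b : ℕ → Carrier

  expSum-cong : (∀ k → a k ≈ b k) → IsExpSum P a → IsExpSum P b
  expSum-cong eq (isExpSum D r L p x) =
    isExpSum D r L p λ k → trans (*-congˡ (sym (eq k))) (x k)

  expSum-⊆ : (∀ {e} → P e → Q e) → IsExpSum P b → IsExpSum Q b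
  expSum-⊆ P⊆Q (isExpSum D r L p x) = isExpSum D r L (ListAll.map P⊆Q p) x

  expSum-0 : IsExpSum P (const 0#)
  expSum-0 = isExpSum 1# regular-1 [] [] λ k → *-identityˡ 0#

  expSum-mon : ∀ c {e} → P e → IsExpSum P (λ k → c * mon e ^ k)
  expSum-mon c p = isExpSum 1# regular-1 [ _ ] (p ∷ []) λ k →
    trans (*-identityˡ _) (sym (+-identityʳ _))

  1^ : ∀ k → 1# ^ k ≈ 1#
  1^ zero    = refl
  1^ (suc k) = trans (*-identityˡ _) (1^ k)

  expSum-const : ∀ c → IsExpSum U (const c)
  expSum-const c = expSum-cong
    (λ k → trans (*-congˡ (trans (^-congˡ k mon-𝟘) (1^ k))) (*-identityʳ c))
    (expSum-mon c {𝟘} tt)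

  scale : Carrier → ExpSum → ExpSum
  scale c = List.map λ (c′ , e) → c * c′ , e

  eval-scale : ∀ c L k → eval (scale c L) k ≈ c * eval L k
  eval-scale c L k = begin
    eval (scale c L) k                      ≡⟨ sum-map _ L _ ⟩
    (∑[ (c′ , e) ← L ] c * c′ * mon e ^ k)   ≈⟨ sum-cong L (λ _ → *-assoc _ _ _) ⟩
    (∑[ (c′ , e) ← L ] c * (c′ * mon e ^ k)) ≈⟨ sum-*ˡ L c _ ⟩
    c * eval L k                            ∎

  scale-exponents : ∀ c {L} → ListAll.All (P ∘ proj₂) L → ListAll.All (P ∘ proj₂) (scale c L)
  scale-exponents c = ListAll.map⁺

  expSum-+ : IsExpSum P a → IsExpSum P b → IsExpSum P (λ k → a k + b k)
  expSum-+ {a = a} {b = b} (isExpSum D r L p x) (isExpSum D′ r′ L′ p′ x′) = isExpSum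
    (D * D′) (regular-* r r′) (scale D′ L ++ scale D L′)
    (ListAll.++⁺ (scale-exponents D′ p) (scale-exponents D p′)) λ k → begin
      D * D′ * (a k + b k)
        ≈⟨ solve 4 (λ D D′ a b → D :* D′ :* (a :+ b) := D′ :* (D :* a) :+ D :* (D′ :* b)) refl
             D D′ (a k) (b k) ⟩
      D′ * (D * a k) + D * (D′ * b k)
        ≈⟨ +-cong (*-congˡ (x k)) (*-congˡ (x′ k)) ⟩
      D′ * eval L k + D * eval L′ k
        ≈⟨ +-cong (eval-scale D′ L k) (eval-scale D L′ k) ⟨
      eval (scale D′ L) k + eval (scale D L′) k
        ≈⟨ sum-++ (scale D′ L) (scale D L′) _ ⟨
      eval (scale D′ L ++ scale D L′) k ∎

  expSum-*ˡ : ∀ c → IsExpSum P b → IsExpSum P (λ k → c * b k)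
  expSum-*ˡ {b = b} c (isExpSum D r L p x) = isExpSum D r (scale c L) (scale-exponents c p) λ k → begin
    D * (c * b k)       ≈⟨ solve 3 (λ D c b → D :* (c :* b) := c :* (D :* b)) refl D c (b k) ⟩
    c * (D * b k)       ≈⟨ *-congˡ (x k) ⟩
    c * eval L k        ≈⟨ eval-scale c L k ⟨
    eval (scale c L) k  ∎

  expSum-sum : ∀ {A : Set} (xs : List A) {f : A → ℕ → Carrier} →
    (∀ x → x ∈ xs → IsExpSum P (f x)) → IsExpSum P (λ k → ∑[ x ← xs ] f x k)
  expSum-sum []       h = expSum-0
  expSum-sum (x ∷ xs) h =
    expSum-+ (h x (here ≡.refl)) (expSum-sum xs λ y y∈ → h y (there y∈))

  _⊗_ : ExpSum → ExpSum → ExpSum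
  _⊗_ = cartesianProductWith λ (c , d) (c′ , d′) → c * c′ , d ⊕ d′

  eval-⊗ : ∀ L L′ k → eval (L ⊗ L′) k ≈ eval L k * eval L′ k
  eval-⊗ L L′ k = begin
    eval (L ⊗ L′) k
      ≈⟨ sum-cartesianProductWith _ L L′ _ ⟩
    (∑[ (c , d) ← L ] ∑[ (c′ , d′) ← L′ ] c * c′ * mon (d ⊕ d′) ^ k)
      ≈⟨ sum-cong L (λ (c , d) → sum-cong L′ λ (c′ , d′) → split c c′ d d′) ⟩
    (∑[ (c , d) ← L ] ∑[ (c′ , d′) ← L′ ] (c * mon d ^ k) * (c′ * mon d′ ^ k))
      ≈⟨ sum-cong L (λ _ → sum-*ˡ L′ _ _) ⟩
    (∑[ (c , d) ← L ] (c * mon d ^ k) * eval L′ k)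
      ≈⟨ sum-*ʳ L _ _ ⟩
    eval L k * eval L′ k ∎
    where
    split : ∀ c c′ d d′ →
      c * c′ * mon (d ⊕ d′) ^ k ≈ (c * mon d ^ k) * (c′ * mon d′ ^ k)
    split c c′ d d′ = begin
      c * c′ * mon (d ⊕ d′) ^ k
        ≈⟨ *-congˡ (trans (^-congˡ k (mon-⊕ d d′)) (^-distrib-* (mon d) (mon d′) k)) ⟩
      c * c′ * (mon d ^ k * mon d′ ^ k)
        ≈⟨ solve 4 (λ c c′ x y → c :* c′ :* (x :* y) := (c :* x) :* (c′ :* y)) refl
             c c′ (mon d ^ k) (mon d′ ^ k) ⟩
      (c * mon d ^ k) * (c′ * mon d′ ^ k) ∎

  -- Exponents of a product are sums `d ⊕ d′`, so a bound on the degrees of the factors does not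
  -- carry over; hence `U`.
  expSum-* : IsExpSum U a → IsExpSum U b → IsExpSum U (λ k → a k * b k)
  expSum-* {a = a} {b = b} (isExpSum D r L p x) (isExpSum D′ r′ L′ p′ x′) = isExpSum
    (D * D′) (regular-* r r′) (L ⊗ L′) (ListAll.universal (λ _ → tt) _) λ k → begin
      D * D′ * (a k * b k)
        ≈⟨ solve 4 (λ D D′ a b → D :* D′ :* (a :* b) := (D :* a) :* (D′ :* b)) refl
             D D′ (a k) (b k) ⟩
      (D * a k) * (D′ * b k)    ≈⟨ *-cong (x k) (x′ k) ⟩
      eval L k * eval L′ k      ≈⟨ eval-⊗ L L′ k ⟨
      eval (L ⊗ L′) k           ∎

  -- For a term c σᵏ of z the sequence (σ − ρ) y − c σᵏ satisfies the same
  -- recurrence with that term removed.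
  expSum-rec-eval : ∀ {e} s L → ListAll.All (λ (_ , d) → Regular (mon d - mon e)) L →
    ListAll.All (P ∘ proj₂) L → P e → (∀ k → b (suc k) ≈ mon e * b k + s * eval L k) → IsExpSum P b
  expSum-rec-eval {b = b} {e} s [] _ _ pe step =
    expSum-cong geometric (expSum-mon (b 0) pe)
    where
    geometric : ∀ k → b 0 * mon e ^ k ≈ b k
    geometric zero    = *-identityʳ _
    geometric (suc k) = begin
      b 0 * (mon e * mon e ^ k)
        ≈⟨ solve 3 (λ b x y → b :* (x :* y) := x :* (b :* y)) refl (b 0) (mon e) (mon e ^ k) ⟩
      mon e * (b 0 * mon e ^ k) ≈⟨ *-congˡ (geometric k) ⟩
      mon e * b k               ≈⟨ +-identityʳ _ ⟨
      mon e * b k + 0#          ≈⟨ +-congˡ (zeroʳ s) ⟨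
      mon e * b k + s * 0#      ≈⟨ step k ⟨
      b (suc k)                 ∎
  expSum-rec-eval {P = P} {b = b} {e} s ((c , d) ∷ L) (reg ∷ regs) (pd ∷ ps) pe step = isExpSum
    (D * δ) (regular-* (IsExpSum.regular ih) reg)
    ((D * (s * c) , d) ∷ IsExpSum.terms ih) (pd ∷ IsExpSum.exponents ih) expansion
    where
    ρ σ δ : Carrier
    ρ = mon e
    σ = mon d
    δ = σ - ρ

    -- The sequence s c σᵏ / (σ - ρ) solves the recurrence with the single inhomogeneous term s c
    -- σᵏ. Multiplying by δ keeps its subtraction inside the ring.
    y′ : ℕ → Carrier
    y′ k = δ * b k + (- (s * c)) * σ ^ k

    δ+ρ : δ + ρ ≈ σ
    δ+ρ = trans (+-assoc _ _ _) (trans (+-congˡ (-‿inverseˡ ρ)) (+-identityʳ σ))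

    step′ : ∀ k → y′ (suc k) ≈ ρ * y′ k + (δ * s) * eval L k
    step′ k = begin
      δ * b (suc k) + (- (s * c)) * (σ * σ ^ k)
        ≈⟨ +-cong (*-congˡ (step k)) (*-congˡ (*-congʳ (sym δ+ρ))) ⟩
      δ * (ρ * b k + s * (c * σ ^ k + eval L k)) + (- (s * c)) * ((δ + ρ) * σ ^ k)
        -- Here -(s c) enters as the independent atom c̄, and what must cancel is gathered in the
        -- factor s c + c̄.
        ≈⟨ solve 8 (λ δ ρ b s c x l c̄ →
             δ :* (ρ :* b :+ s :* (c :* x :+ l)) :+ c̄ :* ((δ :+ ρ) :* x) :=
             (ρ :* (δ :* b :+ c̄ :* x) :+ δ :* s :* l) :+ (s :* c :+ c̄) :* (δ :* x)) refl
             δ ρ (b k) s c (σ ^ k) (eval L k) (- (s * c)) ⟩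
      (ρ * y′ k + δ * s * eval L k) + (s * c + - (s * c)) * (δ * σ ^ k)
        ≈⟨ +-congˡ (trans (*-congʳ (-‿inverseʳ (s * c))) (zeroˡ _)) ⟩
      (ρ * y′ k + δ * s * eval L k) + 0#
        ≈⟨ +-identityʳ _ ⟩
      ρ * y′ k + δ * s * eval L k ∎

    -- The factor `s` in the statement exists for this call: it absorbs δ, so that the remaining
    -- terms are literally the tail `L`.
    ih : IsExpSum P y′
    ih = expSum-rec-eval (δ * s) L regs ps pe step′

    D = IsExpSum.denominator ih

    expansion : ∀ k → D * δ * b k ≈ D * (s * c) * σ ^ k + eval (IsExpSum.terms ih) k
    expansion k = begin
      D * δ * b k
        ≈⟨ +-identityˡ _ ⟨
      0# + D * δ * b k
        ≈⟨ +-congʳ (trans (*-congʳ (-‿inverseʳ (s * c))) (zeroˡ _)) ⟨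
      (s * c + - (s * c)) * (D * σ ^ k) + D * δ * b k
        ≈⟨ solve 6 (λ D δ b c x c̄ →
             (c :+ c̄) :* (D :* x) :+ D :* δ :* b :=
             D :* c :* x :+ D :* (δ :* b :+ c̄ :* x)) refl D δ (b k) (s * c) (σ ^ k) (- (s * c)) ⟩
      D * (s * c) * σ ^ k + D * y′ k
        ≈⟨ +-congˡ (IsExpSum.expansion ih k) ⟩
      D * (s * c) * σ ^ k + eval (IsExpSum.terms ih) k ∎

  -- No ratio occurring in `z` resonates with `mon e`, so no term k ρᵏ arises; this is where the
  -- roots stay simple. Multiplying `b` by the denominator of `z` reduces to an inhomogeneous part
  -- that is an exponential sum without denominator.
  expSum-rec : ∀ {e} {z : ℕ → Carrier} → (∀ {d} → Q d → Regular (mon d - mon e)) →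
    (∀ {d} → Q d → P d) → P e → IsExpSum Q z →
    (∀ k → b (suc k) ≈ mon e * b k + z k) → IsExpSum P b
  expSum-rec {P = P} {b = b} {e} {z} reg Q⇒P pe (isExpSum D r L q x) step = isExpSum
    (IsExpSum.denominator Db * D) (regular-* (IsExpSum.regular Db) r)
    (IsExpSum.terms Db) (IsExpSum.exponents Db)
    λ k → trans (*-assoc _ D (b k)) (IsExpSum.expansion Db k)
    where
    Db : IsExpSum P (λ k → D * b k)
    Db = expSum-rec-eval 1# L (ListAll.map reg q) (ListAll.map Q⇒P q) pe λ k → begin
      D * b (suc k)
        ≈⟨ *-congˡ (step k) ⟩
      D * (mon e * b k + z k)
        ≈⟨ solve 4 (λ D ρ b z → D :* (ρ :* b :+ z) := ρ :* (D :* b) :+ D :* z) refl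
             D (mon e) (b k) (z k) ⟩
      mon e * (D * b k) + D * z k
        ≈⟨ +-congˡ (trans (x k) (sym (*-identityˡ _))) ⟩
      mon e * (D * b k) + 1# * eval L k ∎

-- From exponential sums to recurrences with simple roots.

fromList-unique : ∀ {A : Set} {xs : List A} → ListUnique.Unique xs → Unique (fromList xs)
fromList-unique []       = []
fromList-unique (x∉ ∷ u) = All.fromList⁺ x∉ ∷ fromList-unique u

module SimpleRoots (M : MonomialRing)
  (_≟_ : DecidableEquality (MonomialRing.Exponent M))
  (mon-injective : ∀ {d e} → MonomialRing._≈_ M (MonomialRing.mon M d) (MonomialRing.mon M e) → d ≡ e)
  where

  open MonomialRing M
  open import Relation.Binary.Reasoning.Setoid setoid
  open import Algebra.Properties.Ring ring using (-0#≈0#; +-cancelʳ)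
  open import Algebra.Solver.Ring.NaturalCoefficients.Default commutativeSemiring
    using (solve; _:=_; _:+_; _:*_)
  open ListSum commutativeSemiring
  open ExponentialSums M
  open Recurrence (CommutativeRing.rawRing commutativeRing) hiding (SimpleRootRecurrence)
  open RawSemiringDefs (RawRing.rawSemiring (CommutativeRing.rawRing commutativeRing)) using (sum)

  -- Σᵢ pᵢ b (l - 1 - i + s)
  pair : ∀ {l} → Vec Carrier l → (ℕ → Carrier) → ℕ → Carrier
  pair         []      b s = 0#
  pair {suc l} (x ∷ p) b s = x * b (l ℕ.+ s) + pair p b s

  pair-cong : ∀ {l} {p q : Vec Carrier l} → Pointwise _≈_ p q → ∀ b s → pair p b s ≈ pair q b s
  pair-cong []         b s = refl
  pair-cong (eq ∷ eqs) b s = +-cong (*-congʳ eq) (pair-cong eqs b s)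

  pair-congʳ : ∀ {l} (p : Vec Carrier l) {b b′} → (∀ k → b k ≈ b′ k) → ∀ s → pair p b s ≈ pair p b′ s
  pair-congʳ []      eq s = refl
  pair-congʳ (x ∷ p) eq s = +-cong (*-congˡ (eq _)) (pair-congʳ p eq s)

  pair-linear : ∀ {l} (p : Vec Carrier l) c b b′ s →
    pair p (λ k → c * b k + b′ k) s ≈ c * pair p b s + pair p b′ s
  pair-linear []      c b b′ s = sym (trans (+-identityʳ _) (zeroʳ c))
  pair-linear {suc l} (x ∷ p) c b b′ s = trans (+-congˡ (pair-linear p c b b′ s))
    (solve 6 (λ x c y z t u → x :* (c :* y :+ z) :+ (c :* t :+ u) :=
                              c :* (x :* y :+ t) :+ (x :* z :+ u)) refl
       x c (b (l ℕ.+ s)) (b′ (l ℕ.+ s)) (pair p b s) (pair p b′ s))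

  pair-0 : ∀ {l} (p : Vec Carrier l) s → pair p (const 0#) s ≈ 0#
  pair-0 []      s = refl
  pair-0 (x ∷ p) s = trans (+-cong (zeroʳ x) (pair-0 p s)) (+-identityˡ 0#)

  -- Multiplication by u shifts the sequence, so u - ρ acts as the shift minus ρ. The subtracted
  -- part is moved to the left-hand side to keep the identity free of negatives.
  pair-timesLinear : ∀ {l} ρ (p : Vec Carrier l) b s →
    pair (timesLinear ρ p) b s + ρ * pair p b s ≈ pair p b (suc s)
  pair-timesLinear ρ p b s = begin
    pair (timesLinear ρ p) b s + ρ * pair p b s
      ≈⟨ +-congˡ (trans (sym (pair-map p)) (sym (pair-0∷ (Vec.map (ρ *_) p)))) ⟩
    pair (timesLinear ρ p) b s + pair (0# ∷ Vec.map (ρ *_) p) b s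
      ≈⟨ pair-minus (p ∷ʳ 0#) (0# ∷ Vec.map (ρ *_) p) ⟩
    pair (p ∷ʳ 0#) b s
      ≈⟨ pair-∷ʳ0 p ⟩
    pair p b (suc s) ∎
    where
    pair-map : ∀ {l} (p : Vec Carrier l) → pair (Vec.map (ρ *_) p) b s ≈ ρ * pair p b s
    pair-map []      = sym (zeroʳ ρ)
    pair-map (x ∷ p) = trans (+-cong (*-assoc ρ x _) (pair-map p)) (sym (distribˡ ρ _ _))

    pair-0∷ : ∀ {l} (p : Vec Carrier l) → pair (0# ∷ p) b s ≈ pair p b s
    pair-0∷ p = trans (+-congʳ (zeroˡ _)) (+-identityˡ _)

    pair-minus : ∀ {l} (p q : Vec Carrier l) →
      pair (zipWith (λ x y → x + (- y)) p q) b s + pair q b s ≈ pair p b s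
    pair-minus []      []      = +-identityˡ 0#
    pair-minus {suc l} (x ∷ p) (y ∷ q) = begin
      ((x + - y) * b′ + P-Q) + (y * b′ + Q)
        ≈⟨ solve 6 (λ x y ȳ b m q → ((x :+ ȳ) :* b :+ m) :+ (y :* b :+ q) :=
             (x :* b :+ (m :+ q)) :+ (y :+ ȳ) :* b) refl x y (- y) b′ P-Q Q ⟩
      (x * b′ + (P-Q + Q)) + (y + - y) * b′
        ≈⟨ +-cong (+-congˡ (pair-minus p q)) (trans (*-congʳ (-‿inverseʳ y)) (zeroˡ b′)) ⟩
      (x * b′ + pair p b s) + 0#
        ≈⟨ +-identityʳ _ ⟩
      x * b′ + pair p b s ∎
      where
      b′  = b (l ℕ.+ s)
      P-Q = pair (zipWith (λ x y → x + (- y)) p q) b s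
      Q   = pair q b s

    pair-∷ʳ0 : ∀ {l} (p : Vec Carrier l) → pair (p ∷ʳ 0#) b s ≈ pair p b (suc s)
    pair-∷ʳ0 []                = trans (+-identityʳ _) (zeroˡ _)
    pair-∷ʳ0 {l = suc l} (x ∷ p) =
      +-cong (*-congˡ (reflexive (≡.cong b (≡.sym (ℕ.+-suc l s))))) (pair-∷ʳ0 p)

  pair-^ : ∀ {l} (p : Vec Carrier l) σ s → pair p (σ ^_) (suc s) ≈ σ * pair p (σ ^_) s
  pair-^         []      σ s = sym (zeroʳ σ)
  pair-^ {suc l} (x ∷ p) σ s = begin
    x * σ ^ (l ℕ.+ suc s) + pair p (σ ^_) (suc s)
      ≈⟨ +-cong (*-congˡ (reflexive (≡.cong (σ ^_) (ℕ.+-suc l s)))) (pair-^ p σ s) ⟩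
    x * (σ * σ ^ (l ℕ.+ s)) + σ * pair p (σ ^_) s
      ≈⟨ solve 4 (λ x σ y p → x :* (σ :* y) :+ σ :* p := σ :* (x :* y :+ p)) refl
           x σ (σ ^ (l ℕ.+ s)) (pair p (σ ^_) s) ⟩
    σ * (x * σ ^ (l ℕ.+ s) + pair p (σ ^_) s) ∎

  -- The factor u - `mon e` kills the powers of `mon e`, since shifting them multiplies them by
  -- `mon e`. Every further factor only combines values that vanish already.
  pair-prodLinear-^ : ∀ {es e} → e ∈ es → ∀ s →
    pair (prodLinear (Vec.map mon (fromList es))) (mon e ^_) s ≈ 0#
  pair-prodLinear-^ {e ∷ es} (here ≡.refl) s = +-cancelʳ _ _ _
    (trans (pair-timesLinear (mon e) p _ s) (trans (pair-^ p (mon e) s) (sym (+-identityˡ _))))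
    where p = prodLinear (Vec.map mon (fromList es))
  pair-prodLinear-^ {d ∷ es} {e} (there e∈) s = begin
    pair (timesLinear (mon d) p) (mon e ^_) s
      ≈⟨ +-identityʳ _ ⟨
    pair (timesLinear (mon d) p) (mon e ^_) s + 0#
      ≈⟨ +-congˡ (trans (*-congˡ (pair-prodLinear-^ e∈ s)) (zeroʳ _)) ⟨
    pair (timesLinear (mon d) p) (mon e ^_) s + mon d * pair p (mon e ^_) s
      ≈⟨ pair-timesLinear (mon d) p _ s ⟩
    pair p (mon e ^_) (suc s)
      ≈⟨ pair-prodLinear-^ e∈ (suc s) ⟩
    0# ∎
    where p = prodLinear (Vec.map mon (fromList es))

  pair-prodLinear-eval : ∀ {es} L → (∀ {c e} → (c , e) ∈ L → e ∈ es) → ∀ s →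
    pair (prodLinear (Vec.map mon (fromList es))) (eval L) s ≈ 0#
  pair-prodLinear-eval {es} []            L⊆ s = pair-0 (prodLinear (Vec.map mon (fromList es))) s
  pair-prodLinear-eval {es} ((c , e) ∷ L) L⊆ s = begin
    pair p (λ k → c * mon e ^ k + eval L k) s
      ≈⟨ pair-linear p c _ _ s ⟩
    c * pair p (mon e ^_) s + pair p (eval L) s
      ≈⟨ +-cong (trans (*-congˡ (pair-prodLinear-^ (L⊆ (here ≡.refl)) s)) (zeroʳ c))
                (pair-prodLinear-eval L (L⊆ ∘ there) s) ⟩
    0# + 0#
      ≈⟨ +-identityˡ 0# ⟩
    0# ∎
    where p = prodLinear (Vec.map mon (fromList es))

  prodLinear-monic : ∀ {r} (ρ : Vec Carrier r) → 1# ≈ Vec.head (prodLinear ρ)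
  prodLinear-monic []      = refl
  prodLinear-monic (ρ ∷ ρs) with prodLinear ρs | prodLinear-monic ρs
  ... | x ∷ p | 1≈x = trans 1≈x (sym (trans (+-congˡ -0#≈0#) (+-identityʳ x)))

  charPoly-tail : ∀ {r} (p : Vec Carrier (suc r)) → 1# ≈ Vec.head p →
    Pointwise _≈_ (charPoly (Vec.tail p)) p
  charPoly-tail (x ∷ p) eq = eq ∷ Pointwise.refl refl

  -- With k = l + s + 1 the truncated subtractions in `SatisfiesRecurrence` are exact. The shift
  -- `a ∘ suc` is there because the sequence begins at 1.
  pair-sum : ∀ {l} (p : Vec Carrier l) (a : ℕ → Carrier) s →
    sum (λ i → lookup p i * a (suc (l ℕ.+ s) ∸ suc (toℕ i))) ≈ pair p (a ∘ suc) s
  pair-sum []      a s = refl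
  pair-sum (x ∷ p) a s = +-congˡ (pair-sum p a s)

  -- The roots are monomials and hence the coefficients of the recurrence lie in the ring. The
  -- denominator multiplies the whole relation and is cancelled by its regularity.
  expSum⇒recurrence : ∀ (a : ℕ → Carrier) → IsExpSum U (a ∘ suc) →
    SimpleRootRecurrence (CommutativeRing.rawRing commutativeRing) a
  expSum⇒recurrence a (isExpSum D regular L _ expansion) =
    _ , Vec.tail p , satisfies , ρs , distinct , charPoly-tail p (prodLinear-monic ρs)
    where
    -- Several terms may carry the same exponent. Each exponent must give one root only, and
    -- exponents, unlike ring elements, are compared decidably.
    es = deduplicate _≟_ (List.map proj₂ L)
    ρs = Vec.map mon (fromList es)
    p  = prodLinear ρs

    distinct : ∀ i j → i ≢ j → ¬ lookup ρs i ≈ lookup ρs j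
    distinct i j i≢j eq = i≢j (Unique.lookup-injective
      (fromList-unique (deduplicate-! _≟_ (List.map proj₂ L))) i j
      (mon-injective (subst₂ _≈_ (lookup-map i mon (fromList es)) (lookup-map j mon (fromList es)) eq)))

    pair-p : ∀ s → pair p (a ∘ suc) s ≈ 0#
    pair-p s = regular _ (begin
      D * pair p (a ∘ suc) s
        ≈⟨ +-identityʳ _ ⟨
      D * pair p (a ∘ suc) s + 0#
        ≈⟨ +-congˡ (pair-0 p s) ⟨
      D * pair p (a ∘ suc) s + pair p (const 0#) s
        ≈⟨ pair-linear p D (a ∘ suc) (const 0#) s ⟨
      pair p (λ k → D * a (suc k) + 0#) s
        ≈⟨ pair-congʳ p (λ k → trans (+-identityʳ _) (expansion k)) s ⟩
      pair p (eval L) s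
        ≈⟨ pair-prodLinear-eval {es} L (λ ce∈ → ∈-deduplicate⁺ _≟_ (∈-map⁺ proj₂ ce∈)) s ⟩
      0# ∎)

    satisfies : SatisfiesRecurrence (Vec.tail p) a
    satisfies k r<k = ≡.subst (λ k → a k + sum (λ i → lookup (Vec.tail p) i * a (k ∸ suc (toℕ i))) ≈ 0#)
      (ℕ.m+[n∸m]≡n r<k) (begin
        a (suc (r ℕ.+ s)) + sum (λ i → lookup (Vec.tail p) i * a (suc (r ℕ.+ s) ∸ suc (toℕ i)))
          ≈⟨ +-cong (sym (*-identityˡ _)) (pair-sum (Vec.tail p) a s) ⟩
        pair (charPoly (Vec.tail p)) (a ∘ suc) s
          ≈⟨ pair-cong (charPoly-tail p (prodLinear-monic ρs)) (a ∘ suc) s ⟩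
        pair p (a ∘ suc) s
          ≈⟨ pair-p s ⟩
        0# ∎)
      where
      r = List.length es
      s = k ∸ suc r

-- Powers of triangular transfer operators.

module Transfer (M : MonomialRing) where

  open MonomialRing M
  open import Relation.Binary.Reasoning.Setoid setoid
  open ListSum commutativeSemiring
  open ExponentialSums M
  open import Algebra.Solver.Ring.NaturalCoefficients.Default commutativeSemiring
    using (solve; _:=_; _:+_; _:*_)

  -- A sparse matrix given by its rows: outside `next s` the entries count as zero, whatever `entry`
  -- says there.
  record Operator (S : Set) : Set where
    field
      next  : S → List S
      entry : S → S → Carrier

    apply : (S → Carrier) → S → Carrier
    apply f s = ∑[ s′ ← next s ] entry s s′ * f s′

    iterate : ℕ → (S → Carrier) → S → Carrier
    iterate zero    f = f
    iterate (suc k) f = apply (iterate k f)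

  module _ {S : Set} (_≟_ : DecidableEquality S) (degree : Exponent → ℕ)
    (regular : ∀ d e → degree d < degree e → Regular (mon d - mon e)) where

    -- Triangularity is asked at `Good` states only, since elsewhere a diagonal entry may be 0
    -- instead of a monomial. The second alternative of `descent` admits candidates in `next s` that
    -- violate a condition on fillings.
    record Triangular (op : Operator S) : Set₁ where
      open Operator op
      field
        Good        : Pred S 0ℓ
        exponent    : S → Exponent
        next-unique : ∀ {s} → Good s → ListUnique.Unique (next s)
        next-self   : ∀ {s} → Good s → s ∈ next s
        diagonal    : ∀ {s} → Good s → entry s s ≈ mon (exponent s)
        descent     : ∀ {s s′} → Good s → s′ ∈ next s → s ≢ s′ →
          (Good s′ × degree (exponent s′) < degree (exponent s)) ⊎ entry s s′ ≈ 0#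

      -- Splitting off the diagonal term leaves a first-order recurrence in k whose inhomogeneous
      -- part comes from states of smaller degree. The degree bound in the conclusion is what makes
      -- `regular` applicable one level up; `n` is the fuel for the induction on degrees.
      expSum-iterate : ∀ f n {s} → degree (exponent s) < n → Good s →
        IsExpSum (λ e → degree e ≤ degree (exponent s)) (λ k → iterate k f s)
      expSum-iterate f (suc n) {s} (s≤s ≤n) good = expSum-rec (λ {d} → regular d (exponent s))
        ℕ.<⇒≤ ℕ.≤-refl (expSum-sum (next s) lower) λ k → begin
          apply (iterate k f) s
            ≈⟨ sum-isolate _≟_ (next-unique good) (next-self good) _ ⟩
          entry s s * iterate k f s +
            (∑[ s′ ← next s ] ifYes (¬? (s ≟ s′)) (entry s s′ * iterate k f s′))
            ≈⟨ +-congʳ (*-congʳ (diagonal good)) ⟩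
          mon (exponent s) * iterate k f s +
            (∑[ s′ ← next s ] ifYes (¬? (s ≟ s′)) (entry s s′ * iterate k f s′)) ∎
        where
        lower : ∀ s′ → s′ ∈ next s → IsExpSum (λ e → degree e < degree (exponent s))
          (λ k → ifYes (¬? (s ≟ s′)) (entry s s′ * iterate k f s′))
        lower s′ s′∈ with s ≟ s′
        ... | yes _ = expSum-0
        ... | no s≢s′ with descent good s′∈ s≢s′
        ...   | inj₁ (good′ , <s) = expSum-*ˡ (entry s s′) (expSum-⊆ (λ ≤s′ → ℕ.≤-<-trans ≤s′ <s)
                  (expSum-iterate f n (ℕ.<-≤-trans <s ≤n) good′))
        ...   | inj₂ ≈0 = expSum-cong (λ k → sym (trans (*-congʳ ≈0) (zeroˡ _))) expSum-0

      module _ {V : List S} (V-unique : ListUnique.Unique V)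
        (V-closed : ∀ {s s′} → s ∈ V → s′ ∈ next s → s′ ∈ V) where

        -- Expanding `g` in indicators of single states separates the matrix power from the vector,
        -- so that afterwards the vector may depend on k as well.
        iterate-kernel : ∀ g k {s} → s ∈ V →
          iterate k g s ≈ (∑[ v ← V ] g v * iterate k (λ s → ifYes (s ≟ v) 1#) s)
        iterate-kernel g zero {s} s∈ = sym (trans
          (sum-cong V λ v → trans (*-comm (g v) _)
            (trans (ifYes-*ʳ (s ≟ v) 1# (g v))
              (ifYes-cong (s ≟ v) (s ≟ v) id id λ _ → *-identityˡ (g v))))
          (sum-δ _≟_ V-unique s∈ g))
        iterate-kernel g (suc k) {s} s∈ = begin
          (∑[ s′ ← next s ] entry s s′ * iterate k g s′)
            ≈⟨ sum-cong-∈ (next s) (λ s′ s′∈ → trans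
                 (*-congˡ (iterate-kernel g k (V-closed s∈ s′∈))) (sym (sum-*ˡ V _ _))) ⟩
          (∑[ s′ ← next s ] ∑[ v ← V ] entry s s′ * (g v * iterate k (λ s → ifYes (s ≟ v) 1#) s′))
            ≈⟨ sum-swap (next s) V _ ⟩
          (∑[ v ← V ] ∑[ s′ ← next s ] entry s s′ * (g v * iterate k (λ s → ifYes (s ≟ v) 1#) s′))
            ≈⟨ sum-cong V (λ v → trans
                 (sum-cong (next s) λ s′ → solve 3 (λ x y z → x :* (y :* z) := y :* (x :* z)) refl _ _ _)
                 (sum-*ˡ (next s) (g v) _)) ⟩
          (∑[ v ← V ] g v * iterate (suc k) (λ s → ifYes (s ≟ v) 1#) s) ∎

        -- The same k is the power and the index of the vector. Each summand of the kernel expansion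
        -- is a product of two exponential sums, one for the vector and one for an entry of the
        -- matrix power.
        expSum-iterate-diagonal : ∀ (g : ℕ → S → Carrier) →
          (∀ {v} → v ∈ V → IsExpSum U (λ k → g k v)) →
          ∀ {s} → s ∈ V → Good s → IsExpSum U (λ k → iterate k (g k) s)
        expSum-iterate-diagonal g exp {s} s∈ good = expSum-cong
          (λ k → sym (iterate-kernel (g k) k s∈))
          (expSum-sum V λ v v∈ → expSum-* (exp v∈)
            (expSum-⊆ (λ _ → tt) (expSum-iterate _ _ ℕ.≤-refl good)))

-- The commutative ring of polynomials over ℤ and its monomials.

module Polynomial {m : ℕ} where

  open RawRing (polyRing m) using (_*_; -_; 1#)
  open ≡ using (refl; sym; trans)
  open ≡.≡-Reasoning
  open import Algebra.Properties.CommutativeSemigroup ℤ.+-commutativeSemigroup using (interchange)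

  _∙_ : Monomial m → Monomial m → Monomial m
  _∙_ = zipWith ℕ._+_

  shift : ℤ → Monomial m → Poly m → Poly m
  shift c d = List.map λ (c′ , d′) → c ℤ.* c′ , d ∙ d′

  ∙-comm : ∀ d e → d ∙ e ≡ e ∙ d
  ∙-comm = Vec.zipWith-comm ℕ.+-comm

  coeff-++ : ∀ e (p q : Poly m) → coeff e (p ++ q) ≡ coeff e p ℤ.+ coeff e q
  coeff-++ e []            q = sym (ℤ.+-identityˡ _)
  coeff-++ e ((c , d) ∷ p) q with ≡-dec ℕ._≟_ e d
  ... | yes _ = trans (cong (ℤ._+_ c) (coeff-++ e p q)) (sym (ℤ.+-assoc c _ _))
  ... | no  _ = coeff-++ e p q

  coeff-- : ∀ e (p : Poly m) → coeff e (- p) ≡ ℤ.- coeff e p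
  coeff-- e []            = refl
  coeff-- e ((c , d) ∷ p) with ≡-dec ℕ._≟_ e d
  ... | yes _ = trans (cong (ℤ._+_ (ℤ.- c)) (coeff-- e p)) (sym (ℤ.neg-distrib-+ c _))
  ... | no  _ = coeff-- e p

  zipWith-+-cancelˡ : ∀ {l} (d : Vec ℕ l) {e f} → zipWith ℕ._+_ d e ≡ zipWith ℕ._+_ d f → e ≡ f
  zipWith-+-cancelˡ []      {[]}    {[]}    eq = refl
  zipWith-+-cancelˡ (x ∷ d) {y ∷ e} {z ∷ f} eq = cong₂ _∷_
    (ℕ.+-cancelˡ-≡ x y z (Vec.∷-injectiveˡ eq)) (zipWith-+-cancelˡ d (Vec.∷-injectiveʳ eq))

  quotient? : ∀ {l} (d e : Vec ℕ l) → Dec (∃[ f ] zipWith ℕ._+_ d f ≡ e)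
  quotient? []      []      = yes ([] , refl)
  quotient? (x ∷ d) (y ∷ e) = map′
    (λ (x≤y , f , eq) → y ∸ x ∷ f , cong₂ _∷_ (ℕ.m+[n∸m]≡n x≤y) eq)
    (λ { (z ∷ f , refl) → ℕ.m≤m+n x z , f , refl })
    ((x ℕ.≤? y) ×-dec quotient? d e)

  coeff-shift : ∀ c d f p → coeff (d ∙ f) (shift c d p) ≡ c ℤ.* coeff f p
  coeff-shift c d f []              = sym (ℤ.*-zeroʳ c)
  coeff-shift c d f ((c′ , d′) ∷ p) with ≡-dec ℕ._≟_ (d ∙ f) (d ∙ d′) | ≡-dec ℕ._≟_ f d′
  ... | yes _  | yes _  = trans (cong (ℤ._+_ (c ℤ.* c′)) (coeff-shift c d f p)) (sym (ℤ.*-distribˡ-+ c c′ _))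
  ... | no  _  | no  _  = coeff-shift c d f p
  ... | yes eq | no  ≢  = contradiction (zipWith-+-cancelˡ d eq) ≢
  ... | no  ≢  | yes eq = contradiction (cong (d ∙_) eq) ≢

  coeff-shift-∤ : ∀ c d e p → ¬ (∃[ f ] d ∙ f ≡ e) → coeff e (shift c d p) ≡ 0ℤ
  coeff-shift-∤ c d e []              ∤ = refl
  coeff-shift-∤ c d e ((c′ , d′) ∷ p) ∤ with ≡-dec ℕ._≟_ e (d ∙ d′)
  ... | yes eq = contradiction (d′ , sym eq) ∤
  ... | no  _  = coeff-shift-∤ c d e p ∤

  -- At an exponent divisible by d the coefficient is c times one of the original polynomial, and
  -- elsewhere it is 0; so it depends on the coefficients alone and not on the list of terms.
  shift-cong : ∀ c d {p q} → p ≈ₚ q → shift c d p ≈ₚ shift c d q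
  shift-cong c d {p} {q} p≈q e with quotient? d e
  ... | yes (f , refl) =
    trans (coeff-shift c d f p) (trans (cong (c ℤ.*_) (p≈q f)) (sym (coeff-shift c d f q)))
  ... | no  ∤          = trans (coeff-shift-∤ c d e p ∤) (sym (coeff-shift-∤ c d e q ∤))

  ++-cong : ∀ {p p′ q q′ : Poly m} → p ≈ₚ p′ → q ≈ₚ q′ → p ++ q ≈ₚ p′ ++ q′
  ++-cong {p} {p′} {q} {q′} p≈p′ q≈q′ e =
    trans (coeff-++ e p q) (trans (cong₂ ℤ._+_ (p≈p′ e) (q≈q′ e)) (sym (coeff-++ e p′ q′)))

  *-congˡ : ∀ p {q q′} → q ≈ₚ q′ → p * q ≈ₚ p * q′
  *-congˡ []            q≈q′ e = refl
  *-congˡ ((c , d) ∷ p) {q} {q′} q≈q′ =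
    ++-cong {shift c d q} {shift c d q′} (shift-cong c d {q} {q′} q≈q′) (*-congˡ p {q} {q′} q≈q′)

  *-zeroʳ : ∀ p → p * [] ≡ []
  *-zeroʳ []      = refl
  *-zeroʳ (_ ∷ p) = *-zeroʳ p

  -- The product recurses on its left factor. This expansion along the right factor, valid up to the
  -- order of the terms, is the inductive step of commutativity.
  coeff-*-∷ : ∀ e p c d q → coeff e (p * ((c , d) ∷ q)) ≡ coeff e (shift c d p) ℤ.+ coeff e (p * q)
  coeff-*-∷ e []              c d q = refl
  coeff-*-∷ e ((c′ , d′) ∷ p) c d q = begin
    coeff e (shift c′ d′ ((c , d) ∷ q) ++ p * ((c , d) ∷ q))
      ≡⟨ coeff-++ e (shift c′ d′ ((c , d) ∷ q)) _ ⟩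
    coeff e (shift c′ d′ ((c , d) ∷ q)) ℤ.+ coeff e (p * ((c , d) ∷ q))
      ≡⟨ cong₂ ℤ._+_ (coeff-++ e [ _ ] (shift c′ d′ q)) (coeff-*-∷ e p c d q) ⟩
    (coeff e [ (c′ ℤ.* c , d′ ∙ d) ] ℤ.+ coeff e (shift c′ d′ q)) ℤ.+
      (coeff e (shift c d p) ℤ.+ coeff e (p * q))
      ≡⟨ interchange (coeff e [ (c′ ℤ.* c , d′ ∙ d) ]) _ _ _ ⟩
    (coeff e [ (c′ ℤ.* c , d′ ∙ d) ] ℤ.+ coeff e (shift c d p)) ℤ.+
      (coeff e (shift c′ d′ q) ℤ.+ coeff e (p * q))
      ≡⟨ cong₂ (λ c″ d″ → (coeff e [ (c″ , d″) ] ℤ.+ coeff e (shift c d p)) ℤ.+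
           (coeff e (shift c′ d′ q) ℤ.+ coeff e (p * q))) (ℤ.*-comm c′ c) (∙-comm d′ d) ⟩
    (coeff e [ (c ℤ.* c′ , d ∙ d′) ] ℤ.+ coeff e (shift c d p)) ℤ.+
      (coeff e (shift c′ d′ q) ℤ.+ coeff e (p * q))
      ≡⟨ cong₂ ℤ._+_ (coeff-++ e [ _ ] (shift c d p)) (coeff-++ e (shift c′ d′ q) _) ⟨
    coeff e (shift c d ((c′ , d′) ∷ p)) ℤ.+ coeff e (((c′ , d′) ∷ p) * q) ∎

  *-comm : ∀ p q → p * q ≈ₚ q * p
  *-comm []            q e = cong (coeff e) (sym (*-zeroʳ q))
  *-comm ((c , d) ∷ p) q e = trans (coeff-++ e (shift c d q) _)
    (trans (cong (ℤ._+_ (coeff e (shift c d q))) (*-comm p q e)) (sym (coeff-*-∷ e q c d p)))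

  *-distribʳ-++ : ∀ p q r → (q ++ r) * p ≡ q * p ++ r * p
  *-distribʳ-++ p []            r = refl
  *-distribʳ-++ p ((c , d) ∷ q) r =
    trans (cong (shift c d p ++_) (*-distribʳ-++ p q r)) (sym (List.++-assoc (shift c d p) _ _))

  shift-shift : ∀ c d c′ d′ p → shift (c ℤ.* c′) (d ∙ d′) p ≡ shift c d (shift c′ d′ p)
  shift-shift c d c′ d′ p = trans
    (List.map-cong (λ (c″ , d″) → cong₂ _,_ (ℤ.*-assoc c c′ c″) (Vec.zipWith-assoc ℕ.+-assoc d d′ d″)) p)
    (List.map-∘ p)

  shift-* : ∀ c d p q → shift c d p * q ≡ shift c d (p * q)
  shift-* c d []              q = refl
  shift-* c d ((c′ , d′) ∷ p) q = trans
    (cong₂ _++_ (shift-shift c d c′ d′ q) (shift-* c d p q))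
    (sym (List.map-++ _ (shift c′ d′ q) (p * q)))

  *-assoc : ∀ p q r → (p * q) * r ≡ p * (q * r)
  *-assoc []            q r = refl
  *-assoc ((c , d) ∷ p) q r = trans (*-distribʳ-++ r (shift c d q) (p * q))
    (cong₂ _++_ (shift-* c d q r) (*-assoc p q r))

  *-identityˡ : ∀ p → 1# * p ≡ p
  *-identityˡ p = trans (List.++-identityʳ _)
    (trans
      (List.map-cong (λ (c , d) → cong₂ _,_ (ℤ.*-identityˡ c) (Vec.zipWith-identityˡ ℕ.+-identityˡ d)) p)
      (List.map-id p))

  ≈ₚ-isEquivalence : IsEquivalence (_≈ₚ_ {m})
  ≈ₚ-isEquivalence = record
    { refl  = λ _ → refl
    ; sym   = λ eq e → sym (eq e)
    ; trans = λ eq eq′ e → trans (eq e) (eq′ e)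
    }

  ≈ₚ-reflexive : ∀ {p q : Poly m} → p ≡ q → p ≈ₚ q
  ≈ₚ-reflexive refl _ = refl

  ++-comm : ∀ (p q : Poly m) → p ++ q ≈ₚ q ++ p
  ++-comm p q e = trans (coeff-++ e p q)
    (trans (ℤ.+-comm (coeff e p) (coeff e q)) (sym (coeff-++ e q p)))

  -- Equal left factors can be lists of different forms, so induction on them is not possible;
  -- commutativity moves each factor to the right.
  *-cong : ∀ {p p′ q q′} → p ≈ₚ p′ → q ≈ₚ q′ → p * q ≈ₚ p′ * q′
  *-cong {p} {p′} {q} {q′} p≈p′ q≈q′ e = begin
    coeff e (p * q)   ≡⟨ *-congˡ p {q} {q′} q≈q′ e ⟩
    coeff e (p * q′)  ≡⟨ *-comm p q′ e ⟩
    coeff e (q′ * p)  ≡⟨ *-congˡ q′ {p} {p′} p≈p′ e ⟩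
    coeff e (q′ * p′) ≡⟨ *-comm q′ p′ e ⟩
    coeff e (p′ * q′) ∎

  +-inverseʳ : ∀ p → p ++ (- p) ≈ₚ []
  +-inverseʳ p e = trans (coeff-++ e p (- p))
    (trans (cong (ℤ._+_ (coeff e p)) (coeff-- e p)) (ℤ.+-inverseʳ (coeff e p)))

  poly-isCommutativeRing : IsCommutativeRing (_≈ₚ_ {m}) _++_ _*_ -_ [] 1#
  poly-isCommutativeRing = record
    { isRing = record
      { +-isAbelianGroup = record
        { isGroup = record
          { isMonoid = record
            { isSemigroup = record
              { isMagma = record
                { isEquivalence = ≈ₚ-isEquivalence
                ; ∙-cong        = λ {p} {p′} {q} {q′} → ++-cong {p} {p′} {q} {q′}
                }
              ; assoc = λ p q r → ≈ₚ-reflexive (List.++-assoc p q r)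
              }
            ; identity = (λ _ _ → refl) , (λ p → ≈ₚ-reflexive (List.++-identityʳ p))
            }
          ; inverse = (λ p e → trans (++-comm (- p) p e) (+-inverseʳ p e)) , +-inverseʳ
          ; ⁻¹-cong = λ {p} {q} p≈q e →
              trans (coeff-- e p) (trans (cong ℤ.-_ (p≈q e)) (sym (coeff-- e q)))
          }
        ; comm = ++-comm
        }
      ; *-cong     = λ {p} {p′} {q} {q′} → *-cong {p} {p′} {q} {q′}
      ; *-assoc    = λ p q r → ≈ₚ-reflexive (*-assoc p q r)
      ; *-identity = (λ p → ≈ₚ-reflexive (*-identityˡ p)) ,
          λ p e → trans (*-comm p 1# e) (cong (coeff e) (*-identityˡ p))
      ; distrib    = (λ p q r e → trans (*-comm p (q ++ r) e)
            (trans (cong (coeff e) (*-distribʳ-++ p q r))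
              (++-cong {q * p} {p * q} {r * p} {p * r} (*-comm q p) (*-comm r p) e))) ,
          λ p q r → ≈ₚ-reflexive (*-distribʳ-++ p q r)
      }
    ; *-comm = *-comm
    }

  monomial-* : ∀ d p → monomial d * p ≈ₚ shift 1ℤ d p
  monomial-* d p = ≈ₚ-reflexive (List.++-identityʳ (shift 1ℤ d p))

  coeff-monomial-* : ∀ d f p → coeff (d ∙ f) (monomial d * p) ≡ coeff f p
  coeff-monomial-* d f p =
    trans (monomial-* d p (d ∙ f)) (trans (coeff-shift 1ℤ d f p) (ℤ.*-identityˡ _))

  monomial-injective : ∀ {d e : Monomial m} → monomial d ≈ₚ monomial e → d ≡ e
  monomial-injective {d} {e} eq with ≡-dec ℕ._≟_ d d | ≡-dec ℕ._≟_ d e | eq d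
  ... | _       | yes d≡e | _  = d≡e
  ... | no d≢d  | no _    | _  = contradiction refl d≢d
  ... | yes _   | no _    | ()

  polyMonomialRing : MonomialRing
  polyMonomialRing = record
    { commutativeRing = record { isCommutativeRing = poly-isCommutativeRing }
    ; Exponent        = Monomial m
    ; mon             = monomial
    ; _⊕_             = _∙_
    ; 𝟘               = replicate m 0
    ; mon-⊕           = λ d e → ≈ₚ-reflexive refl
    ; mon-𝟘           = λ _ → refl
    }

  open ExponentialSums polyMonomialRing using (Regular; regular-difference)

  -- A nonzero coefficient of p at f would give one at the smaller degree
  -- degree f + degree d - degree e.
  monomial-difference-regular : (degree : Monomial m → ℕ) →
    (∀ d e → degree (d ∙ e) ≡ degree d ℕ.+ degree e) →
    ∀ d e → degree d < degree e → Regular (monomial d ++ (- monomial e))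
  monomial-difference-regular degree degree-∙ d e d<e =
    regular-difference {monomial d} {monomial e} λ p same f →
    vanish p same (suc (degree f)) f ℕ.≤-refl
    where
    module _ (p : Poly m) (same : monomial d * p ≈ₚ monomial e * p) where

      vanish : ∀ n f → degree f < n → coeff f p ≡ 0ℤ
      vanish (suc n) f (ℕ.s≤s ≤n) with quotient? e (d ∙ f)
      ... | no ∤ = begin
        coeff f p                      ≡⟨ coeff-monomial-* d f p ⟨
        coeff (d ∙ f) (monomial d * p) ≡⟨ same (d ∙ f) ⟩
        coeff (d ∙ f) (monomial e * p) ≡⟨ monomial-* e p (d ∙ f) ⟩
        coeff (d ∙ f) (shift 1ℤ e p)   ≡⟨ coeff-shift-∤ 1ℤ e (d ∙ f) p ∤ ⟩
        0ℤ                             ∎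
      ... | yes (f′ , ef′≡df) = begin
        coeff f p                       ≡⟨ coeff-monomial-* d f p ⟨
        coeff (d ∙ f) (monomial d * p)  ≡⟨ same (d ∙ f) ⟩
        coeff (d ∙ f) (monomial e * p)  ≡⟨ cong (λ g → coeff g (monomial e * p)) ef′≡df ⟨
        coeff (e ∙ f′) (monomial e * p) ≡⟨ coeff-monomial-* e f′ p ⟩
        coeff f′ p                      ≡⟨ vanish n f′ (ℕ.<-≤-trans f′<f ≤n) ⟩
        0ℤ                              ∎
        where
        f′<f : degree f′ < degree f
        f′<f = ℕ.+-cancelˡ-< (degree d) _ _ (≡.subst (degree d ℕ.+ degree f′ <_)
          (trans (sym (degree-∙ e f′)) (trans (cong degree ef′≡df) (degree-∙ d f)))
          (ℕ.+-monoˡ-< (degree f′) d<e))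

-- Fillings as sequences of columns.

module ColumnDecomposition where

  open ≡ using (refl; sym; trans)

  -- The rows of a filling are continued past their last box by repeating the
  -- last entry, so that every filling has columns of full height n.

  rowHead : ∀ {l} → ℕ → Vec ℕ l → ℕ
  rowHead c []      = c
  rowHead c (x ∷ r) = x

  rowTail : ∀ {l} → Vec ℕ l → Vec ℕ (pred l)
  rowTail []      = []
  rowTail (x ∷ r) = r

  firstColumn : ∀ {n} {ℓ : Vec ℕ n} → Vec ℕ n → Filling ℓ → Vec ℕ n
  firstColumn []      []      = []
  firstColumn (c ∷ C) (r ∷ T) = rowHead c r ∷ firstColumn C T

  dropColumn : ∀ {n} {ℓ : Vec ℕ n} → Filling ℓ → Filling (Vec.map pred ℓ)
  dropColumn []      = []
  dropColumn (r ∷ T) = rowTail r ∷ dropColumn T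

  column : ∀ {n} {ℓ : Vec ℕ n} → ℕ → Vec ℕ n → Filling ℓ → Vec ℕ n
  column zero    C T = C
  column (suc j) C T = column j (firstColumn C T) (dropColumn T)

  rowColumn : ∀ {l} → ℕ → ℕ → Vec ℕ l → ℕ
  rowColumn zero    c r = c
  rowColumn (suc j) c r = rowColumn j (rowHead c r) (rowTail r)

  column-∷ : ∀ {n} {l} {ℓ : Vec ℕ n} j c (C : Vec ℕ n) (r : Vec ℕ l) (T : Filling ℓ) →
    column j (c ∷ C) (r ∷ T) ≡ rowColumn j c r ∷ column j C T
  column-∷ zero    c C r T = refl
  column-∷ (suc j) c C r T = column-∷ j (rowHead c r) (firstColumn C T) (rowTail r) (dropColumn T)

  lookup-rowColumn : ∀ {l} c (r : Vec ℕ l) j → lookup (c ∷ r) j ≡ rowColumn (toℕ j) c r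
  lookup-rowColumn c r       zero    = refl
  lookup-rowColumn c (x ∷ r) (suc j) = lookup-rowColumn x r j

  content-column : ∀ {n} {ℓ : Vec ℕ n} (C : Vec ℕ n) (T : Filling ℓ) i j →
    lookup (lookup C i ∷ row T i) j ≡ lookup (column (toℕ j) C T) i
  content-column (c ∷ C) (r ∷ T) zero    j =
    trans (lookup-rowColumn c r j) (cong (λ D → lookup D zero) (sym (column-∷ (toℕ j) c C r T)))
  content-column (c ∷ C) (r ∷ T) (suc i) j = trans (content-column C T i j)
    (cong (λ D → lookup D (suc i)) (sym (column-∷ (toℕ j) c C r T)))

  entries : ℕ → List ℕ
  entries m = List.map suc (upTo m)

  states : ℕ → ∀ n → List (Vec ℕ n)
  states m zero    = [ [] ]
  states m (suc n) = cartesianProductWith _∷_ (entries m) (states m n)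

  -- The second argument is the number of boxes still to come in the row; a finished row keeps its
  -- last entry `c`.
  choices : ℕ → ℕ → ℕ → List ℕ
  choices m zero    c = [ c ]
  choices m (suc l) c = entries m

  -- Weak decrease is not imposed on these candidates: the entries of the transfer matrices vanish
  -- where it fails.
  columns : ∀ {n} → ℕ → Vec ℕ n → Vec ℕ n → List (Vec ℕ n)
  columns m []      []      = [ [] ]
  columns m (l ∷ ℓ) (c ∷ C) = cartesianProductWith _∷_ (choices m l c) (columns m ℓ C)

  entries-unique : ∀ m → ListUnique.Unique (entries m)
  entries-unique m = ListUnique.map⁺ ℕ.suc-injective (ListUnique.upTo⁺ m)

  ∈-entries⁺ : ∀ {m x} → 1 ≤ x → x ≤ m → x ∈ entries m
  ∈-entries⁺ {x = suc x} _ x<m = ∈-map⁺ suc (∈-upTo⁺ x<m)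

  ∈-entries⁻ : ∀ {m x} → x ∈ entries m → 1 ≤ x × x ≤ m
  ∈-entries⁻ x∈ with ∈-map⁻ suc x∈
  ... | y , y∈ , refl = s≤s z≤n , ∈-upTo⁻ y∈

  states-unique : ∀ m n → ListUnique.Unique (states m n)
  states-unique m zero    = [] ∷ []
  states-unique m (suc n) = ListUnique.cartesianProductWith⁺ _∷_ (λ { refl → refl , refl })
    (entries-unique m) (states-unique m n)

  ∈-states⁺ : ∀ {m n} (C : Vec ℕ n) → (∀ i → 1 ≤ lookup C i × lookup C i ≤ m) → C ∈ states m n
  ∈-states⁺ []      h = here refl
  ∈-states⁺ (c ∷ C) h = ∈-cartesianProductWith⁺ _∷_
    (∈-entries⁺ (proj₁ (h zero)) (proj₂ (h zero))) (∈-states⁺ C (h ∘ suc))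

  ∈-states⁻ : ∀ {m n} {C : Vec ℕ n} → C ∈ states m n → ∀ i → 1 ≤ lookup C i × lookup C i ≤ m
  ∈-states⁻ {m} {suc n} C∈ i with ∈-cartesianProductWith⁻ _∷_ (entries m) (states m n) C∈
  ∈-states⁻ {m} {suc n} C∈ zero    | c , C , c∈ , C∈′ , refl = ∈-entries⁻ c∈
  ∈-states⁻ {m} {suc n} C∈ (suc i) | c , C , c∈ , C∈′ , refl = ∈-states⁻ C∈′ i

  columns-unique : ∀ {n} m (ℓ C : Vec ℕ n) → ListUnique.Unique (columns m ℓ C)
  columns-unique m []      []      = [] ∷ []
  columns-unique m (l ∷ ℓ) (c ∷ C) = ListUnique.cartesianProductWith⁺ _∷_ (λ { refl → refl , refl })
    (choices-unique l) (columns-unique m ℓ C)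
    where
    choices-unique : ∀ l → ListUnique.Unique (choices m l c)
    choices-unique zero    = [] ∷ []
    choices-unique (suc l) = entries-unique m

  columns-self : ∀ {m n} (ℓ : Vec ℕ n) {C} → C ∈ states m n → C ∈ columns m ℓ C
  columns-self     []      {[]}    C∈ = here refl
  columns-self {m} (l ∷ ℓ) {c ∷ C} C∈ = ∈-cartesianProductWith⁺ _∷_ (self l)
    (columns-self ℓ (∈-states⁺ C (∈-states⁻ {m} C∈ ∘ suc)))
    where
    self : ∀ l → c ∈ choices m l c
    self zero    = here refl
    self (suc l) = ∈-entries⁺ (proj₁ (∈-states⁻ {m} C∈ zero)) (proj₂ (∈-states⁻ {m} C∈ zero))

  columns-lookup : ∀ {m n} (ℓ C : Vec ℕ n) {C′} → C′ ∈ columns m ℓ C →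
    ∀ i → lookup C′ i ∈ choices m (lookup ℓ i) (lookup C i)
  columns-lookup {m} (l ∷ ℓ) (c ∷ C) C′∈ i
    with ∈-cartesianProductWith⁻ _∷_ (choices m l c) (columns m ℓ C) C′∈
  columns-lookup (l ∷ ℓ) (c ∷ C) C′∈ zero    | _ , _ , c∈ , _  , refl = c∈
  columns-lookup (l ∷ ℓ) (c ∷ C) C′∈ (suc i) | _ , _ , _  , C∈ , refl = columns-lookup ℓ C C∈ i

  columns-frozen : ∀ {m n} (ℓ C : Vec ℕ n) {C′} → C′ ∈ columns m ℓ C →
    ∀ i → lookup ℓ i ≡ 0 → lookup C′ i ≡ lookup C i
  columns-frozen ℓ C C′∈ i ℓᵢ≡0 with lookup ℓ i | ℓᵢ≡0 | columns-lookup ℓ C C′∈ i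
  ... | _ | refl | here eq = eq

  columns⊆states : ∀ {m n} (ℓ : Vec ℕ n) {C C′} → C ∈ states m n → C′ ∈ columns m ℓ C → C′ ∈ states m n
  columns⊆states {m} ℓ {C} {C′} C∈ C′∈ = ∈-states⁺ C′ λ i →
    bounds i (lookup ℓ i) (columns-lookup ℓ C C′∈ i)
    where
    bounds : ∀ i l → lookup C′ i ∈ choices m l (lookup C i) → 1 ≤ lookup C′ i × lookup C′ i ≤ m
    bounds i zero    (here eq) rewrite eq = ∈-states⁻ C∈ i
    bounds i (suc l) ∈                    = ∈-entries⁻ ∈

  -- The candidates depend only on which rows are finished. This allows a column of the stretched
  -- shape to be replaced by one of α.
  columns-cong : ∀ {m n} (ℓ ℓ′ C : Vec ℕ n) → (∀ i → lookup ℓ i ≡ 0 → lookup ℓ′ i ≡ 0) →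
    (∀ i → lookup ℓ′ i ≡ 0 → lookup ℓ i ≡ 0) → columns m ℓ C ≡ columns m ℓ′ C
  columns-cong []      []        []      ⇒ ⇐ = refl
  columns-cong {m} (l ∷ ℓ) (l′ ∷ ℓ′) (c ∷ C) ⇒ ⇐ =
    cong₂ (cartesianProductWith _∷_)
      (choices-cong l l′ (⇒ zero) (⇐ zero)) (columns-cong ℓ ℓ′ C (⇒ ∘ suc) (⇐ ∘ suc))
    where
    choices-cong : ∀ l l′ → (l ≡ 0 → l′ ≡ 0) → (l′ ≡ 0 → l ≡ 0) → choices m l c ≡ choices m l′ c
    choices-cong zero    zero     _ _ = refl
    choices-cong zero    (suc l′) h _ with () ← h refl
    choices-cong (suc l) zero     _ h with () ← h refl
    choices-cong (suc l) (suc l′) _ _ = refl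

  module Columns (S : CommutativeSemiring 0ℓ 0ℓ) where

    open CommutativeSemiring S hiding (refl; sym; trans)
    private module S = CommutativeSemiring S
    open import Relation.Binary.Reasoning.Setoid setoid
    open ListSum S

    rows-peel : ∀ m l c (F : ℕ → Vec ℕ (pred l) → Carrier) →
      (∑[ r ← rows m l ] F (rowHead c r) (rowTail r)) ≈
      (∑[ x ← choices m l c ] ∑[ r ← rows m (pred l) ] F x r)
    rows-peel m zero    c F = S.sym (+-identityʳ _)
    rows-peel m (suc l) c F = sum-cartesianProductWith _∷_ (entries m) (rows m l) _

    -- A filling is the same as its first column together with a filling of the shortened shape: for
    -- a finished row the head is forced and the tail stays empty. The exchange of sums collects the
    -- heads of all rows before the tails.
    fillings-peel : ∀ m {n} (ℓ C : Vec ℕ n) (G : Vec ℕ n → Filling (Vec.map pred ℓ) → Carrier) →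
      (∑[ T ← fillings m ℓ ] G (firstColumn C T) (dropColumn T)) ≈
      (∑[ C′ ← columns m ℓ C ] ∑[ T ← fillings m (Vec.map pred ℓ) ] G C′ T)
    fillings-peel m []      []      G = S.sym (+-identityʳ _)
    fillings-peel m (l ∷ ℓ) (c ∷ C) G = begin
      (∑[ T ← fillings m (l ∷ ℓ) ] G (firstColumn (c ∷ C) T) (dropColumn T))
        ≈⟨ sum-cartesianProductWith _∷_ (rows m l) (fillings m ℓ) _ ⟩
      (∑[ r ← rows m l ] ∑[ T ← fillings m ℓ ]
        G (rowHead c r ∷ firstColumn C T) (rowTail r ∷ dropColumn T))
        ≈⟨ sum-cong (rows m l) (λ r → fillings-peel m ℓ C λ C′ T → G (rowHead c r ∷ C′) (rowTail r ∷ T)) ⟩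
      (∑[ r ← rows m l ] ∑[ C′ ← columns m ℓ C ] ∑[ T ← fillings m (Vec.map pred ℓ) ]
        G (rowHead c r ∷ C′) (rowTail r ∷ T))
        ≈⟨ rows-peel m l c _ ⟩
      (∑[ x ← choices m l c ] ∑[ r ← rows m (pred l) ] ∑[ C′ ← columns m ℓ C ]
        ∑[ T ← fillings m (Vec.map pred ℓ) ] G (x ∷ C′) (r ∷ T))
        ≈⟨ sum-cong (choices m l c) (λ x → sum-swap (rows m (pred l)) (columns m ℓ C) _) ⟩
      (∑[ x ← choices m l c ] ∑[ C′ ← columns m ℓ C ] ∑[ r ← rows m (pred l) ]
        ∑[ T ← fillings m (Vec.map pred ℓ) ] G (x ∷ C′) (r ∷ T))
        ≈⟨ sum-cong (choices m l c) (λ x → sum-cong (columns m ℓ C) λ C′ →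
             sum-cartesianProductWith _∷_ (rows m (pred l)) (fillings m (Vec.map pred ℓ)) _) ⟨
      (∑[ x ← choices m l c ] ∑[ C′ ← columns m ℓ C ]
        ∑[ T ← fillings m (Vec.map pred (l ∷ ℓ)) ] G (x ∷ C′) T)
        ≈⟨ sum-cartesianProductWith _∷_ (choices m l c) (columns m ℓ C) _ ⟨
      (∑[ C′ ← columns m (l ∷ ℓ) (c ∷ C) ] ∑[ T ← fillings m (Vec.map pred (l ∷ ℓ)) ] G C′ T) ∎

    product : ℕ → (ℕ → Carrier) → Carrier
    product zero    f = 1#
    product (suc K) f = f 0 * product K (f ∘ suc)

    transfer : ∀ {n} → ℕ → (ℕ → Vec ℕ n → Vec ℕ n → Carrier) → ℕ → Vec ℕ n → Vec ℕ n → Carrier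
    transfer m entry zero    ℓ C = 1#
    transfer m entry (suc K) ℓ C =
      ∑[ C′ ← columns m ℓ C ] entry 0 C C′ * transfer m (entry ∘ suc) K (Vec.map pred ℓ) C′

    sum-empty : ∀ m {n} (ℓ : Vec ℕ n) x → All (_≤ 0) ℓ → (∑[ T ← fillings m ℓ ] x) ≈ x
    sum-empty m []         x []          = +-identityʳ x
    sum-empty m (zero ∷ ℓ) x (z≤n ∷ ℓ≤0) = S.trans
      (sum-cartesianProductWith _∷_ (rows m 0) (fillings m ℓ) _)
      (S.trans (+-identityʳ _) (sum-empty m ℓ x ℓ≤0))

    -- After K columns every row is finished and exactly one filling is left, which contributes the
    -- final factor 1.
    sum-fillings : ∀ m {n} K (ℓ C : Vec ℕ n) (entry : ℕ → Vec ℕ n → Vec ℕ n → Carrier) → All (_≤ K) ℓ →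
      (∑[ T ← fillings m ℓ ] product K (λ j → entry j (column j C T) (column (suc j) C T))) ≈
      transfer m entry K ℓ C
    sum-fillings m zero    ℓ C entry ℓ≤ = sum-empty m ℓ 1# ℓ≤
    sum-fillings m (suc K) ℓ C entry ℓ≤ = S.trans
      (fillings-peel m ℓ C λ C′ T →
        entry 0 C C′ * product K (λ j → entry (suc j) (column j C′ T) (column (suc j) C′ T)))
      (sum-cong (columns m ℓ C) λ C′ → S.trans (sum-*ˡ (fillings m (Vec.map pred ℓ)) _ _)
        (*-congˡ (sum-fillings m K (Vec.map pred ℓ) C′ (entry ∘ suc) (pred-≤ ℓ≤))))
      where
      pred-≤ : ∀ {n} {ℓ : Vec ℕ n} → All (_≤ suc K) ℓ → All (_≤ K) (Vec.map pred ℓ)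
      pred-≤ []         = []
      pred-≤ (l≤ ∷ ℓ≤) = ℕ.pred-mono-≤ l≤ ∷ pred-≤ ℓ≤

open ColumnDecomposition

-- Conditions and statistics of a pair of adjacent columns.

module Statistics where

  open ≡ using (refl; sym; trans)
  open ≡.≡-Reasoning
  open ListSum ℕ.+-*-commutativeSemiring
  open import Algebra.Properties.CommutativeSemigroup ℕ.+-commutativeSemigroup using (interchange)

  -- The conditions and statistics that a pair of adjacent columns C, D
  -- contributes, where row i has a box in the column of C iff u ≤ ℓᵢ and in
  -- the column of D iff v ≤ ℓᵢ.
  module Step {n : ℕ} (ℓ : Vec ℕ n) (u v : ℕ) (C D : Vec ℕ n) where

    private
      ℓ[_] C[_] D[_] : Fin n → ℕ
      ℓ[_] = lookup ℓ
      C[_] = lookup C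
      D[_] = lookup D

    Distinct : Set
    Distinct = ∀ i c → v ≤ ℓ[ i ] → v ≤ ℓ[ c ] → D[ i ] ≡ D[ c ] → i ≡ c

    -- Distinctness is recorded in each step, also for semi-standard fillings where it is a
    -- consequence, because a column that has been reached must be known to allow its own
    -- repetition.
    Admissible : Set
    Admissible = (∀ i → v ≤ ℓ[ i ] → 1 ≤ D[ i ] × D[ i ] ≤ C[ i ]) × Distinct

    -- Row `i` contains a and b of the triple, a in `C` and b in `D`. Row `c` contains the third
    -- box, which lies in `D` for type A and in `C` for type B.
    TripleA TripleB InversionA InversionB : Fin n → Fin n → Set
    TripleA    i c = v ≤ ℓ[ i ] × v ≤ ℓ[ c ] × i Fin.< c × ℓ[ c ] ≤ ℓ[ i ]
    TripleB    i c = v ≤ ℓ[ i ] × u ≤ ℓ[ c ] × c Fin.< i × ℓ[ c ] < ℓ[ i ]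
    InversionA i c = D[ c ] ≤ C[ i ] × D[ i ] ≤ D[ c ]
    InversionB i c = C[ c ] ≤ C[ i ] × D[ i ] ≤ C[ c ]

    SSAFStep : Set
    SSAFStep = Admissible ×
      (∀ i c → TripleA i c → ¬ InversionA i c) × (∀ i c → TripleB i c → ¬ InversionB i c)

    -- `Distinct` excludes attacks inside the right column, and the second part those between the
    -- columns. Attacks inside the basement belong to no step.
    NAWFStep : Set
    NAWFStep = Admissible × (∀ i c → i Fin.< c → u ≤ ℓ[ i ] → v ≤ ℓ[ c ] → C[ i ] ≢ D[ c ])

    distinct? : Dec Distinct
    distinct? = Fin.all? λ i → Fin.all? λ c →
      (v ℕ.≤? ℓ[ i ]) →-dec (v ℕ.≤? ℓ[ c ]) →-dec (D[ i ] ℕ.≟ D[ c ]) →-dec (i Fin.≟ c)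

    admissible? : Dec Admissible
    admissible? =
      (Fin.all? λ i → (v ℕ.≤? ℓ[ i ]) →-dec ((1 ℕ.≤? D[ i ]) ×-dec (D[ i ] ℕ.≤? C[ i ]))) ×-dec distinct?

    tripleA? : ∀ i c → Dec (TripleA i c)
    tripleA? i c = (v ℕ.≤? ℓ[ i ]) ×-dec (v ℕ.≤? ℓ[ c ]) ×-dec (i Fin.<? c) ×-dec (ℓ[ c ] ℕ.≤? ℓ[ i ])

    tripleB? : ∀ i c → Dec (TripleB i c)
    tripleB? i c = (v ℕ.≤? ℓ[ i ]) ×-dec (u ℕ.≤? ℓ[ c ]) ×-dec (c Fin.<? i) ×-dec (ℓ[ c ] ℕ.<? ℓ[ i ])

    inversionA? : ∀ i c → Dec (InversionA i c)
    inversionA? i c = (D[ c ] ℕ.≤? C[ i ]) ×-dec (D[ i ] ℕ.≤? D[ c ])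

    inversionB? : ∀ i c → Dec (InversionB i c)
    inversionB? i c = (C[ c ] ℕ.≤? C[ i ]) ×-dec (D[ i ] ℕ.≤? C[ c ])

    coinversionA? : ∀ i c → Dec (TripleA i c × ¬ InversionA i c)
    coinversionA? i c = tripleA? i c ×-dec ¬? (inversionA? i c)

    coinversionB? : ∀ i c → Dec (TripleB i c × ¬ InversionB i c)
    coinversionB? i c = tripleB? i c ×-dec ¬? (inversionB? i c)

    ssafStep? : Dec SSAFStep
    ssafStep? = admissible? ×-dec
      (Fin.all? λ i → Fin.all? λ c → tripleA? i c →-dec ¬? (inversionA? i c)) ×-dec
      (Fin.all? λ i → Fin.all? λ c → tripleB? i c →-dec ¬? (inversionB? i c))

    nawfStep? : Dec NAWFStep
    nawfStep? = admissible? ×-dec (Fin.all? λ i → Fin.all? λ c →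
      (i Fin.<? c) →-dec (u ℕ.≤? ℓ[ i ]) →-dec (v ℕ.≤? ℓ[ c ]) →-dec ¬? (C[ i ] ℕ.≟ D[ c ]))

    coinvStep : ℕ
    coinvStep = sumOver (allFin n) λ i → sumOver (allFin n) λ c →
      ifYes (coinversionA? i c) 1 ℕ.+ ifYes (coinversionB? i c) 1

    dnStep : ℕ
    dnStep = sumOver (allFin n) λ i → ifYes ((v ℕ.≤? ℓ[ i ]) ×-dec ¬? (C[ i ] ℕ.≟ D[ i ])) 1

    weightStep : (m : ℕ) → Vec ℕ m
    weightStep m = tabulate λ x → sumOver (allFin n) λ i →
      ifYes ((v ℕ.≤? ℓ[ i ]) ×-dec (D[ i ] ℕ.≟ suc (toℕ x))) 1

  open Step public

  -- The shape and the column indices enter a step only through the rows present on either side and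
  -- through the order of the row lengths. Stretching the shape preserves this order.
  record SameStep {n : ℕ} (ℓ : Vec ℕ n) (u v : ℕ) (ℓ′ : Vec ℕ n) (u′ v′ : ℕ) : Set where
    constructor sameStep
    field
      left⇒   : ∀ i → u ≤ lookup ℓ i → u′ ≤ lookup ℓ′ i
      left⇐   : ∀ i → u′ ≤ lookup ℓ′ i → u ≤ lookup ℓ i
      right⇒  : ∀ i → v ≤ lookup ℓ i → v′ ≤ lookup ℓ′ i
      right⇐  : ∀ i → v′ ≤ lookup ℓ′ i → v ≤ lookup ℓ i
      length⇒ : ∀ i c → lookup ℓ c ≤ lookup ℓ i → lookup ℓ′ c ≤ lookup ℓ′ i
      length⇐ : ∀ i c → lookup ℓ′ c ≤ lookup ℓ′ i → lookup ℓ c ≤ lookup ℓ i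

  module _ {n : ℕ} {ℓ ℓ′ : Vec ℕ n} {u v u′ v′ : ℕ} where

    sameStep-sym : SameStep ℓ u v ℓ′ u′ v′ → SameStep ℓ′ u′ v′ ℓ u v
    sameStep-sym (sameStep l⇒ l⇐ r⇒ r⇐ n⇒ n⇐) = sameStep l⇐ l⇒ r⇐ r⇒ n⇐ n⇒

    module _ (same : SameStep ℓ u v ℓ′ u′ v′) {C D : Vec ℕ n} where

      open SameStep same

      strict⇒ : ∀ i c → lookup ℓ c < lookup ℓ i → lookup ℓ′ c < lookup ℓ′ i
      strict⇒ i c <ℓ = ℕ.≰⇒> λ ≤ℓ′ → ℕ.<⇒≱ <ℓ (length⇐ c i ≤ℓ′)

      strict⇐ : ∀ i c → lookup ℓ′ c < lookup ℓ′ i → lookup ℓ c < lookup ℓ i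
      strict⇐ i c <ℓ′ = ℕ.≰⇒> λ ≤ℓ → ℕ.<⇒≱ <ℓ′ (length⇒ c i ≤ℓ)

      tripleA-same : ∀ i c → TripleA ℓ u v C D i c → TripleA ℓ′ u′ v′ C D i c
      tripleA-same i c (vi , vc , i<c , ≤ℓ) = right⇒ i vi , right⇒ c vc , i<c , length⇒ i c ≤ℓ

      tripleB-same : ∀ i c → TripleB ℓ u v C D i c → TripleB ℓ′ u′ v′ C D i c
      tripleB-same i c (vi , uc , c<i , <ℓ) = right⇒ i vi , left⇒ c uc , c<i , strict⇒ i c <ℓ

      tripleA-same⁻ : ∀ i c → TripleA ℓ′ u′ v′ C D i c → TripleA ℓ u v C D i c
      tripleA-same⁻ i c (vi , vc , i<c , ≤ℓ) = right⇐ i vi , right⇐ c vc , i<c , length⇐ i c ≤ℓ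

      tripleB-same⁻ : ∀ i c → TripleB ℓ′ u′ v′ C D i c → TripleB ℓ u v C D i c
      tripleB-same⁻ i c (vi , uc , c<i , <ℓ) = right⇐ i vi , left⇐ c uc , c<i , strict⇐ i c <ℓ

      admissible-same : Admissible ℓ u v C D → Admissible ℓ′ u′ v′ C D
      admissible-same (bounds , distinct) =
        (λ i vi → bounds i (right⇐ i vi)) , λ i c vi vc → distinct i c (right⇐ i vi) (right⇐ c vc)

      ssafStep-same : SSAFStep ℓ u v C D → SSAFStep ℓ′ u′ v′ C D
      ssafStep-same (adm , noA , noB) = admissible-same adm ,
        (λ i c t → noA i c (tripleA-same⁻ i c t)) , (λ i c t → noB i c (tripleB-same⁻ i c t))

      nawfStep-same : NAWFStep ℓ u v C D → NAWFStep ℓ′ u′ v′ C D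
      nawfStep-same (adm , na) = admissible-same adm ,
        λ i c i<c ui vc → na i c i<c (left⇐ i ui) (right⇐ c vc)

      coinvStep-same : coinvStep ℓ u v C D ≡ coinvStep ℓ′ u′ v′ C D
      coinvStep-same = sum-cong (allFin n) λ i → sum-cong (allFin n) λ c → cong₂ ℕ._+_
        (ifYes-cong (coinversionA? ℓ u v C D i c) (coinversionA? ℓ′ u′ v′ C D i c)
          (λ (t , ¬i) → tripleA-same i c t , ¬i) (λ (t , ¬i) → tripleA-same⁻ i c t , ¬i) λ _ → refl)
        (ifYes-cong (coinversionB? ℓ u v C D i c) (coinversionB? ℓ′ u′ v′ C D i c)
          (λ (t , ¬i) → tripleB-same i c t , ¬i) (λ (t , ¬i) → tripleB-same⁻ i c t , ¬i) λ _ → refl)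

      dnStep-same : dnStep ℓ u v C D ≡ dnStep ℓ′ u′ v′ C D
      dnStep-same = sum-cong (allFin n) λ i →
        ifYes-cong ((v ℕ.≤? lookup ℓ i) ×-dec ¬? (lookup C i ℕ.≟ lookup D i))
          ((v′ ℕ.≤? lookup ℓ′ i) ×-dec ¬? (lookup C i ℕ.≟ lookup D i))
          (λ (vi , p) → right⇒ i vi , p) (λ (vi , p) → right⇐ i vi , p) λ _ → refl

      weightStep-same : ∀ m → weightStep ℓ u v C D m ≡ weightStep ℓ′ u′ v′ C D m
      weightStep-same m = tabulate-cong λ x → sum-cong (allFin n) λ i →
        ifYes-cong ((v ℕ.≤? lookup ℓ i) ×-dec (lookup D i ℕ.≟ suc (toℕ x)))
          ((v′ ℕ.≤? lookup ℓ′ i) ×-dec (lookup D i ℕ.≟ suc (toℕ x)))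
          (λ (vi , p) → right⇒ i vi , p) (λ (vi , p) → right⇐ i vi , p) λ _ → refl

  module _ {n : ℕ} (ℓ : Vec ℕ n) (v : ℕ) (C : Vec ℕ n) where

    -- When a column repeats, the two inequalities of an inversion triple force equal entries in two
    -- rows of that column.
    ssafStep-diagonal : Admissible ℓ v v C C → SSAFStep ℓ v v C C
    ssafStep-diagonal adm@(_ , distinct) = adm ,
      (λ i c (vi , vc , i<c , _) (Dc≤Ci , Di≤Dc) →
        Fin.<⇒≢ i<c (distinct i c vi vc (ℕ.≤-antisym Di≤Dc Dc≤Ci))) ,
      (λ i c (vi , vc , c<i , _) (Cc≤Ci , Di≤Cc) →
        Fin.<⇒≢ c<i (distinct c i vc vi (ℕ.≤-antisym Cc≤Ci Di≤Cc)))

    nawfStep-diagonal : Admissible ℓ v v C C → NAWFStep ℓ v v C C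
    nawfStep-diagonal adm@(_ , distinct) = adm , λ i c i<c vi vc Ci≡Cc →
      Fin.<⇒≢ i<c (distinct i c vi vc Ci≡Cc)

    -- Removes the factor `s` from the diagonal entries, which leaves monomials.
    dnStep-diagonal : dnStep ℓ v v C C ≡ 0
    dnStep-diagonal = trans
      (sum-cong (allFin n) λ i →
        ifYes-no ((v ℕ.≤? lookup ℓ i) ×-dec ¬? (lookup C i ℕ.≟ lookup C i)) λ (_ , ≢) → ≢ refl)
      (sum-0 (allFin n))

  -- Conditions on fillings as conditions on all steps.

  module Global {n : ℕ} (β ℓ : Vec ℕ n) (T : Filling ℓ) (K : ℕ) (ℓ≤K : ∀ i → lookup ℓ i ≤ K) where

    open Augmented β ℓ hiding (IsSSAF; IsNAWF)

    X : ℕ → Vec ℕ n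
    X j = column j β T

    private module At (j : ℕ) = Step ℓ j (suc j) (X j) (X (suc j))

    value : Fin n → ℕ → ℕ
    value i j = lookup (X j) i

    content-value : ∀ b → content T b ≡ value (rowOf b) (col b)
    content-value (i , j) = content-column β T i j

    box : ∀ i {j} → j ≤ lookup ℓ i → Box
    box i j≤ = i , fromℕ< (s≤s j≤)

    col-box : ∀ i {j} (j≤ : j ≤ lookup ℓ i) → col (box i j≤) ≡ j
    col-box i j≤ = Fin.toℕ-fromℕ< (s≤s j≤)

    content-box : ∀ i {j} (j≤ : j ≤ lookup ℓ i) → content T (box i j≤) ≡ value i j
    content-box i j≤ = trans (content-value (box i j≤)) (cong (value i) (col-box i j≤))

    col≤ : ∀ b → col b ≤ rowLength b
    col≤ (i , j) = ℕ.≤-pred (Fin.toℕ<n j)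

    adjacent : ∀ i {j} (j< : suc j ≤ lookup ℓ i) → ImmediatelyLeft (box i (ℕ.<⇒≤ j<)) (box i j<)
    adjacent i j< = refl , trans (cong suc (col-box i (ℕ.<⇒≤ j<))) (sym (col-box i j<))

    Steps : (∀ (u v : ℕ) (C D : Vec ℕ n) → Set) → Set
    Steps P = ∀ j → j < K → P j (suc j) (X j) (X (suc j))

    box-cong : ∀ {i i′} {j : Fin (suc (lookup ℓ i))} {j′ : Fin (suc (lookup ℓ i′))} →
      i ≡ i′ → toℕ j ≡ toℕ j′ →
      _≡_ {A = Box} (i , j) (i′ , j′)
    box-cong refl eq = cong (_ ,_) (Fin.toℕ-injective eq)

    module _ (pos : PositiveEntries T) (dec : WeaklyDecreasingRows T) where

      bounds : ∀ j i → suc j ≤ lookup ℓ i → 1 ≤ value i (suc j) × value i (suc j) ≤ value i j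
      bounds j i j< =
        subst (1 ≤_) (content-box i j<) (pos (box i j<) (subst (1 ≤_) (sym (col-box i j<)) (s≤s z≤n))) ,
        subst₂ _≤_ (content-box i j<) (content-box i (ℕ.<⇒≤ j<))
          (dec (box i (ℕ.<⇒≤ j<)) (box i j<) (adjacent i j<))

      module _ (none : NoInversionTriples T) where

        noA : ∀ j i c → At.TripleA j i c → ¬ At.InversionA j i c
        noA j i c (i≤ , c≤ , i<c , ≤ℓ) (c≤i , i≤c) =
          none (box i (ℕ.<⇒≤ i≤)) (box i i≤) (box c c≤)
            (inj₁ (adjacent i i≤ , trans (col-box c c≤) (sym (col-box i i≤)) , i<c , ≤ℓ))
            (subst₂ _≤_ (sym (content-box c c≤)) (sym (content-box i (ℕ.<⇒≤ i≤))) c≤i ,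
             subst₂ _≤_ (sym (content-box i i≤)) (sym (content-box c c≤)) i≤c)

        noB : ∀ j i c → At.TripleB j i c → ¬ At.InversionB j i c
        noB j i c (i≤ , c≤ , c<i , <ℓ) (c≤i , i≤c) =
          none (box i (ℕ.<⇒≤ i≤)) (box i i≤) (box c c≤)
            (inj₂ (adjacent i i≤ , trans (col-box c c≤) (sym (col-box i (ℕ.<⇒≤ i≤))) , c<i , <ℓ))
            (subst₂ _≤_ (sym (content-box c c≤)) (sym (content-box i (ℕ.<⇒≤ i≤))) c≤i ,
             subst₂ _≤_ (sym (content-box i i≤)) (sym (content-box c c≤)) i≤c)

        -- Equal entries in rows i < c of a column form an inversion triple of
        -- type A with the box to the left of the first one or, if row c is
        -- longer, of type B with the box to the right of the second one.
        distinct-< : ∀ j i c → suc j ≤ lookup ℓ i → suc j ≤ lookup ℓ c → i Fin.< c →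
          value i (suc j) ≢ value c (suc j)
        distinct-< j i c i≤ c≤ i<c eq with lookup ℓ c ℕ.≤? lookup ℓ i
        ... | yes ≤ℓ = noA j i c (i≤ , c≤ , i<c , ≤ℓ)
          (ℕ.≤-trans (ℕ.≤-reflexive (sym eq)) (proj₂ (bounds j i i≤)) , ℕ.≤-reflexive eq)
        ... | no ≰ℓ = noB (suc j) c i (ℕ.≤-<-trans i≤ (ℕ.≰⇒> ≰ℓ) , i≤ , i<c , ℕ.≰⇒> ≰ℓ)
          (ℕ.≤-reflexive eq ,
           ℕ.≤-trans (proj₂ (bounds (suc j) c (ℕ.≤-<-trans i≤ (ℕ.≰⇒> ≰ℓ)))) (ℕ.≤-reflexive (sym eq)))

        ssaf-distinct : ∀ j → At.Distinct j
        ssaf-distinct j i c i≤ c≤ eq with Fin.<-cmp i c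
        ... | tri< i<c _ _ = contradiction eq (distinct-< j i c i≤ c≤ i<c)
        ... | tri≈ _ i≡c _ = i≡c
        ... | tri> _ _ c<i = contradiction (sym eq) (distinct-< j c i c≤ i≤ c<i)

      module _ (na : NonAttacking T) where

        nawf-distinct : ∀ j → At.Distinct j
        nawf-distinct j i c i≤ c≤ eq with i Fin.≟ c
        ... | yes i≡c = i≡c
        ... | no  i≢c = ⊥-elim (na (box i i≤) (box c c≤) (i≢c ∘ cong proj₁)
          (trans (content-box i i≤) (trans eq (sym (content-box c c≤))) ,
           inj₁ (trans (col-box i i≤) (sym (col-box c c≤)))))

        nawf-adjacent : ∀ j i c → i Fin.< c → j ≤ lookup ℓ i → suc j ≤ lookup ℓ c →
          value i j ≢ value c (suc j)
        nawf-adjacent j i c i<c i≤ c≤ eq = na (box i i≤) (box c c≤)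
          (λ eq′ → Fin.<⇒≢ i<c (cong proj₁ eq′))
          (trans (content-box i i≤) (trans eq (sym (content-box c c≤))) ,
           inj₂ (trans (cong suc (col-box i i≤)) (sym (col-box c c≤)) , i<c))

    ssaf⇒steps : IsSSAF β ℓ T → Steps (SSAFStep ℓ)
    ssaf⇒steps (pos , dec , none) j _ =
      (bounds pos dec j , ssaf-distinct pos dec none j) , noA pos dec none j , noB pos dec none j

    nawf⇒steps : IsNAWF β ℓ T → Steps (NAWFStep ℓ)
    nawf⇒steps (pos , dec , na) j _ =
      (bounds pos dec j , nawf-distinct pos dec na j) , nawf-adjacent pos dec na j

    module _ (adm : Steps (Admissible ℓ)) where

      positive : PositiveEntries T
      positive b@(i , suc q) _ = subst (1 ≤_) (sym (content-value b))
        (proj₁ (proj₁ (adm (toℕ q) (ℕ.<-≤-trans (col≤ b) (ℓ≤K i))) i (col≤ b)))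

      decreasing : WeaklyDecreasingRows T
      decreasing a@(i , p) b@(.i , suc q) (refl , eq) = subst₂ _≤_ (sym (content-value b))
        (trans (cong (value i) (sym (ℕ.suc-injective eq))) (sym (content-value a)))
        (proj₂ (proj₁ (adm (toℕ q) (ℕ.<-≤-trans (col≤ b) (ℓ≤K i))) i (col≤ b)))

    at : ∀ b {j} → col b ≡ j → content T b ≡ value (rowOf b) j
    at b eq = trans (content-value b) (cong (value (rowOf b)) eq)

    present : ∀ b {j} → col b ≡ j → j ≤ rowLength b
    present b eq = subst (_≤ rowLength b) eq (col≤ b)

    right : ∀ a b → ImmediatelyLeft a b → content T b ≡ value (rowOf a) (suc (col a))
    right a b (refl , pq) = at b (sym pq)

    steps⇒ssaf : Steps (SSAFStep ℓ) → IsSSAF β ℓ T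
    steps⇒ssaf steps = positive adm , decreasing adm , none
      where
      adm : Steps (Admissible ℓ)
      adm j j<K = proj₁ (steps j j<K)

      none : NoInversionTriples T
      none a@(i , p) b@(.i , q) c@(k , r) (inj₁ ((refl , pq) , r≡q , i<k , ≤ℓ)) (c≤a , b≤c) =
        proj₁ (proj₂ (steps (toℕ p) (ℕ.<-≤-trans (present b (sym pq)) (ℓ≤K i)))) i k
          (present b (sym pq) , present c r≡ , i<k , ≤ℓ)
          (subst₂ _≤_ (at c r≡) (at a refl) c≤a , subst₂ _≤_ (at b (sym pq)) (at c r≡) b≤c)
        where
        r≡ : col c ≡ suc (toℕ p)
        r≡ = trans r≡q (sym pq)
      none a@(i , p) b@(.i , q) c@(k , r) (inj₂ ((refl , pq) , r≡p , k<i , <ℓ)) (c≤a , b≤c) =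
        proj₂ (proj₂ (steps (toℕ p) (ℕ.<-≤-trans (present b (sym pq)) (ℓ≤K i)))) i k
          (present b (sym pq) , present c r≡p , k<i , <ℓ)
          (subst₂ _≤_ (at c r≡p) (at a refl) c≤a , subst₂ _≤_ (at b (sym pq)) (at c r≡p) b≤c)

    steps⇒nawf : Unique β → Steps (NAWFStep ℓ) → IsNAWF β ℓ T
    steps⇒nawf β-unique steps = positive adm , decreasing adm , nonAttacking
      where
      adm : Steps (Admissible ℓ)
      adm j j<K = proj₁ (steps j j<K)

      sameColumn : ∀ i (p : Fin (suc (lookup ℓ i))) c (q : Fin (suc (lookup ℓ c))) → toℕ p ≡ toℕ q →
        content T (i , p) ≡ content T (c , q) → i ≡ c
      -- In the basement distinctness comes from `β-unique`; in column p + 1 it comes from the step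
      -- ending there.
      sameColumn i zero    c zero    _  eq = Unique.lookup-injective β-unique i c eq
      sameColumn i (suc p) c (suc q) pq eq =
        proj₂ (adm (toℕ p) (ℕ.<-≤-trans (col≤ (i , suc p)) (ℓ≤K i))) i c
        (col≤ (i , suc p)) (present (c , suc q) (sym pq))
        (trans (sym (at (i , suc p) refl)) (trans eq (at (c , suc q) (sym pq))))

      nonAttacking : NonAttacking T
      nonAttacking (i , p) (c , q) a≢b (eq , inj₁ pq) = a≢b (box-cong (sameColumn i p c q pq eq) pq)
      nonAttacking a@(i , p) b@(c , q) a≢b (eq , inj₂ (pq , i<c)) =
        proj₂ (steps (toℕ p) (ℕ.<-≤-trans (present b (sym pq)) (ℓ≤K c)))
          i c i<c (col≤ a) (present b (sym pq))
          (trans (sym (at a refl)) (trans eq (at b (sym pq))))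

  -- Statistics of fillings as sums over steps.

  length-filter-sum : ∀ {A : Set} {P : Pred A 0ℓ} (P? : Decidable P) xs →
    length (filter P? xs) ≡ (∑[ x ← xs ] ifYes (P? x) 1)
  length-filter-sum P? []       = refl
  length-filter-sum P? (x ∷ xs) with P? x
  ... | yes _ = cong suc (length-filter-sum P? xs)
  ... | no  _ = length-filter-sum P? xs

  sumTo : ℕ → (ℕ → ℕ) → ℕ
  sumTo zero    f = 0
  sumTo (suc K) f = f 0 ℕ.+ sumTo K (f ∘ suc)

  sumTo-extend : ∀ {l K} → l ≤ K → ∀ f → (∀ j → l ≤ j → f j ≡ 0) → sumTo l f ≡ sumTo K f
  sumTo-extend {K = zero}  z≤n       f f≡0 = refl
  sumTo-extend {K = suc K} z≤n       f f≡0 =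
    cong₂ ℕ._+_ (sym (f≡0 0 z≤n)) (sumTo-extend {K = K} z≤n (f ∘ suc) λ j _ → f≡0 (suc j) z≤n)
  sumTo-extend             (s≤s l≤K) f f≡0 =
    cong (f 0 ℕ.+_) (sumTo-extend l≤K (f ∘ suc) λ j l≤j → f≡0 (suc j) (s≤s l≤j))

  sumTo-cong : ∀ K {f g : ℕ → ℕ} → (∀ j → f j ≡ g j) → sumTo K f ≡ sumTo K g
  sumTo-cong zero    eq = refl
  sumTo-cong (suc K) eq = cong₂ ℕ._+_ (eq 0) (sumTo-cong K (eq ∘ suc))

  sumTo-0 : ∀ K → sumTo K (λ _ → 0) ≡ 0
  sumTo-0 zero    = refl
  sumTo-0 (suc K) = sumTo-0 K

  sumTo-+ : ∀ K f g → sumTo K (λ j → f j ℕ.+ g j) ≡ sumTo K f ℕ.+ sumTo K g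
  sumTo-+ zero    f g = refl
  sumTo-+ (suc K) f g = trans (cong (_ ℕ.+_) (sumTo-+ K (f ∘ suc) (g ∘ suc))) (interchange (f 0) (g 0) _ _)

  sumTo-swap : ∀ {A : Set} (xs : List A) K (f : A → ℕ → ℕ) →
    (∑[ x ← xs ] sumTo K (f x)) ≡ sumTo K (λ j → ∑[ x ← xs ] f x j)
  sumTo-swap []       K f = sym (sumTo-0 K)
  sumTo-swap (x ∷ xs) K f = trans (cong (sumTo K (f x) ℕ.+_) (sumTo-swap xs K f)) (sym (sumTo-+ K (f x) _))

  sum-tabulate : ∀ {A : Set} l (h : Fin l → A) (f : A → ℕ) (g : ℕ → ℕ) → (∀ i → f (h i) ≡ g (toℕ i)) →
    sumOver (List.tabulate h) f ≡ sumTo l g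
  sum-tabulate zero    h f g eq = refl
  sum-tabulate (suc l) h f g eq = cong₂ ℕ._+_ (eq zero) (sum-tabulate l (h ∘ suc) f (g ∘ suc) (eq ∘ suc))

  module Counting {n : ℕ} (β ℓ : Vec ℕ n) (T : Filling ℓ) (K : ℕ) (ℓ≤K : ∀ i → lookup ℓ i ≤ K) where

    open Augmented β ℓ
    open Global β ℓ T K ℓ≤K

    private module At (j : ℕ) = Step ℓ j (suc j) (X j) (X (suc j))

    sum-boxes : ∀ (f : Box → ℕ) →
      sumOver boxes f ≡ (∑[ i ← allFin n ] ∑[ j ← allFin (suc (lookup ℓ i)) ] f (i , j))
    sum-boxes f = trans (sum-concatMap _ (allFin n) f)
      (sum-cong (allFin n) λ i → sum-map (i ,_) (allFin (suc (lookup ℓ i))) f)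

    -- Each box is charged to the step in which it is on the left. The last of the ℓᵢ + 1 boxes of a
    -- row starts no step of that row, so its term is dropped before the sum is extended to K.
    sum-boxes-left : ∀ (f : Box → ℕ) (g : Fin n → ℕ → ℕ) → (∀ b → f b ≡ g (rowOf b) (col b)) →
      (∀ i j → lookup ℓ i ≤ j → g i j ≡ 0) → sumOver boxes f ≡ sumTo K (λ j → ∑[ i ← allFin n ] g i j)
    sum-boxes-left f g eq g≡0 = begin
      sumOver boxes f
        ≡⟨ sum-boxes f ⟩
      (∑[ i ← allFin n ] ∑[ j ← allFin (suc (lookup ℓ i)) ] f (i , j))
        ≡⟨ sum-cong (allFin n) (λ i → trans
             (sum-tabulate (suc (lookup ℓ i)) id _ (g i) λ j → eq (i , j))
             (trans (sym (sumTo-extend (ℕ.n≤1+n _) (g i) (g≡0 i))) (sumTo-extend (ℓ≤K i) (g i) (g≡0 i)))) ⟩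
      (∑[ i ← allFin n ] sumTo K (g i))
        ≡⟨ sumTo-swap (allFin n) K g ⟩
      sumTo K (λ j → ∑[ i ← allFin n ] g i j) ∎

    -- Each box is charged to the step in which it is on the right; the basement boxes are on the
    -- right of none.
    sum-boxes-right : ∀ (f : Box → ℕ) (g : Fin n → ℕ → ℕ) → (∀ i → f (i , zero) ≡ 0) →
      (∀ i j → f (i , suc j) ≡ g i (toℕ j)) →
      (∀ i j → lookup ℓ i ≤ j → g i j ≡ 0) → sumOver boxes f ≡ sumTo K (λ j → ∑[ i ← allFin n ] g i j)
    sum-boxes-right f g f≡0 eq g≡0 = begin
      sumOver boxes f
        ≡⟨ sum-boxes f ⟩
      (∑[ i ← allFin n ] ∑[ j ← allFin (suc (lookup ℓ i)) ] f (i , j))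
        ≡⟨ sum-cong (allFin n) (λ i → trans
             (cong₂ ℕ._+_ (f≡0 i) (sum-tabulate (lookup ℓ i) suc _ (g i) (eq i)))
             (sumTo-extend (ℓ≤K i) (g i) (g≡0 i))) ⟩
      (∑[ i ← allFin n ] sumTo K (g i))
        ≡⟨ sumTo-swap (allFin n) K g ⟩
      sumTo K (λ j → ∑[ i ← allFin n ] g i j) ∎

    sum-column : ∀ p (f : Box → ℕ) (g : Fin n → ℕ) → (∀ b → f b ≡ ifYes (col b ℕ.≟ p) (g (rowOf b))) →
      sumOver boxes f ≡ (∑[ i ← allFin n ] ifYes (p ℕ.≤? lookup ℓ i) (g i))
    sum-column p f g eq = trans (sum-boxes f) (sum-cong (allFin n) λ i →
      trans (sum-cong (allFin (suc (lookup ℓ i))) λ j → eq (i , j)) (inRow i (p ℕ.≤? lookup ℓ i)))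
      where
      inRow : ∀ i (p≤? : Dec (p ≤ lookup ℓ i)) →
        (∑[ j ← allFin (suc (lookup ℓ i)) ] ifYes (toℕ j ℕ.≟ p) (g i)) ≡ ifYes p≤? (g i)
      inRow i (yes p≤) = trans
        (sum-cong (allFin (suc (lookup ℓ i))) λ j →
          ifYes-cong (toℕ j ℕ.≟ p) (fromℕ< (s≤s p≤) Fin.≟ j)
            (λ eq → Fin.toℕ-injective (trans (Fin.toℕ-fromℕ< (s≤s p≤)) (sym eq)))
            (λ eq → trans (cong toℕ (sym eq)) (Fin.toℕ-fromℕ< (s≤s p≤))) λ _ → refl)
        (sum-δ Fin._≟_ (ListUnique.allFin⁺ _) (∈-allFin (fromℕ< (s≤s p≤))) λ _ → g i)
      inRow i (no p≰) = trans
        (sum-cong (allFin (suc (lookup ℓ i))) λ j → ifYes-no (toℕ j ℕ.≟ p) λ eq →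
          p≰ (subst (_≤ lookup ℓ i) eq (ℕ.≤-pred (Fin.toℕ<n j))))
        (sum-0 (allFin (suc (lookup ℓ i))))

    -- The box to the right of a, when it exists, is the only b such that a is
    -- immediately left of b.
    sum-right : ∀ a (f : Box → ℕ) x →
      (∀ b → f b ≡ ifYes (immediatelyLeft? a b) x) →
      sumOver boxes f ≡ ifYes (suc (col a) ℕ.≤? rowLength a) x
    sum-right a f x eq = begin
      sumOver boxes f
        ≡⟨ sum-column (suc (col a)) f (λ i → ifYes (rowOf a Fin.≟ i) x) (λ b → trans (eq b) (nest b)) ⟩
      (∑[ i ← allFin n ] ifYes (suc (col a) ℕ.≤? lookup ℓ i) (ifYes (rowOf a Fin.≟ i) x))
        ≡⟨ sum-cong (allFin n) (λ i → ifYes-swap (suc (col a) ℕ.≤? lookup ℓ i) (rowOf a Fin.≟ i)) ⟩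
      (∑[ i ← allFin n ] ifYes (rowOf a Fin.≟ i) (ifYes (suc (col a) ℕ.≤? lookup ℓ i) x))
        ≡⟨ sum-δ Fin._≟_ (ListUnique.allFin⁺ n) (∈-allFin (rowOf a))
             (λ i → ifYes (suc (col a) ℕ.≤? lookup ℓ i) x) ⟩
      ifYes (suc (col a) ℕ.≤? rowLength a) x ∎
      where
      nest : ∀ b → ifYes (immediatelyLeft? a b) x ≡
        ifYes (col b ℕ.≟ suc (col a)) (ifYes (rowOf a Fin.≟ rowOf b) x)
      nest b = ifYes-split (immediatelyLeft? a b) (col b ℕ.≟ suc (col a)) (rowOf a Fin.≟ rowOf b)
        (λ (i≡ , pq) → sym pq , i≡) (λ qp i≡ → i≡ , sym qp)

    dn-steps : dn T ≡ sumTo K (λ j → At.dnStep j)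
    dn-steps = begin
      dn T
        ≡⟨ length-filter-sum _ (cartesianProduct boxes boxes) ⟩
      (∑[ ab ← cartesianProduct boxes boxes ]
        ifYes (immediatelyLeft? (proj₁ ab) (proj₂ ab) ×-dec
          ¬? (content T (proj₁ ab) ℕ.≟ content T (proj₂ ab))) 1)
        ≡⟨ sum-cartesianProductWith _,_ boxes boxes _ ⟩
      (∑[ a ← boxes ] ∑[ b ← boxes ] ifYes (immediatelyLeft? a b ×-dec ¬? (content T a ℕ.≟ content T b)) 1)
        ≡⟨ sum-boxes-left _
             (λ i j → ifYes ((suc j ℕ.≤? lookup ℓ i) ×-dec ¬? (value i j ℕ.≟ value i (suc j))) 1)
             (λ a → trans (sum-right a _ _ (collapse a)) (merge a))
             (λ i j ≤j → ifYes-no ((suc j ℕ.≤? lookup ℓ i) ×-dec ¬? (value i j ℕ.≟ value i (suc j)))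
               λ (j< , _) → ℕ.<⇒≱ j< ≤j) ⟩
      sumTo K (λ j → At.dnStep j) ∎
      where
      differ? : ∀ i j → Dec (value i j ≢ value i (suc j))
      differ? i j = ¬? (value i j ℕ.≟ value i (suc j))

      collapse : ∀ a b → ifYes (immediatelyLeft? a b ×-dec ¬? (content T a ℕ.≟ content T b)) 1 ≡
        ifYes (immediatelyLeft? a b) (ifYes (differ? (rowOf a) (col a)) 1)
      collapse a b = ifYes-split
        (immediatelyLeft? a b ×-dec ¬? (content T a ℕ.≟ content T b))
        (immediatelyLeft? a b) (differ? (rowOf a) (col a))
        (λ (left , a≢b) → left , λ eq → a≢b (trans (at a refl) (trans eq (sym (right a b left)))))
        (λ left ≢ → left , λ eq → ≢ (trans (sym (at a refl)) (trans eq (right a b left))))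

      merge : ∀ a → ifYes (suc (col a) ℕ.≤? rowLength a) (ifYes (differ? (rowOf a) (col a)) 1) ≡
        ifYes ((suc (col a) ℕ.≤? rowLength a) ×-dec differ? (rowOf a) (col a)) 1
      merge a = sym (ifYes-split ((suc (col a) ℕ.≤? rowLength a) ×-dec differ? (rowOf a) (col a))
        (suc (col a) ℕ.≤? rowLength a) (differ? (rowOf a) (col a)) id _,_)

    weight-steps : ∀ m x → lookup (weight T m) x ≡
      sumTo K (λ j → lookup (At.weightStep j m) x)
    weight-steps m x = begin
      lookup (weight T m) x
        ≡⟨ lookup∘tabulate _ x ⟩
      length (filter (λ b → (1 ℕ.≤? col b) ×-dec (content T b ℕ.≟ suc (toℕ x))) boxes)
        ≡⟨ length-filter-sum (λ b → (1 ℕ.≤? col b) ×-dec (content T b ℕ.≟ suc (toℕ x))) boxes ⟩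
      (∑[ b ← boxes ] ifYes ((1 ℕ.≤? col b) ×-dec (content T b ℕ.≟ suc (toℕ x))) 1)
        ≡⟨ sum-boxes-right _
             (λ i j → ifYes ((suc j ℕ.≤? lookup ℓ i) ×-dec (value i (suc j) ℕ.≟ suc (toℕ x))) 1)
             (λ _ → refl)
             (λ i j → ifYes-cong ((1 ℕ.≤? suc (toℕ j)) ×-dec (content T (i , suc j) ℕ.≟ suc (toℕ x)))
               ((suc (toℕ j) ℕ.≤? lookup ℓ i) ×-dec (value i (suc (toℕ j)) ℕ.≟ suc (toℕ x)))
               (λ (_ , eq) → col≤ (i , suc j) , trans (sym (at (i , suc j) refl)) eq)
               (λ (_ , eq) → s≤s z≤n , trans (at (i , suc j) refl) eq) λ _ → refl)
             (λ i j ≤j → ifYes-no ((suc j ℕ.≤? lookup ℓ i) ×-dec (value i (suc j) ℕ.≟ suc (toℕ x)))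
               λ (j< , _) → ℕ.<⇒≱ j< ≤j) ⟩
      sumTo K (λ j → ∑[ i ← allFin n ]
        ifYes ((suc j ℕ.≤? lookup ℓ i) ×-dec (value i (suc j) ℕ.≟ suc (toℕ x))) 1)
        ≡⟨ sumTo-cong K (λ j → lookup∘tabulate (λ x → ∑[ i ← allFin n ]
             ifYes ((suc j ℕ.≤? lookup ℓ i) ×-dec (value i (suc j) ℕ.≟ suc (toℕ x))) 1) x) ⟨
      sumTo K (λ j → lookup (At.weightStep j m) x) ∎

    -- The box a fixes the step and the row, b is then forced, and c can only lie in one of the two
    -- columns of the step.
    coinv-steps : coinv T ≡ sumTo K (λ j → At.coinvStep j)
    coinv-steps = begin
      coinv T
        ≡⟨ length-filter-sum _ (cartesianProduct boxes (cartesianProduct boxes boxes)) ⟩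
      (∑[ (a , b , c) ← cartesianProduct boxes (cartesianProduct boxes boxes) ] count a b c)
        ≡⟨ sum-cartesianProductWith _,_ boxes (cartesianProduct boxes boxes) _ ⟩
      (∑[ a ← boxes ] ∑[ (b , c) ← cartesianProduct boxes boxes ] count a b c)
        ≡⟨ sum-cong boxes (λ a → sum-cartesianProductWith _,_ boxes boxes _) ⟩
      (∑[ a ← boxes ] ∑[ b ← boxes ] ∑[ c ← boxes ] count a b c)
        ≡⟨ sum-boxes-left _ (λ i j → ∑[ c ← allFin n ] rowCount i j c)
             (λ a → trans (sum-right a _ (∑[ c ← allFin n ] rowCountʳ a c) (collapse a)) (merge a))
             (λ i j ≤j → rowCount-0 i j (ℕ.≤⇒≯ ≤j)) ⟩
      sumTo K (λ j → At.coinvStep j) ∎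
      where
      count : Box → Box → Box → ℕ
      count a b c = ifYes (triple? a b c ×-dec ¬? (inversion? T a b c)) 1

      rowCount : Fin n → ℕ → Fin n → ℕ
      rowCount i j c = ifYes (At.coinversionA? j i c) 1 ℕ.+ ifYes (At.coinversionB? j i c) 1

      rowCount-0 : ∀ i j → ¬ suc j ≤ lookup ℓ i → (∑[ c ← allFin n ] rowCount i j c) ≡ 0
      rowCount-0 i j j≮ = trans
        (sum-cong (allFin n) λ c → cong₂ ℕ._+_
          (ifYes-no (At.coinversionA? j i c)
            λ ((j< , _) , _) → j≮ j<)
          (ifYes-no (At.coinversionB? j i c)
            λ ((j< , _) , _) → j≮ j<))
        (sum-0 (allFin n))

      module _ (a : Box) where

        private
          i = rowOf a
          j = col a

        A? : ∀ c → Dec (i Fin.< c × lookup ℓ c ≤ lookup ℓ i × ¬ At.InversionA j i c)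
        A? c = (i Fin.<? c) ×-dec (lookup ℓ c ℕ.≤? lookup ℓ i) ×-dec ¬? (At.inversionA? j i c)

        B? : ∀ c → Dec (c Fin.< i × lookup ℓ c < lookup ℓ i × ¬ At.InversionB j i c)
        B? c = (c Fin.<? i) ×-dec (lookup ℓ c ℕ.<? lookup ℓ i) ×-dec ¬? (At.inversionB? j i c)

        -- The presence of the third box is the outer condition, as `sum-column` produces it. The
        -- presence of b is left to `sum-right`.
        rowCountʳ : Fin n → ℕ
        rowCountʳ c = ifYes (suc j ℕ.≤? lookup ℓ c) (ifYes (A? c) 1) ℕ.+
          ifYes (j ℕ.≤? lookup ℓ c) (ifYes (B? c) 1)

        -- The column of c decides the type of the triple, so at most one of the two summands is
        -- nonzero.
        split : ∀ b → (left : ImmediatelyLeft a b) → ∀ c → count a b c ≡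
          ifYes (col c ℕ.≟ suc j) (ifYes (A? (rowOf c)) 1) ℕ.+ ifYes (col c ℕ.≟ j) (ifYes (B? (rowOf c)) 1)
        split b left@(_ , pq) c = cases (col c ℕ.≟ suc j) (col c ℕ.≟ j)
          where
          inversion⇒ : ∀ {r} → col c ≡ r → Inversion T a b c →
            value (rowOf c) r ≤ value i j × value i (suc j) ≤ value (rowOf c) r
          inversion⇒ eq (c≤a , b≤c) =
            subst₂ _≤_ (at c eq) (at a refl) c≤a , subst₂ _≤_ (right a b left) (at c eq) b≤c

          inversion⇐ : ∀ {r} → col c ≡ r →
            value (rowOf c) r ≤ value i j × value i (suc j) ≤ value (rowOf c) r → Inversion T a b c
          inversion⇐ eq (c≤a , b≤c) =
            subst₂ _≤_ (sym (at c eq)) (sym (at a refl)) c≤a ,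
            subst₂ _≤_ (sym (right a b left)) (sym (at c eq)) b≤c

          cases : (p? : Dec (col c ≡ suc j)) (q? : Dec (col c ≡ j)) → count a b c ≡
            ifYes p? (ifYes (A? (rowOf c)) 1) ℕ.+ ifYes q? (ifYes (B? (rowOf c)) 1)
          cases (yes p) (yes q) = contradiction (trans (sym p) q) ℕ.1+n≢n
          cases (yes p) (no ¬q) = trans
            (ifYes-cong (triple? a b c ×-dec ¬? (inversion? T a b c)) (A? (rowOf c))
              (λ { (inj₁ (_ , _ , b<c , ≤ℓ) , ¬inv) →
                   subst (Fin._< _) (sym (proj₁ left)) b<c , ≤ℓ , ¬inv ∘ inversion⇐ p
                 ; (inj₂ (_ , q , _) , _) → contradiction q ¬q })
              (λ (i<c , ≤ℓ , ¬inv) →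
                inj₁ (left , trans p pq , subst (Fin._< _) (proj₁ left) i<c , ≤ℓ) , ¬inv ∘ inversion⇒ p)
              λ _ → refl)
            (sym (ℕ.+-identityʳ _))
          cases (no ¬p) (yes q) =
            ifYes-cong (triple? a b c ×-dec ¬? (inversion? T a b c)) (B? (rowOf c))
              (λ { (inj₁ (_ , p , _) , _) → contradiction (trans p (sym pq)) ¬p
                 ; (inj₂ (_ , _ , c<a , <ℓ) , ¬inv) → c<a , <ℓ , ¬inv ∘ inversion⇐ q })
              (λ (c<i , <ℓ , ¬inv) → inj₂ (left , q , c<i , <ℓ) , ¬inv ∘ inversion⇒ q)
              λ _ → refl
          cases (no ¬p) (no ¬q) = ifYes-no (triple? a b c ×-dec ¬? (inversion? T a b c))
            λ { (inj₁ (_ , p , _) , _) → ¬p (trans p (sym pq)) ; (inj₂ (_ , q , _) , _) → ¬q q }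

        collapse : ∀ b → (∑[ c ← boxes ] count a b c) ≡
          ifYes (immediatelyLeft? a b) (∑[ c ← allFin n ] rowCountʳ c)
        collapse b = cases (immediatelyLeft? a b)
          where
          cases : (left? : Dec (ImmediatelyLeft a b)) →
            (∑[ c ← boxes ] count a b c) ≡ ifYes left? (∑[ c ← allFin n ] rowCountʳ c)
          cases (yes left) = begin
            (∑[ c ← boxes ] count a b c)
              ≡⟨ sum-cong boxes (split b left) ⟩
            (∑[ c ← boxes ] ifYes (col c ℕ.≟ suc j) (ifYes (A? (rowOf c)) 1) ℕ.+
                              ifYes (col c ℕ.≟ j) (ifYes (B? (rowOf c)) 1))
              ≡⟨ sum-+ boxes _ _ ⟩
            (∑[ c ← boxes ] ifYes (col c ℕ.≟ suc j) (ifYes (A? (rowOf c)) 1)) ℕ.+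
            (∑[ c ← boxes ] ifYes (col c ℕ.≟ j) (ifYes (B? (rowOf c)) 1))
              ≡⟨ cong₂ ℕ._+_ (sum-column (suc j) _ (λ c → ifYes (A? c) 1) λ _ → refl)
                             (sum-column j _ (λ c → ifYes (B? c) 1) λ _ → refl) ⟩
            (∑[ c ← allFin n ] ifYes (suc j ℕ.≤? lookup ℓ c) (ifYes (A? c) 1)) ℕ.+
            (∑[ c ← allFin n ] ifYes (j ℕ.≤? lookup ℓ c) (ifYes (B? c) 1))
              ≡⟨ sum-+ (allFin n) _ _ ⟨
            (∑[ c ← allFin n ] rowCountʳ c) ∎
          cases (no ¬left) = trans
            (sum-cong boxes λ c → ifYes-no (triple? a b c ×-dec ¬? (inversion? T a b c))
              λ { (inj₁ (left , _) , _) → ¬left left ; (inj₂ (left , _) , _) → ¬left left })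
            (sum-0 boxes)

        merge : ifYes (suc j ℕ.≤? lookup ℓ i) (∑[ c ← allFin n ] rowCountʳ c) ≡
          (∑[ c ← allFin n ] rowCount i j c)
        merge = cases (suc j ℕ.≤? lookup ℓ i)
          where
          cases : (j<? : Dec (suc j ≤ lookup ℓ i)) →
            ifYes j<? (∑[ c ← allFin n ] rowCountʳ c) ≡ (∑[ c ← allFin n ] rowCount i j c)
          cases (yes j<) = sum-cong (allFin n) λ c → sym (cong₂ ℕ._+_
            (ifYes-split (At.coinversionA? j i c)
              (suc j ℕ.≤? lookup ℓ c) (A? c)
              (λ ((_ , c≤ , i<c , ≤ℓ) , ¬inv) → c≤ , i<c , ≤ℓ , ¬inv)
              (λ c≤ (i<c , ≤ℓ , ¬inv) → (j< , c≤ , i<c , ≤ℓ) , ¬inv))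
            (ifYes-split (At.coinversionB? j i c)
              (j ℕ.≤? lookup ℓ c) (B? c)
              (λ ((_ , c≤ , c<i , <ℓ) , ¬inv) → c≤ , c<i , <ℓ , ¬inv)
              (λ c≤ (c<i , <ℓ , ¬inv) → (j< , c≤ , c<i , <ℓ) , ¬inv)))
          cases (no j≮) = sym (rowCount-0 i j j≮)

  -- The degree of a column and its strict descent.

  lookup≤⇒All : ∀ {K n} (v : Vec ℕ n) → (∀ i → lookup v i ≤ K) → All (_≤ K) v
  lookup≤⇒All []      h = []
  lookup≤⇒All (x ∷ v) h = h zero ∷ lookup≤⇒All v (h ∘ suc)

  lookup-ext : ∀ {A : Set} {n} (v w : Vec A n) → (∀ i → lookup v i ≡ lookup w i) → v ≡ w
  lookup-ext v w eq = ≡.trans (≡.sym (tabulate∘lookup v)) (≡.trans (tabulate-cong eq) (tabulate∘lookup w))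

  sum-<⊎≡ : ∀ {A : Set} (xs : List A) (f g : A → ℕ) → (∀ x → f x ≤ g x) →
    sumOver xs f < sumOver xs g ⊎ (sumOver xs f ≤ sumOver xs g × (∀ x → x ∈ xs → f x ≡ g x))
  sum-<⊎≡ []       f g f≤g = inj₂ (z≤n , λ _ ())
  sum-<⊎≡ (x ∷ xs) f g f≤g with sum-<⊎≡ xs f g f≤g | ℕ.m≤n⇒m<n∨m≡n (f≤g x)
  ... | inj₁ <          | _        = inj₁ (ℕ.+-mono-≤-< (f≤g x) <)
  ... | inj₂ (≤ , _)    | inj₁ f<g = inj₁ (ℕ.+-mono-<-≤ f<g ≤)
  ... | inj₂ (≤ , same) | inj₂ f≡g =
    inj₂ (ℕ.+-mono-≤ (f≤g x) ≤ , λ { y (here ≡.refl) → f≡g ; y (there y∈) → same y y∈ })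

  -- Coordinate x belongs to the content x + 1, hence the factor.
  weightedDegree : ∀ {d} → Vec ℕ d → ℕ
  weightedDegree {d} w = ∑[ x ← allFin d ] suc (toℕ x) ℕ.* lookup w x

  weightedDegree-+ : ∀ {d} (v w : Vec ℕ d) →
    weightedDegree (zipWith ℕ._+_ v w) ≡ weightedDegree v ℕ.+ weightedDegree w
  weightedDegree-+ {d} v w = ≡.trans
    (sum-cong (allFin d) λ x → ≡.trans (cong (suc (toℕ x) ℕ.*_) (lookup-zipWith ℕ._+_ x v w))
      (ℕ.*-distribˡ-+ (suc (toℕ x)) (lookup v x) (lookup w x)))
    (sum-+ (allFin d) _ _)

  weightedDegree-0 : ∀ d → weightedDegree (replicate d 0) ≡ 0
  weightedDegree-0 d = ≡.trans
    (sum-cong (allFin d) λ x → ≡.trans (cong (suc (toℕ x) ℕ.*_) (Vec.lookup-replicate x 0))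
      (ℕ.*-zeroʳ (suc (toℕ x))))
    (sum-0 (allFin d))

  module _ {n : ℕ} (ℓ : Vec ℕ n) (v : ℕ) where

    total : Vec ℕ n → ℕ
    total C = ∑[ i ← allFin n ] ifYes (v ℕ.≤? lookup ℓ i) (lookup C i)

    -- Rows left out of the sum are frozen, so two different columns differ in a row that counts,
    -- and there the entry drops.
    total-< : ∀ C D → (∀ i → v ≤ lookup ℓ i → lookup D i ≤ lookup C i) →
      (∀ i → ¬ v ≤ lookup ℓ i → lookup D i ≡ lookup C i) → C ≢ D → total D < total C
    total-< C D D≤C frozen C≢D with sum-<⊎≡ (allFin n) _ _ pointwise
      where
      pointwise : ∀ i → ifYes (v ℕ.≤? lookup ℓ i) (lookup D i) ≤ ifYes (v ℕ.≤? lookup ℓ i) (lookup C i)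
      pointwise i with v ℕ.≤? lookup ℓ i
      ... | yes v≤ = D≤C i v≤
      ... | no _   = z≤n
    ... | inj₁ <           = <
    ... | inj₂ (_ , equal) = contradiction (lookup-ext C D λ i → ≡.sym (same i)) C≢D
      where
      same : ∀ i → lookup D i ≡ lookup C i
      same i with v ℕ.≤? lookup ℓ i | equal i (∈-allFin i)
      ... | yes _  | eq = eq
      ... | no v≰  | _  = frozen i v≰

    -- After exchanging the sums, a row contributes x + 1 for the one variable x with content equal
    -- to its entry; the bound by d ensures that this variable exists.
    weightedDegree-weightStep : ∀ u d (C D : Vec ℕ n) →
      (∀ i → v ≤ lookup ℓ i → 1 ≤ lookup D i × lookup D i ≤ d) →
      weightedDegree (weightStep ℓ u v C D d) ≡ total D
    weightedDegree-weightStep u d C D bounds = begin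
      (∑[ x ← allFin d ] suc (toℕ x) ℕ.* lookup (weightStep ℓ u v C D d) x)
        ≡⟨ sum-cong (allFin d) (λ x → ≡.trans
             (cong (suc (toℕ x) ℕ.*_) (lookup∘tabulate (λ x → ∑[ i ← allFin n ] hit i x) x))
             (≡.sym (sum-*ˡ (allFin n) (suc (toℕ x)) (λ i → hit i x)))) ⟩
      (∑[ x ← allFin d ] ∑[ i ← allFin n ] suc (toℕ x) ℕ.* hit i x)
        ≡⟨ sum-swap (allFin d) (allFin n) _ ⟩
      (∑[ i ← allFin n ] ∑[ x ← allFin d ] suc (toℕ x) ℕ.* hit i x)
        ≡⟨ sum-cong (allFin n) inRow ⟩
      total D ∎
      where
      hit : Fin n → Fin d → ℕ
      hit i x = ifYes ((v ℕ.≤? lookup ℓ i) ×-dec (lookup D i ℕ.≟ suc (toℕ x))) 1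

      inRow : ∀ i → (∑[ x ← allFin d ] suc (toℕ x) ℕ.* hit i x) ≡ ifYes (v ℕ.≤? lookup ℓ i) (lookup D i)
      inRow i = cases (v ℕ.≤? lookup ℓ i)
        where
        absorb : ∀ {P : Set} (P? : Dec P) y → y ℕ.* ifYes P? 1 ≡ ifYes P? y
        absorb (yes _) y = ℕ.*-identityʳ y
        absorb (no _)  y = ℕ.*-zeroʳ y

        cases : (v≤? : Dec (v ≤ lookup ℓ i)) →
          (∑[ x ← allFin d ] suc (toℕ x) ℕ.* hit i x) ≡ ifYes v≤? (lookup D i)
        cases (no v≰) = ≡.trans
          (sum-cong (allFin d) λ x → ≡.trans
            (cong (suc (toℕ x) ℕ.*_)
              (ifYes-no ((v ℕ.≤? lookup ℓ i) ×-dec (lookup D i ℕ.≟ suc (toℕ x))) (v≰ ∘ proj₁)))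
            (ℕ.*-zeroʳ (suc (toℕ x))))
          (sum-0 (allFin d))
        cases (yes v≤) with lookup D i in eq | bounds i v≤
        ... | suc c | _ , c<d = ≡.trans
          (sum-cong (allFin d) λ x → ≡.trans
            (absorb ((v ℕ.≤? lookup ℓ i) ×-dec (suc c ℕ.≟ suc (toℕ x))) (suc (toℕ x)))
            (ifYes-cong ((v ℕ.≤? lookup ℓ i) ×-dec (suc c ℕ.≟ suc (toℕ x))) (fromℕ< c<d Fin.≟ x)
              (λ (_ , c≡x) → Fin.toℕ-injective (≡.trans (Fin.toℕ-fromℕ< c<d) (ℕ.suc-injective c≡x)))
              (λ c≡x → v≤ , cong suc (≡.trans (≡.sym (Fin.toℕ-fromℕ< c<d)) (cong toℕ c≡x)))
              λ _ → ≡.refl))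
          (≡.trans (sum-δ Fin._≟_ (ListUnique.allFin⁺ d) (∈-allFin (fromℕ< c<d)) (suc ∘ toℕ))
            (cong suc (Fin.toℕ-fromℕ< c<d)))

open Statistics

-- Generating functions as products of transfer operators.

-- The common ground of the two families of fillings: `same` lets the columns of a block share one
-- matrix, and `diagonal` makes its diagonal nonzero at columns with distinct entries.
record StepCondition : Set₁ where
  field
    Holds      : ∀ {n} → Vec ℕ n → ℕ → ℕ → Vec ℕ n → Vec ℕ n → Set
    holds?     : ∀ {n} (ℓ : Vec ℕ n) u v C D → Dec (Holds ℓ u v C D)
    admissible : ∀ {n} {ℓ : Vec ℕ n} {u v C D} → Holds ℓ u v C D → Admissible ℓ u v C D
    same       : ∀ {n} {ℓ ℓ′ : Vec ℕ n} {u v u′ v′ C D} → SameStep ℓ u v ℓ′ u′ v′ →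
      Holds ℓ u v C D → Holds ℓ′ u′ v′ C D
    diagonal   : ∀ {n} (ℓ : Vec ℕ n) v C → Admissible ℓ v v C C → Holds ℓ v v C C

-- A filling contributes x^w t^coinv s^dn. Since `t` has degree 0, the degree of a diagonal entry is
-- that of its weight, whatever power of `t` accompanies it.
record WeightedRing : Set₁ where
  field
    monomialRing : MonomialRing
  open MonomialRing monomialRing public
  field
    degree   : Exponent → ℕ
    degree-⊕ : ∀ d e → degree (d ⊕ e) ≡ degree d ℕ.+ degree e
    degree-𝟘 : degree 𝟘 ≡ 0
    regular  : ∀ d e → degree d < degree e → ExponentialSums.Regular monomialRing (mon d - mon e)
    _≟_      : DecidableEquality Exponent
    mon-injective : ∀ {d e} → mon d ≈ mon e → d ≡ e
    variables : ℕ
    x^_      : Vec ℕ variables → Exponent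
    x^-+     : ∀ v w → x^ (zipWith ℕ._+_ v w) ≡ (x^ v) ⊕ (x^ w)
    x^-0     : x^ (replicate variables 0) ≡ 𝟘
    degree-x : ∀ w → degree (x^ w) ≡ weightedDegree w
    t        : Exponent
    degree-t : degree t ≡ 0
    s        : Carrier

module Generating (W : WeightedRing) (condition : StepCondition) where

  open WeightedRing W renaming (refl to ≈-refl; sym to ≈-sym; trans to ≈-trans)
  open StepCondition condition
  open ListSum commutativeSemiring
  open ExponentialSums monomialRing
  open Transfer monomialRing
  open Columns commutativeSemiring
  open import Relation.Binary.Reasoning.Setoid setoid
  open import Algebra.Properties.Semiring.Exp semiring using (^-homo-*)
  open import Algebra.Solver.Ring.NaturalCoefficients.Default commutativeSemiring
    using (solve; _:=_; _:+_; _:*_)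

  monomialTerm : Vec ℕ variables → ℕ → ℕ → Carrier
  monomialTerm w c d = mon (x^ w) * mon t ^ c * s ^ d

  monomialTerm-trivial : mon t ≈ 1# → s ≈ 1# → ∀ w c d → monomialTerm w c d ≈ mon (x^ w)
  monomialTerm-trivial t≈1 s≈1 w c d = begin
    mon (x^ w) * mon t ^ c * s ^ d ≈⟨ *-cong (*-congˡ (^-congˡ c t≈1)) (^-congˡ d s≈1) ⟩
    mon (x^ w) * 1# ^ c * 1# ^ d   ≈⟨ *-cong (*-congˡ (1^ c)) (1^ d) ⟩
    mon (x^ w) * 1# * 1#           ≈⟨ ≈-trans (*-identityʳ _) (*-identityʳ _) ⟩
    mon (x^ w)                     ∎

  module _ {n : ℕ} (m : ℕ) where

    -- The right column has index v + 1, and a row has a box there iff ℓᵢ ∸ v is positive. The index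
    -- `u` of the left column is separate: within a block it is v + 1 as well, on entering the block
    -- it is v.
    stepOperator : Vec ℕ n → ℕ → ℕ → Operator (Vec ℕ n)
    stepOperator ℓ u v = record
      { next  = columns m (Vec.map (_∸ v) ℓ)
      ; entry = λ C D → ifYes (holds? ℓ u (suc v) C D) (monomialTerm
          (weightStep ℓ u (suc v) C D variables) (coinvStep ℓ u (suc v) C D) (dnStep ℓ u (suc v) C D))
      }

    open Operator

    apply-cong : ∀ (op : Operator (Vec ℕ n)) {f g} → (∀ C → f C ≈ g C) → ∀ C → apply op f C ≈ apply op g C
    apply-cong op f≈g C = sum-cong (next op C) λ D → *-congˡ (f≈g D)

    module _ {ℓ ℓ′ : Vec ℕ n} {u v u′ v′ : ℕ} (step : SameStep ℓ u (suc v) ℓ′ u′ (suc v′)) where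

      next-same : ∀ C → next (stepOperator ℓ u v) C ≡ next (stepOperator ℓ′ u′ v′) C
      next-same C = columns-cong (Vec.map (_∸ v) ℓ) (Vec.map (_∸ v′) ℓ′) C
        (λ i → transport ℓ ℓ′ (SameStep.right⇐ step i)) (λ i → transport ℓ′ ℓ (SameStep.right⇒ step i))
        where
        transport : ∀ {v v′ i} ℓ ℓ′ → (suc v′ ≤ lookup ℓ′ i → suc v ≤ lookup ℓ i) →
          lookup (Vec.map (_∸ v) ℓ) i ≡ 0 → lookup (Vec.map (_∸ v′) ℓ′) i ≡ 0
        transport {v} {v′} {i} ℓ ℓ′ h eq = ≡.trans (lookup-map i (_∸ v′) ℓ′) (ℕ.m≤n⇒m∸n≡0 (ℕ.≮⇒≥ λ <ℓ′ →
          ℕ.<⇒≱ (h <ℓ′) (ℕ.m∸n≡0⇒m≤n (≡.trans (≡.sym (lookup-map i (_∸ v) ℓ)) eq))))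

      entry-same : ∀ C D → entry (stepOperator ℓ u v) C D ≈ entry (stepOperator ℓ′ u′ v′) C D
      entry-same C D = ifYes-cong (holds? ℓ u (suc v) C D) (holds? ℓ′ u′ (suc v′) C D)
        (same step) (same (sameStep-sym step)) λ _ → reflexive (≡.trans
          (cong (λ w → monomialTerm w (coinvStep ℓ u (suc v) C D) (dnStep ℓ u (suc v) C D))
            (weightStep-same step {C} {D} variables))
          (cong₂ (monomialTerm _) (coinvStep-same step {C} {D}) (dnStep-same step {C} {D})))

      apply-same : ∀ {f g} → (∀ C → f C ≈ g C) →
        ∀ C → apply (stepOperator ℓ u v) f C ≈ apply (stepOperator ℓ′ u′ v′) g C
      apply-same {f} {g} f≈g C = begin
        apply (stepOperator ℓ u v) f C
          ≈⟨ sum-cong (next (stepOperator ℓ u v) C) (λ D → *-cong (entry-same C D) (f≈g D)) ⟩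
        sumOver (next (stepOperator ℓ u v) C) (λ D → entry (stepOperator ℓ′ u′ v′) C D * g D)
          ≡⟨ cong (λ xs → sumOver xs (λ D → entry (stepOperator ℓ′ u′ v′) C D * g D)) (next-same C) ⟩
        apply (stepOperator ℓ′ u′ v′) g C ∎

    run : Vec ℕ n → ℕ → ℕ → Vec ℕ n → Carrier
    run ℓ j zero    C = 1#
    run ℓ j (suc K) C = apply (stepOperator ℓ j j) (run ℓ (suc j) K) C

    stepEntry : Vec ℕ n → ℕ → Vec ℕ n → Vec ℕ n → Carrier
    stepEntry ℓ j = entry (stepOperator ℓ j j)

    -- `transfer` shortens the shape, while `run` keeps it and advances the column index. Triples
    -- compare the lengths of full rows, so the second form is the one to which `SameStep` applies.
    transfer-run : ∀ ℓ K j ℓ′ → (∀ i → lookup ℓ′ i ≡ lookup ℓ i ∸ j) →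
      ∀ e → (∀ i → e i ≡ stepEntry ℓ (i ℕ.+ j)) → ∀ C → transfer m e K ℓ′ C ≈ run ℓ j K C
    transfer-run ℓ zero    j ℓ′ ℓ′≡ e e≡ C = ≈-refl
    transfer-run ℓ (suc K) j ℓ′ ℓ′≡ e e≡ C = begin
      sumOver (columns m ℓ′ C) (λ D → e 0 C D * transfer m (e ∘ suc) K (Vec.map pred ℓ′) D)
        ≈⟨ sum-cong (columns m ℓ′ C) (λ D → *-cong (reflexive (cong (λ f → f C D) (e≡ 0)))
             (transfer-run ℓ K (suc j) (Vec.map pred ℓ′)
               (λ i → ≡.trans (lookup-map i pred ℓ′)
                 (≡.trans (cong pred (ℓ′≡ i)) (ℕ.pred[m∸n]≡m∸[1+n] (lookup ℓ i) j)))
               (e ∘ suc) (λ i → ≡.trans (e≡ (suc i)) (cong (stepEntry ℓ) (≡.sym (ℕ.+-suc i j)))) D)) ⟩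
      sumOver (columns m ℓ′ C) (λ D → stepEntry ℓ j C D * run ℓ (suc j) K D)
        ≡⟨ cong (λ xs → sumOver xs (λ D → stepEntry ℓ j C D * run ℓ (suc j) K D))
             (cong (λ ℓ → columns m ℓ C) (lookup-ext ℓ′ (Vec.map (_∸ j) ℓ) λ i →
               ≡.trans (ℓ′≡ i) (≡.sym (lookup-map i (_∸ j) ℓ)))) ⟩
      apply (stepOperator ℓ j j) (run ℓ (suc j) K) C ∎

    product-cong : ∀ K {f g : ℕ → Carrier} → (∀ j → j < K → f j ≈ g j) → product K f ≈ product K g
    product-cong zero    eq = ≈-refl
    product-cong (suc K) eq = *-cong (eq 0 (s≤s z≤n)) (product-cong K λ j j<K → eq (suc j) (s≤s j<K))

    product-ifYes-no : ∀ K {P : ℕ → Set} (P? : ∀ j → Dec (P j)) (f : ℕ → Carrier) → ¬ (∀ j → j < K → P j) →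
      product K (λ j → ifYes (P? j) (f j)) ≈ 0#
    product-ifYes-no zero    P? f ¬∀ = ⊥-elim (¬∀ λ _ ())
    product-ifYes-no (suc K) P? f ¬∀ with P? 0
    ... | no _  = zeroˡ _
    ... | yes p = ≈-trans (*-congˡ (product-ifYes-no K (P? ∘ suc) (f ∘ suc) λ ∀P → ¬∀ λ
      { zero _ → p ; (suc j) (s≤s j<K) → ∀P j j<K })) (zeroʳ _)

    product-monomialTerm : ∀ K (w : ℕ → Vec ℕ variables) c d →
      product K (λ j → monomialTerm (w j) (c j) (d j)) ≈
      monomialTerm (tabulate λ x → sumTo K λ j → lookup (w j) x) (sumTo K c) (sumTo K d)
    product-monomialTerm zero w c d = ≈-sym (≈-trans (*-identityʳ _) (≈-trans (*-identityʳ _)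
      (≈-trans (reflexive (cong mon (≡.trans (cong x^_ (lookup-ext _ _ λ i →
        ≡.trans (lookup∘tabulate (λ _ → 0) i) (≡.sym (Vec.lookup-replicate i 0)))) x^-0))) mon-𝟘)))
    product-monomialTerm (suc K) w c d = begin
      monomialTerm (w 0) (c 0) (d 0) * product K (λ j → monomialTerm (w (suc j)) (c (suc j)) (d (suc j)))
        ≈⟨ *-congˡ (product-monomialTerm K (w ∘ suc) (c ∘ suc) (d ∘ suc)) ⟩
      monomialTerm (w 0) (c 0) (d 0) * monomialTerm w′ (sumTo K (c ∘ suc)) (sumTo K (d ∘ suc))
        ≈⟨ solve 6 (λ x y z x′ y′ z′ →
             (x :* y :* z) :* (x′ :* y′ :* z′) := (x :* x′) :* (y :* y′) :* (z :* z′)) ≈-refl _ _ _ _ _ _ ⟩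
      (mon (x^ w 0) * mon (x^ w′)) * (mon t ^ c 0 * mon t ^ sumTo K (c ∘ suc)) *
      (s ^ d 0 * s ^ sumTo K (d ∘ suc))
        ≈⟨ *-cong (*-cong
             (≈-trans (reflexive (cong mon (≡.trans (cong x^_ w-suc) (x^-+ (w 0) w′)))) (mon-⊕ _ _))
             (^-homo-* (mon t) (c 0) _)) (^-homo-* s (d 0) _) ⟨
      monomialTerm (tabulate λ x → sumTo (suc K) λ j → lookup (w j) x) (sumTo (suc K) c) (sumTo (suc K) d) ∎
      where
      w′ : Vec ℕ variables
      w′ = tabulate λ x → sumTo K λ j → lookup (w (suc j)) x

      w-suc : (tabulate λ x → sumTo (suc K) λ j → lookup (w j) x) ≡ zipWith ℕ._+_ (w 0) w′
      w-suc = lookup-ext _ _ λ x → ≡.trans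
        (lookup∘tabulate (λ x → sumTo (suc K) λ j → lookup (w j) x) x) (≡.sym
        (≡.trans (lookup-zipWith ℕ._+_ x (w 0) w′)
          (cong (lookup (w 0) x ℕ.+_) (lookup∘tabulate (λ x → sumTo K λ j → lookup (w (suc j)) x) x))))

    module _ (β ℓ : Vec ℕ n) (K : ℕ) (ℓ≤K : ∀ i → lookup ℓ i ≤ K)
      {Φ : Pred (Filling ℓ) 0ℓ} (Φ? : Decidable Φ)
      (Φ⇒ : ∀ T → Φ T → Global.Steps β ℓ T K ℓ≤K (Holds ℓ))
      (⇒Φ : ∀ T → Global.Steps β ℓ T K ℓ≤K (Holds ℓ) → Φ T)
      where

      open Augmented β ℓ using (weight; coinv; dn)

      term : Filling ℓ → Carrier
      term T = monomialTerm (weight T variables) (coinv T) (dn T)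

      -- A filling outside `Φ` violates some step and the product has a zero factor; otherwise the
      -- statistics add up over the steps.
      term-product : ∀ T → ifYes (Φ? T) (term T) ≈
        product K (λ j → stepEntry ℓ j (column j β T) (column (suc j) β T))
      term-product T = cases (Φ? T)
        where
        open Global β ℓ T K ℓ≤K using (X; Steps)
        open Counting β ℓ T K ℓ≤K

        cases : (Φ? : Dec (Φ T)) → ifYes Φ? (term T) ≈ product K (λ j → stepEntry ℓ j (X j) (X (suc j)))
        cases (no ¬Φ) =
          ≈-sym (product-ifYes-no K (λ j → holds? ℓ j (suc j) (X j) (X (suc j))) _ (¬Φ ∘ ⇒Φ T))
        cases (yes Φ) = ≈-sym (begin
          product K (λ j → stepEntry ℓ j (X j) (X (suc j)))
            ≈⟨ product-cong K (λ j j<K → ifYes-yes (holds? ℓ j (suc j) (X j) (X (suc j))) (Φ⇒ T Φ j j<K)) ⟩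
          product K (λ j → monomialTerm (w j) (c j) (d j))
            ≈⟨ product-monomialTerm K w c d ⟩
          monomialTerm (tabulate λ x → sumTo K λ j → lookup (w j) x) (sumTo K c) (sumTo K d)
            ≡⟨ cong (λ w → monomialTerm w (sumTo K c) (sumTo K d)) (lookup-ext _ (weight T variables) λ x →
                 ≡.trans (lookup∘tabulate (λ x → sumTo K λ j → lookup (w j) x) x)
                   (≡.sym (weight-steps variables x))) ⟩
          monomialTerm (weight T variables) (sumTo K c) (sumTo K d)
            ≡⟨ cong₂ (monomialTerm (weight T variables)) (≡.sym coinv-steps) (≡.sym dn-steps) ⟩
          term T ∎)
          where
          w : ℕ → Vec ℕ variables
          w j = weightStep ℓ j (suc j) (X j) (X (suc j)) variables
          c d : ℕ → ℕ
          c j = coinvStep ℓ j (suc j) (X j) (X (suc j))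
          d j = dnStep ℓ j (suc j) (X j) (X (suc j))

      sum-run : sumOver (filter Φ? (fillings m ℓ)) term ≈ run ℓ 0 K β
      sum-run = begin
        sumOver (filter Φ? (fillings m ℓ)) term
          ≈⟨ sum-filter Φ? (fillings m ℓ) term ⟩
        sumOver (fillings m ℓ) (λ T → ifYes (Φ? T) (term T))
          ≈⟨ sum-cong (fillings m ℓ) term-product ⟩
        sumOver (fillings m ℓ) (λ T → product K (λ j → stepEntry ℓ j (column j β T) (column (suc j) β T)))
          ≈⟨ sum-fillings m K ℓ β (stepEntry ℓ) (lookup≤⇒All ℓ ℓ≤K) ⟩
        transfer m (stepEntry ℓ) K ℓ β
          ≈⟨ transfer-run ℓ K 0 ℓ (λ _ → ≡.refl) (stepEntry ℓ)
               (λ i → cong (stepEntry ℓ) (≡.sym (ℕ.+-identityʳ i))) β ⟩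
        run ℓ 0 K β ∎

-- Stretched shapes and their blocks of equal columns.

lookup≤maximum : ∀ {n} (v : Vec ℕ n) i → lookup v i ≤ maximum v
lookup≤maximum (x ∷ v) zero    = ℕ.m≤m⊔n x (maximum v)
lookup≤maximum (x ∷ v) (suc i) = ℕ.≤-trans (lookup≤maximum v i) (ℕ.m≤n⊔m x (maximum v))

·-≤ : ∀ k {n} (α : Vec ℕ n) i → lookup (k · α) i ≤ k ℕ.* maximum α
·-≤ k α i =
  subst (_≤ k ℕ.* maximum α) (≡.sym (lookup-map i (k ℕ.*_) α)) (ℕ.*-monoʳ-≤ k (lookup≤maximum α i))

module Stretched (W : WeightedRing) (condition : StepCondition) {n : ℕ} (m : ℕ)
  (m≤ : m ≤ WeightedRing.variables W) (α : Vec ℕ n) where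

  open WeightedRing W renaming (refl to ≈-refl; sym to ≈-sym; trans to ≈-trans)
  open StepCondition condition
  open ListSum commutativeSemiring
  open ExponentialSums monomialRing
  open Transfer monomialRing
  open Generating W condition
  open import Relation.Binary.Reasoning.Setoid setoid
  open Operator

  special ordinary : ℕ → Operator (Vec ℕ n)
  special  v = stepOperator m α v v
  ordinary v = stepOperator m α (suc v) v

  -- In the shape (k + 1) · α, row i has a box in each of the columns
  -- (k + 1) v + 1, …, (k + 1) (v + 1) iff v + 1 ≤ αᵢ. Hence these columns
  -- are reached by one special step and k equal steps.
  blocks : ℕ → ℕ → ℕ → Vec ℕ n → Carrier
  blocks k zero    v C = 1#
  blocks k (suc N) v C = apply (special v) (iterate (ordinary v) k (blocks k N (suc v))) C

  module _ (k : ℕ) where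

    private
      ℓ : Vec ℕ n
      ℓ = suc k · α

    length-· : ∀ i → lookup ℓ i ≡ suc k ℕ.* lookup α i
    length-· i = lookup-map i (suc k ℕ.*_) α

    -- All row lengths are multiples of k + 1, and for 1 ≤ j ≤ k + 1 no multiple lies strictly
    -- between (k + 1) v + j and (k + 1) (v + 1).
    level⇒ : ∀ v {j} → 1 ≤ j → ∀ i → suc k ℕ.* v ℕ.+ j ≤ lookup ℓ i → suc v ≤ lookup α i
    level⇒ v {j} 1≤j i ≤ℓ = ℕ.≰⇒> λ ≤v → ℕ.<⇒≱
      (ℕ.<-≤-trans (ℕ.m<m+n (suc k ℕ.* v) 1≤j) (subst (_ ≤_) (length-· i) ≤ℓ)) (ℕ.*-monoʳ-≤ (suc k) ≤v)

    level⇐ : ∀ v {j} → j ≤ suc k → ∀ i → suc v ≤ lookup α i → suc k ℕ.* v ℕ.+ j ≤ lookup ℓ i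
    level⇐ v {j} j≤ i v< = ℕ.≤-trans (ℕ.+-monoʳ-≤ (suc k ℕ.* v) j≤) (subst₂ _≤_
      (≡.trans (ℕ.*-suc (suc k) v) (ℕ.+-comm (suc k) _)) (≡.sym (length-· i)) (ℕ.*-monoʳ-≤ (suc k) v<))

    length⇒ : ∀ i c → lookup ℓ c ≤ lookup ℓ i → lookup α c ≤ lookup α i
    length⇒ i c ≤ℓ = ℕ.*-cancelˡ-≤ (suc k) (subst₂ _≤_ (length-· c) (length-· i) ≤ℓ)

    length⇐ : ∀ i c → lookup α c ≤ lookup α i → lookup ℓ c ≤ lookup ℓ i
    length⇐ i c ≤α = subst₂ _≤_ (≡.sym (length-· c)) (≡.sym (length-· i)) (ℕ.*-monoʳ-≤ (suc k) ≤α)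

    -- The left column (k + 1) v closes the previous block, or is the basement for v = 0, so it has
    -- the rows of column v of α.
    special-same : ∀ v → SameStep ℓ (suc k ℕ.* v) (suc (suc k ℕ.* v)) α v (suc v)
    special-same v = sameStep
      (λ i ≤ℓ → ℕ.*-cancelˡ-≤ (suc k) (subst (_ ≤_) (length-· i) ≤ℓ))
      (λ i ≤α → subst (_ ≤_) (≡.sym (length-· i)) (ℕ.*-monoʳ-≤ (suc k) ≤α))
      (λ i ≤ℓ → level⇒ v (s≤s z≤n) i (subst (_≤ lookup ℓ i) (ℕ.+-comm 1 _) ≤ℓ))
      (λ i ≤α → subst (_≤ lookup ℓ i) (ℕ.+-comm _ 1) (level⇐ v (s≤s z≤n) i ≤α))
      length⇒ length⇐

    ordinary-same : ∀ v {j} → 1 ≤ j → j ≤ k →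
      SameStep ℓ (suc k ℕ.* v ℕ.+ j) (suc (suc k ℕ.* v ℕ.+ j)) α (suc v) (suc v)
    ordinary-same v {j} 1≤j j≤k = sameStep
      (level⇒ v 1≤j) (level⇐ v (ℕ.m≤n⇒m≤1+n j≤k))
      (λ i ≤ℓ → level⇒ v (s≤s z≤n) i (subst (_≤ lookup ℓ i) (≡.sym (ℕ.+-suc _ j)) ≤ℓ))
      (λ i ≤α → subst (_≤ lookup ℓ i) (ℕ.+-suc _ j) (level⇐ v (s≤s j≤k) i ≤α))
      length⇒ length⇐

    -- Of the k ordinary steps of block v, `i` are done and `r` remain. At r = 0 the column index (k
    -- + 1) v + i + 1 has become (k + 1) (v + 1), where the next block starts.
    run-ordinary : ∀ v R r i → i ℕ.+ r ≡ k → ∀ C →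
      run m ℓ (suc k ℕ.* v ℕ.+ suc i) (r ℕ.+ R) C ≈
      iterate (ordinary v) r (run m ℓ (suc k ℕ.* suc v) R) C
    run-ordinary v R zero i eq C = reflexive (cong (λ j → run m ℓ j R C)
      (≡.trans (cong (λ i → suc k ℕ.* v ℕ.+ suc i) (≡.trans (≡.sym (ℕ.+-identityʳ i)) eq))
        (≡.trans (ℕ.+-comm _ (suc k)) (≡.sym (ℕ.*-suc (suc k) v)))))
    run-ordinary v R (suc r) i eq C = apply-same m
      (ordinary-same v (s≤s z≤n) (subst (suc i ≤_) eq′ (ℕ.m≤m+n (suc i) r)))
      (λ D → ≈-trans (reflexive (cong (λ j → run m ℓ j (r ℕ.+ R) D) (≡.sym (ℕ.+-suc _ (suc i)))))
        (run-ordinary v R r (suc i) eq′ D)) C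
      where
      eq′ : suc i ℕ.+ r ≡ k
      eq′ = ≡.trans (≡.sym (ℕ.+-suc i r)) eq

    run-blocks : ∀ N v C → run m ℓ (suc k ℕ.* v) (suc k ℕ.* N) C ≈ blocks k N v C
    run-blocks zero    v C = reflexive (cong (λ K → run m ℓ (suc k ℕ.* v) K C) (ℕ.*-zeroʳ (suc k)))
    run-blocks (suc N) v C = begin
      run m ℓ (suc k ℕ.* v) (suc k ℕ.* suc N) C
        ≡⟨ cong (λ K → run m ℓ (suc k ℕ.* v) K C) (ℕ.*-suc (suc k) N) ⟩
      apply (stepOperator m ℓ (suc k ℕ.* v) (suc k ℕ.* v)) (run m ℓ (suc (suc k ℕ.* v)) (k ℕ.+ suc k ℕ.* N)) C
        ≈⟨ apply-same m (special-same v) (λ D → ≈-trans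
             (reflexive (cong (λ j → run m ℓ j (k ℕ.+ suc k ℕ.* N) D) (ℕ.+-comm 1 (suc k ℕ.* v))))
             (run-ordinary v (suc k ℕ.* N) k 0 ≡.refl D)) C ⟩
      apply (special v) (iterate (ordinary v) k (run m ℓ (suc k ℕ.* suc v) (suc k ℕ.* N))) C
        ≈⟨ apply-cong m (special v) (iterate-cong k (run-blocks N (suc v))) C ⟩
      blocks k (suc N) v C ∎
      where
      iterate-cong : ∀ r {f g} → (∀ C → f C ≈ g C) →
        ∀ C → iterate (ordinary v) r f C ≈ iterate (ordinary v) r g C
      iterate-cong zero    f≈g = f≈g
      iterate-cong (suc r) f≈g = apply-cong m (ordinary v) (iterate-cong r f≈g)

  power : ℕ → Exponent
  power zero    = 𝟘
  power (suc c) = t ⊕ power c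

  mon-power : ∀ c → mon (power c) ≈ mon t ^ c
  mon-power zero    = mon-𝟘
  mon-power (suc c) = ≈-trans (mon-⊕ t (power c)) (*-congˡ (mon-power c))

  degree-power : ∀ c → degree (power c) ≡ 0
  degree-power zero    = degree-𝟘
  degree-power (suc c) = ≡.trans (degree-⊕ t (power c)) (cong₂ ℕ._+_ degree-t (degree-power c))

  -- Only the rows that continue into block v need distinct entries; finished rows are merely
  -- carried along.
  Good : ℕ → Vec ℕ n → Set
  Good v C = C ∈ states m n × Distinct α (suc v) (suc v) C C

  exponent : ℕ → Vec ℕ n → Exponent
  exponent v C = (x^ weightStep α (suc v) (suc v) C C variables) ⊕ power (coinvStep α (suc v) (suc v) C C)

  degree-exponent : ∀ v {C} → C ∈ states m n → degree (exponent v C) ≡ total α (suc v) C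
  degree-exponent v {C} C∈ = ≡.trans (degree-⊕ (x^ w) (power c)) (≡.trans
    (≡.trans (cong₂ ℕ._+_ (degree-x w) (degree-power c)) (ℕ.+-identityʳ _))
    (weightedDegree-weightStep α (suc v) (suc v) variables C C λ i _ →
      proj₁ (∈-states⁻ C∈ i) , ℕ.≤-trans (proj₂ (∈-states⁻ C∈ i)) m≤))
    where
    w = weightStep α (suc v) (suc v) C C variables
    c = coinvStep α (suc v) (suc v) C C

  frozen : ∀ u v {C D} → D ∈ next (stepOperator m α u v) C →
    ∀ i → ¬ suc v ≤ lookup α i → lookup D i ≡ lookup C i
  frozen u v {C} D∈ i v≮ = columns-frozen (Vec.map (_∸ v) α) C D∈ i
    (≡.trans (lookup-map i (_∸ v) α) (ℕ.m≤n⇒m∸n≡0 (ℕ.≮⇒≥ v≮)))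

  next⊆states : ∀ u v {C D} → C ∈ states m n → D ∈ next (stepOperator m α u v) C → D ∈ states m n
  next⊆states u v = columns⊆states (Vec.map (_∸ v) α)

  ordinary-triangular : ∀ v → Triangular (≡-dec ℕ._≟_) degree regular (ordinary v)
  ordinary-triangular v = record
    { Good        = Good v
    ; exponent    = exponent v
    ; next-unique = λ {C} _ → columns-unique m (Vec.map (_∸ v) α) C
    ; next-self   = λ (C∈ , _) → columns-self (Vec.map (_∸ v) α) C∈
    ; diagonal    = λ {C} → diagonal-entry C
    ; descent     = λ {C} {D} good D∈ C≢D → descend C D good D∈ C≢D (holds? α (suc v) (suc v) C D)
    }
    where
    diagonal-entry : ∀ C → Good v C → entry (ordinary v) C C ≈ mon (exponent v C)
    diagonal-entry C (C∈ , distinct) = begin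
      entry (ordinary v) C C
        ≈⟨ ifYes-yes (holds? α (suc v) (suc v) C C) (diagonal α (suc v) C
             ((λ i _ → proj₁ (∈-states⁻ C∈ i) , ℕ.≤-refl) , distinct)) ⟩
      monomialTerm w c (dnStep α (suc v) (suc v) C C)
        ≡⟨ cong (monomialTerm w c) (dnStep-diagonal α (suc v) C) ⟩
      mon (x^ w) * mon t ^ c * 1#
        ≈⟨ *-identityʳ _ ⟩
      mon (x^ w) * mon t ^ c
        ≈⟨ *-congˡ (mon-power c) ⟨
      mon (x^ w) * mon (power c)
        ≈⟨ mon-⊕ _ _ ⟨
      mon (exponent v C) ∎
      where
      w = weightStep α (suc v) (suc v) C C variables
      c = coinvStep α (suc v) (suc v) C C

    descend : ∀ C D → Good v C → D ∈ next (ordinary v) C → C ≢ D →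
      (holds : Dec (Holds α (suc v) (suc v) C D)) →
      (Good v D × degree (exponent v D) < degree (exponent v C)) ⊎
      ifYes holds (monomialTerm (weightStep α (suc v) (suc v) C D variables)
        (coinvStep α (suc v) (suc v) C D) (dnStep α (suc v) (suc v) C D)) ≈ 0#
    descend C D good D∈ C≢D (no _) = inj₂ ≈-refl
    descend C D (C∈ , _) D∈ C≢D (yes holds) = inj₁ ((D∈states , proj₂ (admissible holds)) ,
      subst₂ _<_ (≡.sym (degree-exponent v D∈states)) (≡.sym (degree-exponent v C∈))
        (total-< α (suc v) C D (λ i v≤ → proj₂ (proj₁ (admissible holds) i v≤)) (frozen (suc v) v D∈) C≢D))
      where
      D∈states : D ∈ states m n
      D∈states = next⊆states (suc v) v C∈ D∈

  -- Entries of the special step are coefficients independent of k. A nonzero one leads to a column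
  -- with distinct entries, which is the `Good` state from which the ordinary steps must start.
  expSum-blocks : ∀ N v {C} → C ∈ states m n → IsExpSum U (λ k → blocks k N v C)
  expSum-blocks zero    v     C∈ = expSum-const 1#
  expSum-blocks (suc N) v {C} C∈ = expSum-sum (next (special v) C) λ D D∈ →
    summand D (next⊆states v v C∈ D∈) (holds? α v (suc v) C D)
    where
    summand : ∀ D → D ∈ states m n → (holds : Dec (Holds α v (suc v) C D)) → IsExpSum U (λ k →
      ifYes holds (monomialTerm (weightStep α v (suc v) C D variables)
        (coinvStep α v (suc v) C D) (dnStep α v (suc v) C D)) *
      iterate (ordinary v) k (blocks k N (suc v)) D)
    summand D D∈ (no _)      = expSum-cong (λ k → ≈-sym (zeroˡ _)) expSum-0
    summand D D∈ (yes holds) = expSum-*ˡ _ (Triangular.expSum-iterate-diagonal (ordinary-triangular v)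
      (states-unique m n) (λ {C} → next⊆states (suc v) v {C}) (λ k → blocks k N (suc v))
      (expSum-blocks N (suc v)) D∈ (D∈ , proj₂ (admissible holds)))

  expSum-run : ∀ {β} → β ∈ states m n →
    IsExpSum U (λ k → run m (suc k · α) 0 (suc k ℕ.* maximum α) β)
  expSum-run {β} β∈ = expSum-cong
    (λ k → ≈-sym (≈-trans
      (reflexive (cong (λ j → run m (suc k · α) j (suc k ℕ.* maximum α) β) (≡.sym (ℕ.*-zeroʳ (suc k)))))
      (run-blocks k (maximum α) 0 β)))
    (expSum-blocks (maximum α) 0 β∈)

  module _ (β : Vec ℕ n) (β∈ : β ∈ states m n)
    {Φ : ∀ ℓ → Pred (Filling ℓ) 0ℓ} (Φ? : ∀ ℓ → Decidable (Φ ℓ))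
    (Φ⇒ : ∀ ℓ K ℓ≤K T → Φ ℓ T → Global.Steps β ℓ T K ℓ≤K (Holds ℓ))
    (⇒Φ : ∀ ℓ K ℓ≤K T → Global.Steps β ℓ T K ℓ≤K (Holds ℓ) → Φ ℓ T)
    (f : Vec ℕ variables → ℕ → ℕ → Carrier) (f≈ : ∀ w c d → monomialTerm w c d ≈ f w c d)
    where

    -- With the summand as a parameter this reduces to the definitions of `atom` and
    -- `hallLittlewood`; `f≈` accounts for the trivial factors in the case of atoms.
    generatingFunction : Vec ℕ n → Carrier
    generatingFunction ℓ = sumOver (filter (Φ? ℓ) (fillings m ℓ)) λ T →
      f (Augmented.weight β ℓ T variables) (Augmented.coinv β ℓ T) (Augmented.dn β ℓ T)

    generatingFunction-recurrence :
      SimpleRootRecurrence (CommutativeRing.rawRing commutativeRing) (λ k → generatingFunction (k · α))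
    generatingFunction-recurrence = SimpleRoots.expSum⇒recurrence monomialRing _≟_ mon-injective
      (λ k → generatingFunction (k · α)) (expSum-cong run-generating (expSum-run β∈))
      where
      run-generating : ∀ k → run m (suc k · α) 0 (suc k ℕ.* maximum α) β ≈ generatingFunction (suc k · α)
      run-generating k = ≈-trans
        (≈-sym (sum-run m β ℓ K ℓ≤K (Φ? ℓ) (Φ⇒ ℓ K ℓ≤K) (⇒Φ ℓ K ℓ≤K)))
        (sum-cong (filter (Φ? ℓ) (fillings m ℓ)) λ T → f≈ _ _ _)
        where
        ℓ   = suc k · α
        K   = suc k ℕ.* maximum α
        ℓ≤K = ·-≤ (suc k) α

-- The two families of fillings.

open Polynomial using (_∙_; polyMonomialRing; monomial-injective; monomial-difference-regular)

ssafCondition nawfCondition : StepCondition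
ssafCondition = record
  { Holds      = SSAFStep
  ; holds?     = ssafStep?
  ; admissible = proj₁
  ; same       = λ {C = C} {D} step → ssafStep-same step {C} {D}
  ; diagonal   = ssafStep-diagonal
  }
nawfCondition = record
  { Holds      = NAWFStep
  ; holds?     = nawfStep?
  ; admissible = proj₁
  ; same       = λ {C = C} {D} step → nawfStep-same step {C} {D}
  ; diagonal   = nawfStep-diagonal
  }

-- For atoms the statistics coinv and dn are to be ignored: t and s are 1.
atomRing : ℕ → WeightedRing
atomRing m = record
  { monomialRing = polyMonomialRing {m}
  ; degree       = weightedDegree
  ; degree-⊕     = weightedDegree-+
  ; degree-𝟘     = weightedDegree-0 m
  ; regular      = monomial-difference-regular weightedDegree weightedDegree-+
  ; _≟_          = ≡-dec ℕ._≟_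
  ; mon-injective = monomial-injective
  ; variables    = m
  ; x^_          = id
  ; x^-+         = λ _ _ → ≡.refl
  ; x^-0         = ≡.refl
  ; degree-x     = λ _ → ≡.refl
  ; t            = replicate m 0
  ; degree-t     = weightedDegree-0 m
  ; s            = monomial (replicate m 0)
  }

hallLittlewoodRing : ℕ → WeightedRing
hallLittlewoodRing n = record
  { monomialRing = polyMonomialRing {suc n}
  -- The tail discards the exponent of t, the variable of index zero.
  ; degree       = weightedDegree ∘ Vec.tail
  ; degree-⊕     = degree-∙
  ; degree-𝟘     = weightedDegree-0 n
  ; regular      = monomial-difference-regular (weightedDegree ∘ Vec.tail) degree-∙
  ; _≟_          = ≡-dec ℕ._≟_
  ; mon-injective = monomial-injective
  ; variables    = n
  ; x^_          = 0 ∷_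
  ; x^-+         = λ _ _ → ≡.refl
  ; x^-0         = ≡.refl
  ; degree-x     = λ _ → ≡.refl
  ; t            = 1 ∷ replicate n 0
  ; degree-t     = weightedDegree-0 n
  ; s            = 1# + (- monomial (1 ∷ replicate n 0))
  }
  where
  open MonomialRing (polyMonomialRing {suc n}) using (1#; _+_; -_)

  degree-∙ : ∀ (d e : Monomial (suc n)) →
    weightedDegree (Vec.tail (d ∙ e)) ≡ weightedDegree (Vec.tail d) ℕ.+ weightedDegree (Vec.tail e)
  degree-∙ (_ ∷ d) (_ ∷ e) = weightedDegree-+ d e

basement∈states : ∀ {n} (β : Vec ℕ n) → All (1 ≤_) β → β ∈ states (maximum β) n
basement∈states β 1≤β = ∈-states⁺ β λ i → All.lookup⁺ 1≤β i , lookup≤maximum β i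

atom-recurrence : ∀ {n} (α β : Vec ℕ n) → All (1 ≤_) β →
  SimpleRootRecurrence (polyRing (maximum β)) (λ k → atom β (k · α))
atom-recurrence α β 1≤β = Stretched.generatingFunction-recurrence (atomRing m) ssafCondition m ℕ.≤-refl α
  β (basement∈states β 1≤β) (Augmented.isSSAF? β)
  (λ ℓ K ℓ≤K T → Global.ssaf⇒steps β ℓ T K ℓ≤K)
  (λ ℓ K ℓ≤K T → Global.steps⇒ssaf β ℓ T K ℓ≤K)
  (λ w _ _ → monomial w)
  (Generating.monomialTerm-trivial (atomRing m) ssafCondition (λ _ → ≡.refl) (λ _ → ≡.refl))
  where
  m = maximum β

standardBasement-unique : ∀ n → Unique (standardBasement n)
standardBasement-unique n = Unique.tabulate⁺ (Fin.toℕ-injective ∘ ℕ.suc-injective)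

standardBasement-positive : ∀ n → All (1 ≤_) (standardBasement n)
standardBasement-positive n = All.tabulate⁺ λ _ → s≤s z≤n

maximum-≤ : ∀ {n m} (v : Vec ℕ n) → (∀ i → lookup v i ≤ m) → maximum v ≤ m
maximum-≤ []      h = z≤n
maximum-≤ (x ∷ v) h = ℕ.⊔-lub (h zero) (maximum-≤ v (h ∘ suc))

-- Entries range up to `maximum β`, whereas the ring has n variables x; every content needs its
-- variable.
standardBasement-maximum : ∀ n → maximum (standardBasement n) ≤ n
standardBasement-maximum n = maximum-≤ (standardBasement n) λ i →
  subst (_≤ n) (≡.sym (lookup∘tabulate (suc ∘ toℕ) i)) (Fin.toℕ<n i)

hallLittlewood-recurrence : ∀ {n} (α : Vec ℕ n) →
  SimpleRootRecurrence (polyRing (suc n)) (λ k → hallLittlewood (k · α))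
hallLittlewood-recurrence {n} α = Stretched.generatingFunction-recurrence
  (hallLittlewoodRing n) nawfCondition (maximum β) (standardBasement-maximum n) α
  β (basement∈states β (standardBasement-positive n)) (Augmented.isNAWF? β)
  (λ ℓ K ℓ≤K T → Global.nawf⇒steps β ℓ T K ℓ≤K)
  (λ ℓ K ℓ≤K T → Global.steps⇒nawf β ℓ T K ℓ≤K (standardBasement-unique n))
  (Generating.monomialTerm (hallLittlewoodRing n) nawfCondition) (λ _ _ _ _ → ≡.refl)
  where
  β = standardBasement n

corollary14 : (n : ℕ) → 1 ≤ n → (α β : Vec ℕ n) → All (1 ≤_) β → Unique β →
    SimpleRootRecurrence (polyRing (maximum β)) (λ k → atom β (k · α)) ×
    SimpleRootRecurrence (polyRing (suc n)) (λ k → hallLittlewood (k · α))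
corollary14 n _ α β 1≤β _ = atom-recurrence α β 1≤β , hallLittlewood-recurrence α
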